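{- Let $D\geq 1$ be an integer. Every $\left(\frac{4D+3}{2(D+1)},\frac{1}{2(D+1)}\right)$-sparse multigraph $G$ has a $(D,\mathrm{F})$-coloring, i.e. a partition $(M,F)$ of $V(G)$ such that $G[M]$ is a forest with maximum degree at most $D$ and $G[F]$ is a forest.
   Context: All multigraphs are loopless. For $a>0$ and real $b$, a multigraph $H$ is $(a,b)$-sparse if it is loopless and for every $A\subseteq V(H)$ with $|A|\geq 2$, the induced subgraph $H[A]$ has at most $a|A|+b$ edges (counted with multiplicity). A forest is an acyclic multigraph; in particular a pair of parallel edges forms a cycle (a 2-cycle), so a forest has no multiple edges. -}

module Defs where

open import Data.Nat using (ℕ; zero; suc; _+_; _*_; _≤_; _≡ᵇ_)
open import Data.Bool using (Bool; true; false; _∧_; _∨_)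
open import Data.Fin using (Fin; zero; suc; toℕ; inject₁; fromℕ)
open import Data.Fin.Subset using (Subset; _∈_; ∣_∣; ∁)
open import Data.Vec using (lookup)
open import Data.List using (List; length; filterᵇ; allFin)
open import Data.Product using (Σ; ∃; ∃-syntax; _×_; _,_; proj₁; proj₂)
open import Data.Sum using (_⊎_)
open import Data.Empty using (⊥)
open import Function.Definitions using (Injective)
open import Relation.Binary.PropositionalEquality using (_≡_; _≢_)

-- A loopless multigraph on vertex set Fin n with m edges (edges are labelled
-- by Fin m, so parallel edges are allowed); edge e joins ends e = (u , v).
record Multigraph : Set where
  field
    n        : ℕ
    m        : ℕ
    ends     : Fin m → Fin n × Fin n
    loopless : ∀ e → proj₁ (ends e) ≢ proj₂ (ends e)

open Multigraph public

Joins : (G : Multigraph) → Fin (m G) → Fin (n G) → Fin (n G) → Set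
Joins G e u v = ends G e ≡ (u , v) ⊎ ends G e ≡ (v , u)

edgesIn : (G : Multigraph) → Subset (n G) → ℕ
edgesIn G A =
  length (filterᵇ (λ e → lookup A (proj₁ (ends G e)) ∧ lookup A (proj₂ (ends G e)))
                  (allFin (m G)))

degreeIn : (G : Multigraph) → Subset (n G) → Fin (n G) → ℕ
degreeIn G A v =
  length (filterᵇ (λ e → ((toℕ (proj₁ (ends G e)) ≡ᵇ toℕ v) ∧ lookup A (proj₂ (ends G e)))
                       ∨ ((toℕ (proj₂ (ends G e)) ≡ᵇ toℕ v) ∧ lookup A (proj₁ (ends G e))))
                  (allFin (m G)))

-- (a,b)-sparse with a = (4D+3)/(2(D+1)), b = 1/(2(D+1)), cleared of
-- denominators: for all A with |A| ≥ 2, 2(D+1)·e(G[A]) ≤ (4D+3)|A| + 1.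
SparseD : ℕ → Multigraph → Set
SparseD D G = ∀ (A : Subset (n G)) → 2 ≤ ∣ A ∣ →
  2 * (suc D) * edgesIn G A ≤ (4 * D + 3) * ∣ A ∣ + 1

-- A cycle in G[A] of length k+2: distinct vertices vs 0..k+1 of A and distinct
-- edges es 0..k+1, edge es i joining vs i and vs (i+1), edge es (k+1)
-- joining vs (k+1) and vs 0. (Length 2 = a pair of parallel edges.)
record CycleIn (G : Multigraph) (A : Subset (n G)) : Set where
  field
    k        : ℕ
    vs       : Fin (suc (suc k)) → Fin (n G)
    es       : Fin (suc (suc k)) → Fin (m G)
    vs-inj   : Injective _≡_ _≡_ vs
    es-inj   : Injective _≡_ _≡_ es
    vs-in    : ∀ i → vs i ∈ A
    step     : ∀ (i : Fin (suc k)) → Joins G (es (inject₁ i)) (vs (inject₁ i)) (vs (suc i))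
    close    : Joins G (es (fromℕ (suc k))) (vs (fromℕ (suc k))) (vs zero)

IsForestOn : (G : Multigraph) → Subset (n G) → Set
IsForestOn G A = CycleIn G A → ⊥

MaxDegOn≤ : (G : Multigraph) → Subset (n G) → ℕ → Set
MaxDegOn≤ G A D = ∀ v → v ∈ A → degreeIn G A v ≤ D

DFColoring : ℕ → Multigraph → Set
DFColoring D G = ∃[ M ] (IsForestOn G M × MaxDegOn≤ G M D × IsForestOn G (∁ M))

{-# OPTIONS --safe #-}

-- Let every vertex v carry a load β v ≤ D + 1, the part of its degree in M that is
-- already used up (load D + 1 forces v into F), and give a vertex set A the potential
-- ρ A = Σ (4D + 3 − 2 β v) − 2 (D + 1) e(A). By induction on the number of vertices, a
-- coloring exists as soon as ρ ≥ −1 on all sets with at least two vertices. Coloring a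
-- proper set A and contracting it (A ∩ F becomes a single vertex of load D + 1) shows that
-- in a minimal counterexample every proper set with at least two vertices has potential at
-- least 5, or 4 if D = 1. Hence, after deleting a vertex, the loads of its neighbours may be
-- raised, which reserves room in M for that vertex. The charges
-- 4D + 3 − 2 β v − (D + 1) deg v sum to ρ V ≥ −1, and a vertex of charge above −1 has degree
-- 3 and load below D, or is removed at once. For D ≥ 2 such a vertex is removed by raising
-- the loads of its three neighbours. For D = 1 it has charge 1; further reductions show that
-- a vertex of charge −c has at most 2c neighbours of charge 1, and counting leaves only a
-- graph with five vertices.

module Submission where

open import Data.Bool using (Bool; true; false; _∧_; _∨_; not; if_then_else_)
import Data.Bool as Bool
open import Data.Bool.Properties using (∧-zeroʳ; ∨-zeroʳ; ∨-identityʳ)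
open import Data.Empty using (⊥; ⊥-elim)
open import Data.Fin using (Fin; zero; suc; toℕ; inject₁; fromℕ)
open import Data.Fin.Properties using (_≟_; all?; any?; toℕ-injective)
open import Data.Fin.Relation.Unary.Top using (view; ‵fromℕ; ‵inj₁)
import Data.Fin.Subset as Sub
open import Data.Fin.Subset.Properties using (anySubset?)
open import Data.Integer hiding (suc; _≟_; _⊔_)
open import Data.Integer.Properties hiding (_≟_)
import Data.Integer.Properties as ℤ
open import Data.Integer.Tactic.RingSolver using (solve; solve-∀)
open import Data.List as List using ([]; _∷_; length; filterᵇ)
open import Data.Nat as ℕ using (ℕ)
import Data.Nat.Properties as ℕ
open import Data.Product using (∃-syntax; _×_; _,_; proj₁; proj₂)
open import Data.Sum using (_⊎_; inj₁; inj₂)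
open import Data.Vec as Vec using (Vec; lookup; tabulate)
open import Data.Vec.Properties using (lookup∘tabulate; []=⇒lookup; lookup-map)
open import Data.Vec.Relation.Unary.All as All using (All)
open import Function using (_∘_; case_of_)
open import Relation.Binary.PropositionalEquality
open import Relation.Nullary using (¬_; Dec; yes; no; does)
open import Relation.Nullary.Decidable using (dec-true; dec-false; _×-dec_)

-- The two gap values are a matter of prices. A unit of load costs 2, so room at all three
-- neighbours of a deleted vertex costs 6, and potential 5 is just enough to stay at -1. The gap is
-- raised one unit at a time: sets of potential exactly `g` can be contracted as long as the vertex
-- that replaces their F-part, of weight 4D + 3 - 2 (D + 1) = 2D + 1, pays for `g`. For D ≥ 2 this
-- reaches 5; for D = 1 the last step starts from 3 and ends at 4, which pays for two units of load
-- only. Hence every reduction for D = 1 must avoid paying for one of the neighbours: it is certain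
-- to be in F, or is deleted as well, or subdivides a new edge and thereby goes to F. Loads make the
-- statement inductive: contracting a colored set turns the edges into its M-part into load at their
-- outer ends. There is no argument from a minimal counterexample. Each step returns either a
-- coloring or the next structural fact, and violating sets are found by exhaustive search.

private variable N : ℕ

-- Integer inequalities and sums

infixr 5 _⊕_
_⊕_ : ∀ {a b c d} → a ≤ b → c ≤ d → a + c ≤ b + d
_⊕_ = +-mono-≤

-- Linear arithmetic by certificate: the hypotheses are added up with `_⊕_`, each as often as its
-- coefficient demands, and the ring solver checks that both inequalities have the same difference
-- of sides. Products enter as further hypotheses through `*-nonneg`.
lin : ∀ {a b c d} → a ≤ b → d - c ≡ b - a → c ≤ d
lin p eq = 0≤i-j⇒j≤i (subst (0ℤ ≤_) (sym eq) (i≤j⇒0≤j-i p))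

0≤+ : ∀ k → 0ℤ ≤ + k
0≤+ k = +≤+ ℕ.z≤n

padʳ : ∀ {a b c} → a ≤ b → 0ℤ ≤ c → a ≤ b + c
padʳ {a} {b} {c} p q = subst (_≤ b + c) (+-identityʳ a) (p ⊕ q)

padˡ : ∀ {a b c} → 0ℤ ≤ b → a ≤ c → a ≤ b + c
padˡ {a} {b} {c} p q = subst (_≤ b + c) (+-identityˡ a) (p ⊕ q)

*-nonneg : ∀ {a b} → 0ℤ ≤ a → 0ℤ ≤ b → 0ℤ ≤ a * b
*-nonneg {+ a} {+ b} _ _ = subst (0ℤ ≤_) (pos-* a b) (0≤+ (a ℕ.* b))

*-monoˡ : ∀ k {a b} → 0ℤ ≤ k → a ≤ b → k * a ≤ k * b
*-monoˡ (+ k) 0≤k p = *-monoˡ-≤-nonNeg (+ k) p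

n≤0⊎1≤n : ∀ n → n ≤ 0ℤ ⊎ 1ℤ ≤ n
n≤0⊎1≤n (+ ℕ.zero) = inj₁ ≤-refl
n≤0⊎1≤n +[1+ n ]  = inj₂ (+≤+ (ℕ.s≤s ℕ.z≤n))
n≤0⊎1≤n -[1+ n ]  = inj₁ -≤+

infix 4 _≤⊎>_
_≤⊎>_ : ∀ a b → a ≤ b ⊎ b + 1ℤ ≤ a
a ≤⊎> b with n≤0⊎1≤n (a - b)
... | inj₁ p = inj₁ (lin p (solve (a ∷ b ∷ [])))
... | inj₂ p = inj₂ (lin p (solve (a ∷ b ∷ [])))

1≰0 : ¬ (1ℤ ≤ 0ℤ)
1≰0 (+≤+ ())

opaque
  sum : (Fin N → ℤ) → ℤ
  sum {ℕ.zero}  f = 0ℤ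
  sum {ℕ.suc N} f = f zero + sum (f ∘ suc)

  ∑-suc : (f : Fin (ℕ.suc N) → ℤ) → sum f ≡ f zero + sum (f ∘ suc)
  ∑-suc f = refl

  ∑-cong : {f g : Fin N → ℤ} → (∀ i → f i ≡ g i) → sum f ≡ sum g
  ∑-cong {ℕ.zero}  p = refl
  ∑-cong {ℕ.suc N} p = cong₂ _+_ (p zero) (∑-cong (p ∘ suc))

  ∑-+ : (f g : Fin N → ℤ) → sum (λ i → f i + g i) ≡ sum f + sum g
  ∑-+ {ℕ.zero}  f g = refl
  ∑-+ {ℕ.suc N} f g = trans (cong (_+_ (f zero + g zero)) (∑-+ (f ∘ suc) (g ∘ suc))) (interchange (f zero) (g zero) (sum (f ∘ suc)) (sum (g ∘ suc)))
    where
    interchange : ∀ a b c d → a + b + (c + d) ≡ a + c + (b + d)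
    interchange = solve-∀

  ∑-*ˡ : ∀ x (f : Fin N → ℤ) → x * sum f ≡ sum (λ i → x * f i)
  ∑-*ˡ {ℕ.zero}  x f = *-zeroʳ x
  ∑-*ˡ {ℕ.suc N} x f = trans (*-distribˡ-+ x (f zero) _) (cong (_+_ (x * f zero)) (∑-*ˡ x (f ∘ suc)))

  ∑-mono : {f g : Fin N → ℤ} → (∀ i → f i ≤ g i) → sum f ≤ sum g
  ∑-mono {ℕ.zero}  p = ≤-refl
  ∑-mono {ℕ.suc N} p = p zero ⊕ ∑-mono (p ∘ suc)

  ∑-zero : {f : Fin N → ℤ} → (∀ i → f i ≡ 0ℤ) → sum f ≡ 0ℤ
  ∑-zero {ℕ.zero}  p = refl
  ∑-zero {ℕ.suc N} p = cong₂ _+_ (p zero) (∑-zero (p ∘ suc))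

  ∑-nonneg : {f : Fin N → ℤ} → (∀ i → 0ℤ ≤ f i) → 0ℤ ≤ sum f
  ∑-nonneg {N} {f} p = subst (_≤ sum f) (∑-zero {N} {λ _ → 0ℤ} λ _ → refl) (∑-mono {N} {λ _ → 0ℤ} p)

  ∑-term : {f : Fin N → ℤ} → (∀ i → 0ℤ ≤ f i) → ∀ i → f i ≤ sum f
  ∑-term {f = f} p zero    = subst (_≤ sum f) (+-identityʳ (f zero)) (≤-refl {f zero} ⊕ ∑-nonneg (p ∘ suc))
  ∑-term {f = f} p (suc i) = subst (_≤ sum f) (+-identityˡ (f (suc i))) (p zero ⊕ ∑-term (p ∘ suc) i)

  ∑-positive : {f : Fin N → ℤ} → 1ℤ ≤ sum f → ∃[ i ] 1ℤ ≤ f i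
  ∑-positive {ℕ.zero} p = ⊥-elim (1≰0 p)
  ∑-positive {ℕ.suc N} {f} p with n≤0⊎1≤n (f zero)
  ... | inj₂ q = zero , q
  ... | inj₁ q with n≤0⊎1≤n (sum (f ∘ suc))
  ...   | inj₁ r = ⊥-elim (1≰0 (≤-trans p (q ⊕ r)))
  ...   | inj₂ r with ∑-positive r
  ...     | i , s = suc i , s

  ∑-comm : ∀ {M} (f : Fin M → Fin N → ℤ) → sum (λ i → sum (f i)) ≡ sum (λ j → sum (λ i → f i j))
  ∑-comm {N} {ℕ.zero}  f = sym (∑-zero {N} {λ _ → 0ℤ} λ _ → refl)
  ∑-comm {N} {ℕ.suc M} f = trans (cong (_+_ (sum (f zero))) (∑-comm (f ∘ suc))) (sym (∑-+ (f zero) (λ j → sum (λ i → f (suc i) j))))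

χ : Bool → ℤ
χ true  = 1ℤ
χ false = 0ℤ

χ≥0 : ∀ b → 0ℤ ≤ χ b
χ≥0 true  = 0≤+ 1
χ≥0 false = ≤-refl

χ≤1 : ∀ b → χ b ≤ 1ℤ
χ≤1 true  = ≤-refl
χ≤1 false = 0≤+ 1

opaque
  _==_ : Fin N → Fin N → Bool
  u == v = does (u ≟ v)

  ==-refl : (v : Fin N) → (v == v) ≡ true
  ==-refl v = dec-true (v ≟ v) refl

  ==-≢ : {u v : Fin N} → u ≢ v → (u == v) ≡ false
  ==-≢ {u = u} {v} = dec-false (u ≟ v)

δ : Fin N → Fin N → ℤ
δ u v = χ (u == v)

opaque
  unfolding sum _==_

  ∑-δ : (v : Fin N) (f : Fin N → ℤ) → sum (λ u → δ v u * f u) ≡ f v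
  ∑-δ zero    f = trans (cong₂ _+_ (*-identityˡ (f zero)) (∑-zero λ i → *-zeroˡ (f (suc i)))) (+-identityʳ _)
  ∑-δ (suc v) f = trans (cong₂ _+_ (*-zeroˡ (f zero)) (∑-δ v (f ∘ suc))) (+-identityˡ _)

-- Vertex sets and their indicator functions

infixl 6 _⊞_
_⊞_ : (Fin N → ℤ) → (Fin N → ℤ) → Fin N → ℤ
(a ⊞ b) u = a u + b u

VSet : ℕ → Set
VSet N = Fin N → Bool

⟦_⟧ : VSet N → Fin N → ℤ
⟦ A ⟧ u = χ (A u)

⟦⟧≥0 : (A : VSet N) → ∀ u → 0ℤ ≤ ⟦ A ⟧ u
⟦⟧≥0 A u = χ≥0 (A u)

infix 4 _∈_ _∉_ _⊆_
-- A record instead of the bare equation `A u ≡ true`, from which unification could not recover `A`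
-- and `u`.
record _∈_ (u : Fin N) (A : VSet N) : Set where
  constructor mem
  field is-true : A u ≡ true

record _∉_ (u : Fin N) (A : VSet N) : Set where
  constructor nmem
  field is-false : A u ≡ false

open _∈_ public
open _∉_ public

_⊆_ : VSet N → VSet N → Set
A ⊆ B = ∀ u → u ∈ A → u ∈ B

∈-contra : {A : VSet N} {u : Fin N} {C : Set} → u ∈ A → u ∉ A → C
∈-contra (mem p) (nmem q) with trans (sym p) q
... | ()

_∈?_ : (u : Fin N) (A : VSet N) → u ∈ A ⊎ u ∉ A
u ∈? A with A u in eq
... | true  = inj₁ (mem eq)
... | false = inj₂ (nmem eq)

χ-mono : ∀ {a b} → (a ≡ true → b ≡ true) → χ a ≤ χ b
χ-mono {true}  p rewrite p refl = ≤-refl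
χ-mono {false} {b} p = χ≥0 b

⟦⟧-mono : {A B : VSet N} → A ⊆ B → ∀ u → ⟦ A ⟧ u ≤ ⟦ B ⟧ u
⟦⟧-mono s u = χ-mono λ p → is-true (s u (mem p))

⟦⟧-≐ : {A B : VSet N} → A ⊆ B → B ⊆ A → ∀ u → ⟦ A ⟧ u ≡ ⟦ B ⟧ u
⟦⟧-≐ s t u = ≤-antisym (⟦⟧-mono s u) (⟦⟧-mono t u)

∉-⊆ : {A B : VSet N} {u : Fin N} → A ⊆ B → u ∉ B → u ∉ A
∉-⊆ {A = A} {u = u} s q = case u ∈? A of λ { (inj₁ p) → ∈-contra (s u p) q ; (inj₂ r) → r }

⟦⟧-∈ : {A : VSet N} {u : Fin N} → u ∈ A → ⟦ A ⟧ u ≡ 1ℤ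
⟦⟧-∈ (mem p) = cong χ p

⟦⟧-∉ : {A : VSet N} {u : Fin N} → u ∉ A → ⟦ A ⟧ u ≡ 0ℤ
⟦⟧-∉ (nmem p) = cong χ p

size : VSet N → ℤ
size A = sum ⟦ A ⟧

infixl 7 _∩_ _∖_ _−_
infixl 6 _∪_ _⁺_
opaque
  _∩_ _∖_ _∪_ : VSet N → VSet N → VSet N
  (A ∩ B) u = A u ∧ B u
  (A ∖ B) u = A u ∧ not (B u)
  (A ∪ B) u = A u ∨ B u

  _−_ _⁺_ : VSet N → Fin N → VSet N
  (A − v) u = A u ∧ not (v == u)
  (A ⁺ v) u = A u ∨ (v == u)

∧-true : ∀ {a b} → a ∧ b ≡ true → a ≡ true × b ≡ true
∧-true {true} p = refl , p

not-true : ∀ {b} → not b ≡ true → b ≡ false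
not-true {false} _ = refl

module _ {A B : VSet N} {u : Fin N} where

  opaque
    unfolding _∩_

    ∈-∩⁺ : u ∈ A → u ∈ B → u ∈ A ∩ B
    ∈-∩⁺ (mem p) (mem q) = mem (cong₂ _∧_ p q)

    ∈-∩ˡ : u ∈ A ∩ B → u ∈ A
    ∈-∩ˡ (mem p) = mem (proj₁ (∧-true p))

    ∈-∩ʳ : u ∈ A ∩ B → u ∈ B
    ∈-∩ʳ (mem p) = mem (proj₂ (∧-true {A u} p))

    ∈-∖⁺ : u ∈ A → u ∉ B → u ∈ A ∖ B
    ∈-∖⁺ (mem p) (nmem q) = mem (cong₂ (λ a b → a ∧ not b) p q)

    ∈-∖ˡ : u ∈ A ∖ B → u ∈ A
    ∈-∖ˡ (mem p) = mem (proj₁ (∧-true p))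

    ∈-∖ʳ : u ∈ A ∖ B → u ∉ B
    ∈-∖ʳ (mem p) = nmem (not-true (proj₂ (∧-true {A u} p)))

    ∈-∪ˡ : u ∈ A → u ∈ A ∪ B
    ∈-∪ˡ (mem p) = mem (cong (_∨ B u) p)

    ∈-∪ʳ : u ∈ B → u ∈ A ∪ B
    ∈-∪ʳ (mem p) = mem (trans (cong (A u ∨_) p) (∨-zeroʳ (A u)))

    ∈-∪⁻ : u ∈ A ∪ B → u ∈ A ⊎ u ∈ B
    ∈-∪⁻ (mem p) with A u in eq
    ... | true  = inj₁ (mem eq)
    ... | false = inj₂ (mem p)

    ∉-∪ : u ∉ A → u ∉ B → u ∉ A ∪ B
    ∉-∪ (nmem p) (nmem q) = nmem (cong₂ _∨_ p q)

module _ {A : VSet N} {v : Fin N} where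

  opaque
    unfolding _∩_ _==_

    ∈-−⁺ : ∀ {u} → u ∈ A → v ≢ u → u ∈ A − v
    ∈-−⁺ (mem p) q = mem (cong₂ (λ a b → a ∧ not b) p (==-≢ q))

    ∈-−ˡ : ∀ {u} → u ∈ A − v → u ∈ A
    ∈-−ˡ (mem p) = mem (proj₁ (∧-true p))

    ∈-−ʳ : ∀ {u} → u ∈ A − v → v ≢ u
    ∈-−ʳ {u} (mem p) refl with trans (sym (not-true (proj₂ (∧-true {A u} p)))) (==-refl v)
    ... | ()

    ∉-− : v ∉ A − v
    ∉-− = nmem (trans (cong (λ b → A v ∧ not b) (==-refl v)) (∧-zeroʳ (A v)))

    ∈-⁺ˡ : ∀ {u} → u ∈ A → u ∈ A ⁺ v
    ∈-⁺ˡ {u} (mem p) = mem (cong (_∨ (v == u)) p)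

    ∈-⁺≡ : v ∈ A ⁺ v
    ∈-⁺≡ = mem (trans (cong (A v ∨_) (==-refl v)) (∨-zeroʳ (A v)))

    ∈-⁺⁻ : ∀ {u} → u ∈ A ⁺ v → v ≡ u ⊎ u ∈ A
    ∈-⁺⁻ {u} (mem p) with v ≟ u
    ... | yes q = inj₁ q
    ... | no  _ = inj₂ (mem (trans (sym (∨-identityʳ (A u))) p))

    ∉-⁺ : ∀ {u} → v ≢ u → u ∉ A → u ∉ A ⁺ v
    ∉-⁺ q (nmem p) = nmem (cong₂ _∨_ p (==-≢ q))

opaque
  unfolding _∩_ _==_

  ⟦⟧-remove : {A : VSet N} {v : Fin N} → v ∈ A → ∀ u → ⟦ A ⟧ u ≡ (⟦ A − v ⟧ ⊞ δ v) u
  ⟦⟧-remove {A = A} {v} (mem v∈A) u with v ≟ u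
  ... | yes refl rewrite v∈A = refl
  ... | no  _ with A u
  ...   | true  = refl
  ...   | false = refl

  ⟦⟧-remove-∉ : {A : VSet N} {v : Fin N} → v ∉ A → ∀ u → ⟦ A ⟧ u ≡ ⟦ A − v ⟧ u
  ⟦⟧-remove-∉ {A = A} {v} (nmem v∉A) u with v ≟ u
  ... | yes refl rewrite v∉A = refl
  ... | no  _ with A u
  ...   | true  = refl
  ...   | false = refl

  ⟦⟧-insert : {A : VSet N} {v : Fin N} → v ∉ A → ∀ u → ⟦ A ⁺ v ⟧ u ≡ (⟦ A ⟧ ⊞ δ v) u
  ⟦⟧-insert {A = A} {v} (nmem v∉A) u with v ≟ u
  ... | yes refl rewrite v∉A = refl
  ... | no  _ with A u
  ...   | true  = refl
  ...   | false = refl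

  ⟦⟧-∩∖ : (A B : VSet N) → ∀ u → ⟦ A ⟧ u ≡ (⟦ A ∩ B ⟧ ⊞ ⟦ A ∖ B ⟧) u
  ⟦⟧-∩∖ A B u with A u | B u
  ... | false | _     = refl
  ... | true  | false = refl
  ... | true  | true  = refl

  ⟦⟧-∪ : {A B : VSet N} → (∀ u → u ∈ A → u ∉ B) → ∀ u → ⟦ A ∪ B ⟧ u ≡ (⟦ A ⟧ ⊞ ⟦ B ⟧) u
  ⟦⟧-∪ {A = A} {B} disj u with A u in eq | B u in eq′
  ... | false | false = refl
  ... | false | true  = refl
  ... | true  | false = refl
  ... | true  | true  = ∈-contra {A = B} (mem eq′) (disj u (mem eq))

⟦⟧-split : {A S : VSet N} → A ⊆ S → ∀ u → ⟦ S ⟧ u ≡ (⟦ A ⟧ ⊞ ⟦ S ∖ A ⟧) u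
⟦⟧-split {A = A} {S} s u = trans (⟦⟧-∩∖ S A u) (cong (_+ ⟦ S ∖ A ⟧ u) (⟦⟧-≐ (λ _ → ∈-∩ʳ) (λ w p → ∈-∩⁺ (s w p) p) u))

size-remove : {A : VSet N} {v : Fin N} → v ∈ A → size A ≡ size (A − v) + 1ℤ
size-remove {A = A} {v} v∈A = begin
  size A                              ≡⟨ ∑-cong (⟦⟧-remove v∈A) ⟩
  sum (⟦ A − v ⟧ ⊞ δ v)               ≡⟨ ∑-+ ⟦ A − v ⟧ (δ v) ⟩
  size (A − v) + sum (δ v)            ≡⟨ cong (_+_ (size (A − v))) (∑-cong λ u → sym (*-identityʳ (δ v u))) ⟩
  size (A − v) + sum (λ u → δ v u * 1ℤ) ≡⟨ cong (_+_ (size (A − v))) (∑-δ v (λ _ → 1ℤ)) ⟩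
  size (A − v) + 1ℤ                   ∎
  where open ≡-Reasoning

size-mono : {A B : VSet N} → A ⊆ B → size A ≤ size B
size-mono s = ∑-mono (⟦⟧-mono s)

size-nonempty : {A : VSet N} {v : Fin N} → v ∈ A → 1ℤ ≤ size A
size-nonempty {A = A} {v} p = subst (_≤ size A) (⟦⟧-∈ p) (∑-term (⟦⟧≥0 A) v)

-- Adjacency matrices as bilinear forms

Mat : ℕ → Set
Mat N = Fin N → Fin N → ℤ

opaque
  row : Mat N → Fin N → (Fin N → ℤ) → ℤ
  row μ v a = sum λ u → a u * μ v u

  -- On the indicators of two disjoint sets this is the number of edges between them; on one set
  -- taken twice it is twice the number of edges inside.
  quad : Mat N → (Fin N → ℤ) → (Fin N → ℤ) → ℤ
  quad μ a b = sum λ u → a u * row μ u b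

  row-cong : (μ : Mat N) (v : Fin N) {a b : Fin N → ℤ} → (∀ u → a u ≡ b u) → row μ v a ≡ row μ v b
  row-cong μ v p = ∑-cong λ u → cong (_* μ v u) (p u)

  row-+ : (μ : Mat N) (v : Fin N) (a b : Fin N → ℤ) → row μ v (a ⊞ b) ≡ row μ v a + row μ v b
  row-+ μ v a b = trans (∑-cong λ u → *-distribʳ-+ (μ v u) (a u) (b u)) (∑-+ _ _)

  row-δ : (μ : Mat N) (v u : Fin N) → row μ v (δ u) ≡ μ v u
  row-δ μ v u = ∑-δ u (μ v)

  quad-cong : (μ : Mat N) {a a′ b b′ : Fin N → ℤ} → (∀ u → a u ≡ a′ u) → (∀ u → b u ≡ b′ u) → quad μ a b ≡ quad μ a′ b′
  quad-cong μ p q = ∑-cong λ u → cong₂ _*_ (p u) (row-cong μ u q)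

  quad-+ˡ : (μ : Mat N) (a a′ b : Fin N → ℤ) → quad μ (a ⊞ a′) b ≡ quad μ a b + quad μ a′ b
  quad-+ˡ μ a a′ b = trans (∑-cong λ u → *-distribʳ-+ (row μ u b) (a u) (a′ u)) (∑-+ _ _)

  quad-+ʳ : (μ : Mat N) (a b b′ : Fin N → ℤ) → quad μ a (b ⊞ b′) ≡ quad μ a b + quad μ a b′
  quad-+ʳ μ a b b′ = trans (∑-cong λ u → trans (cong (a u *_) (row-+ μ u b b′)) (*-distribˡ-+ (a u) _ _)) (∑-+ _ _)

  quad-δ : (μ : Mat N) (v : Fin N) (b : Fin N → ℤ) → quad μ (δ v) b ≡ row μ v b
  quad-δ μ v b = ∑-δ v (λ u → row μ u b)

  quad-sym : (μ : Mat N) → (∀ u v → μ u v ≡ μ v u) → ∀ a b → quad μ a b ≡ quad μ b a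
  quad-sym μ μ-sym a b = begin
    sum (λ u → a u * sum (λ v → b v * μ u v))   ≡⟨ ∑-cong (λ u → ∑-*ˡ (a u) _) ⟩
    sum (λ u → sum (λ v → a u * (b v * μ u v))) ≡⟨ ∑-comm (λ u v → a u * (b v * μ u v)) ⟩
    sum (λ v → sum (λ u → a u * (b v * μ u v))) ≡⟨ ∑-cong (λ v → ∑-cong λ u → trans (exch (a u) (b v) (μ u v)) (cong (λ t → b v * (a u * t)) (μ-sym u v))) ⟩
    sum (λ v → sum (λ u → b v * (a u * μ v u))) ≡⟨ ∑-cong (λ v → sym (∑-*ˡ (b v) _)) ⟩
    sum (λ v → b v * sum (λ u → a u * μ v u))   ∎
    where
    open ≡-Reasoning
    exch : ∀ x y z → x * (y * z) ≡ y * (x * z)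
    exch = solve-∀

module _ {μ : Mat N} (μ≥0 : ∀ u v → 0ℤ ≤ μ u v) where

  opaque
    unfolding row quad

    row-mono : ∀ v {a b : Fin N → ℤ} → (∀ u → a u ≤ b u) → row μ v a ≤ row μ v b
    row-mono v {a} {b} p = ∑-mono λ u → subst₂ _≤_ (*-comm (μ v u) (a u)) (*-comm (μ v u) (b u)) (*-monoˡ (μ v u) (μ≥0 v u) (p u))

    row≥0 : ∀ v {a : Fin N → ℤ} → (∀ u → 0ℤ ≤ a u) → 0ℤ ≤ row μ v a
    row≥0 v p = ∑-nonneg λ u → *-nonneg (p u) (μ≥0 v u)

    quad-monoʳ : {a b b′ : Fin N → ℤ} → (∀ u → 0ℤ ≤ a u) → (∀ u → b u ≤ b′ u) → quad μ a b ≤ quad μ a b′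
    quad-monoʳ {a} p q = ∑-mono λ u → *-monoˡ (a u) (p u) (row-mono u q)

    quad≥0 : {a b : Fin N → ℤ} → (∀ u → 0ℤ ≤ a u) → (∀ u → 0ℤ ≤ b u) → 0ℤ ≤ quad μ a b
    quad≥0 p q = ∑-nonneg λ u → *-nonneg (p u) (row≥0 u q)

    row-∈ : ∀ v {A : VSet N} {u} → u ∈ A → μ v u ≤ row μ v ⟦ A ⟧
    row-∈ v {A} {u} p = subst (_≤ row μ v ⟦ A ⟧) (trans (cong (_* μ v u) (⟦⟧-∈ p)) (*-identityˡ (μ v u))) (∑-term (λ w → *-nonneg (⟦⟧≥0 A w) (μ≥0 v w)) u)

-- Forests and colorings

record Mult (N : ℕ) : Set where
  field
    μ     : Mat N
    μ-sym : ∀ u v → μ u v ≡ μ v u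
    μ≥0   : ∀ u v → 0ℤ ≤ μ u v
    μ-irr : ∀ v → μ v v ≡ 0ℤ

nonempty? : (B : VSet N) → (∃[ u ] u ∈ B) ⊎ (∀ u → u ∉ B)
nonempty? B with any? (λ u → B u Bool.≟ true)
... | yes (u , p) = inj₁ (u , mem p)
... | no ¬p = inj₂ λ u → case u ∈? B of λ { (inj₁ (mem p)) → ⊥-elim (¬p (u , p)) ; (inj₂ q) → q }

empty-⟦⟧ : {B : VSet N} → (∀ u → u ∉ B) → ∀ u → ⟦ B ⟧ u ≡ 0ℤ
empty-⟦⟧ p u = ⟦⟧-∉ (p u)

size-empty : {B : VSet N} → (∀ u → u ∉ B) → size B ≡ 0ℤ
size-empty p = ∑-zero (empty-⟦⟧ p)

opaque
  unfolding row quad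

  row-empty : (μ : Mat N) (v : Fin N) {B : VSet N} → (∀ u → u ∉ B) → row μ v ⟦ B ⟧ ≡ 0ℤ
  row-empty μ v {B} p = ∑-zero λ u → trans (cong (_* μ v u) (empty-⟦⟧ {B = B} p u)) (*-zeroˡ (μ v u))

  quad-empty : (μ : Mat N) {B : VSet N} (b : Fin N → ℤ) → (∀ u → u ∉ B) → quad μ ⟦ B ⟧ b ≡ 0ℤ
  quad-empty μ {B} b p = ∑-zero λ u → trans (cong (_* row μ u b) (empty-⟦⟧ {B = B} p u)) (*-zeroˡ (row μ u b))

module _ (m : Mult N) where
  open Mult m

  quad-square : ∀ a b → quad μ (a ⊞ b) (a ⊞ b) ≡ quad μ a a + + 2 * quad μ b a + quad μ b b
  quad-square a b = begin
    quad μ (a ⊞ b) (a ⊞ b)                                 ≡⟨ quad-+ˡ μ a b (a ⊞ b) ⟩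
    quad μ a (a ⊞ b) + quad μ b (a ⊞ b)                    ≡⟨ cong₂ _+_ (quad-+ʳ μ a a b) (quad-+ʳ μ b a b) ⟩
    quad μ a a + quad μ a b + (quad μ b a + quad μ b b)    ≡⟨ cong (λ t → quad μ a a + t + (quad μ b a + quad μ b b)) (quad-sym μ μ-sym a b) ⟩
    quad μ a a + quad μ b a + (quad μ b a + quad μ b b)    ≡⟨ regroup (quad μ a a) (quad μ b a) (quad μ b b) ⟩
    quad μ a a + + 2 * quad μ b a + quad μ b b             ∎
    where
    open ≡-Reasoning
    regroup : ∀ x y z → x + y + (y + z) ≡ x + + 2 * y + z
    regroup = solve-∀

  quad-⊞δ : ∀ a v → quad μ (a ⊞ δ v) (a ⊞ δ v) ≡ quad μ a a + + 2 * row μ v a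
  quad-⊞δ a v = begin
    quad μ (a ⊞ δ v) (a ⊞ δ v)                                ≡⟨ quad-square a (δ v) ⟩
    quad μ a a + + 2 * quad μ (δ v) a + quad μ (δ v) (δ v)    ≡⟨ cong₂ (λ s t → quad μ a a + + 2 * s + t) (quad-δ μ v a) (trans (quad-δ μ v (δ v)) (trans (row-δ μ v v) (μ-irr v))) ⟩
    quad μ a a + + 2 * row μ v a + 0ℤ                         ≡⟨ +-identityʳ _ ⟩
    quad μ a a + + 2 * row μ v a                              ∎
    where open ≡-Reasoning

  quad-remove : ∀ {B v} → v ∈ B → quad μ ⟦ B ⟧ ⟦ B ⟧ ≡ quad μ ⟦ B − v ⟧ ⟦ B − v ⟧ + + 2 * row μ v ⟦ B − v ⟧
  quad-remove {B} {v} p = trans (quad-cong μ (⟦⟧-remove p) (⟦⟧-remove p)) (quad-⊞δ ⟦ B − v ⟧ v)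

-- Acyclicity as a sparsity condition: a multigraph is a forest iff every
-- non-empty vertex set B spans at most |B| − 1 edges (quad counts edges twice).
Acyclic : Mat N → VSet N → Set
Acyclic μ P = ∀ B → B ⊆ P → ∀ u → u ∈ B → quad μ ⟦ B ⟧ ⟦ B ⟧ + + 2 ≤ + 2 * size B

acyclic-mono : {μ : Mat N} {P P′ : VSet N} → P′ ⊆ P → Acyclic μ P → Acyclic μ P′
acyclic-mono s ac B B⊆ = ac B (λ u p → s u (B⊆ u p))

-- Two matrices are allowed so that `v` may take the place of an edge of `μ₁`: compared with the
-- count in `μ₁`, adding `v` to a set brings at most one more edge, just as it brings one more
-- vertex. A pendant vertex is the case in which both matrices agree.
acyclic-insert : (m : Mult N) {μ₁ : Mat N} {P P′ : VSet N} (v : Fin N) → let open Mult m in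
  Acyclic μ₁ P → (∀ u → u ∈ P′ → v ≢ u → u ∈ P) →
  (∀ B → B ⊆ P → quad μ ⟦ B ⟧ ⟦ B ⟧ ≤ quad μ₁ ⟦ B ⟧ ⟦ B ⟧) →
  (∀ B → B ⊆ P → quad μ ⟦ B ⟧ ⟦ B ⟧ + + 2 * row μ v ⟦ B ⟧ ≤ quad μ₁ ⟦ B ⟧ ⟦ B ⟧ + + 2) →
  Acyclic μ P′
acyclic-insert m {μ₁} {P} {P′} v ac sub le le-v B B⊆ u u∈B with v ∈? B
... | inj₂ v∉B = ≤-trans (+-monoˡ-≤ (+ 2) (le B B⊆P)) (ac B B⊆P u u∈B)
  where
  B⊆P : B ⊆ P
  B⊆P w w∈B = sub w (B⊆ w w∈B) λ { refl → ∈-contra w∈B v∉B }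
... | inj₁ v∈B with nonempty? (B − v)
-- `Acyclic μ₁ P` is silent about the empty set, so `B` consisting of `v` alone is checked directly.
...   | inj₂ e = ≤-reflexive (begin
  quad μ ⟦ B ⟧ ⟦ B ⟧ + + 2                                        ≡⟨ cong (_+ + 2) (quad-remove m v∈B) ⟩
  quad μ ⟦ B − v ⟧ ⟦ B − v ⟧ + + 2 * row μ v ⟦ B − v ⟧ + + 2      ≡⟨ cong₂ (λ s t → s + + 2 * t + + 2) (quad-empty μ {B − v} ⟦ B − v ⟧ e) (row-empty μ v {B − v} e) ⟩
  + 2 * (0ℤ + 1ℤ)                                                 ≡⟨ cong (λ t → + 2 * (t + 1ℤ)) (size-empty {B = B − v} e) ⟨
  + 2 * (size (B − v) + 1ℤ)                                       ≡⟨ cong (_*_ (+ 2)) (size-remove v∈B) ⟨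
  + 2 * size B                                                    ∎)
  where
  open Mult m
  open ≡-Reasoning
...   | inj₁ (w , w∈) = subst₂ (λ s t → s + + 2 ≤ + 2 * t) (sym (quad-remove m v∈B)) (sym (size-remove v∈B))
        (arith (quad μ ⟦ B − v ⟧ ⟦ B − v ⟧) (row μ v ⟦ B − v ⟧) (quad μ₁ ⟦ B − v ⟧ ⟦ B − v ⟧) (size (B − v))
          (le-v (B − v) B−v⊆P) (ac (B − v) B−v⊆P w w∈))
  where
  open Mult m
  B−v⊆P : B − v ⊆ P
  B−v⊆P w w∈ = sub w (B⊆ w (∈-−ˡ w∈)) (∈-−ʳ w∈)
  arith : ∀ q r q₁ s → q + + 2 * r ≤ q₁ + + 2 → q₁ + + 2 ≤ + 2 * s → q + + 2 * r + + 2 ≤ + 2 * (s + 1ℤ)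
  arith q r q₁ s p p′ = lin (p ⊕ p′) (solve (q ∷ r ∷ q₁ ∷ s ∷ []))

acyclic-leaf : (m : Mult N) {P P′ : VSet N} (v : Fin N) → let open Mult m in
  Acyclic μ P → (∀ u → u ∈ P′ → v ≢ u → u ∈ P) → row μ v ⟦ P ⟧ ≤ 1ℤ → Acyclic μ P′
acyclic-leaf m v ac sub le = acyclic-insert m v ac sub (λ _ _ → ≤-refl)
  λ B B⊆ → arith (quad μ ⟦ B ⟧ ⟦ B ⟧) (row μ v ⟦ B ⟧) (≤-trans (row-mono μ≥0 v (⟦⟧-mono {A = B} B⊆)) le)
  where
  open Mult m
  arith : ∀ q r → r ≤ 1ℤ → q + + 2 * r ≤ q + + 2
  arith q r p = lin (p ⊕ p) (solve (q ∷ r ∷ []))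

_[_↦_] : VSet N → Fin N → Bool → VSet N
(c [ v ↦ b ]) u = if v == u then b else c u

upd-≢ : (c : VSet N) {v u : Fin N} (b : Bool) → v ≢ u → (c [ v ↦ b ]) u ≡ c u
upd-≢ c b p rewrite ==-≢ p = refl

upd-≡ : (c : VSet N) (v : Fin N) (b : Bool) → (c [ v ↦ b ]) v ≡ b
upd-≡ c v b rewrite ==-refl v = refl

module _ {c : VSet N} {v : Fin N} where

  upd-∈ : ∀ {b u} → v ≢ u → u ∈ c [ v ↦ b ] → u ∈ c
  upd-∈ {b} v≢u (mem p) = mem (trans (sym (upd-≢ c b v≢u)) p)

  upd-∉ : ∀ {b u} → v ≢ u → u ∉ c [ v ↦ b ] → u ∉ c
  upd-∉ {b} v≢u (nmem p) = nmem (trans (sym (upd-≢ c b v≢u)) p)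

  upd-false : v ∉ c [ v ↦ false ]
  upd-false = nmem (upd-≡ c v false)

  upd-true : v ∈ c [ v ↦ true ]
  upd-true = mem (upd-≡ c v true)

module Coloring {N : ℕ} (D : ℤ) where

  -- c marks the vertices of the class M; β v is the degree that v has already
  -- used up in M, so that β v = D + 1 forces v into F.
  record Colored (m : Mult N) (β : Fin N → ℤ) (S c : VSet N) : Set where
    open Mult m
    field
      forestM : Acyclic μ (S ∩ c)
      forestF : Acyclic μ (S ∖ c)
      degree  : ∀ v → v ∈ S → v ∈ c → row μ v ⟦ S ∩ c ⟧ + β v ≤ D

  open Colored public

  Colorable : Mult N → (Fin N → ℤ) → VSet N → Set
  Colorable m β S = ∃[ c ] Colored m β S c

  module _ {m : Mult N} where
    open Mult m

    weaken : ∀ {β β′ S c} → Colored m β′ S c → (∀ u → u ∈ S → u ∈ c → β u ≤ β′ u) → Colored m β S c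
    weaken {S = S} {c} C le = record
      { forestM = forestM C
      ; forestF = forestF C
      ; degree  = λ v v∈S v∈c → ≤-trans (+-monoʳ-≤ (row μ v ⟦ S ∩ c ⟧) (le v v∈S v∈c)) (degree C v v∈S v∈c)
      }

    addF : ∀ {β S c v} → Colored m β (S − v) c → row μ v ⟦ (S − v) ∖ c ⟧ ≤ 1ℤ → Colored m β S (c [ v ↦ false ])
    addF {β} {S} {c} {v} C le = record
      { forestM = acyclic-mono M⊆ (forestM C)
      ; forestF = acyclic-leaf m v (forestF C) F⊆ le
      ; degree  = λ u u∈S u∈c′ → let v≢u = v≢ u u∈c′ in
          ≤-trans (+-monoˡ-≤ (β u) (row-mono μ≥0 u (⟦⟧-mono M⊆)))
                  (degree C u (∈-−⁺ u∈S v≢u) (upd-∈ v≢u u∈c′))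
      }
      where
      c′ = c [ v ↦ false ]
      v≢ : ∀ u → u ∈ c′ → v ≢ u
      v≢ u p refl = ∈-contra p upd-false
      M⊆ : S ∩ c′ ⊆ (S − v) ∩ c
      M⊆ u p = let v≢u = v≢ u (∈-∩ʳ p) in ∈-∩⁺ (∈-−⁺ (∈-∩ˡ p) v≢u) (upd-∈ v≢u (∈-∩ʳ p))
      F⊆ : ∀ u → u ∈ S ∖ c′ → v ≢ u → u ∈ (S − v) ∖ c
      F⊆ u p v≢u = ∈-∖⁺ (∈-−⁺ (∈-∖ˡ p) v≢u) (upd-∉ v≢u (∈-∖ʳ p))

    -- Putting `v` into M uses up degree at its neighbours in M; the excess of `β′` over `β` is the
    -- room reserved there.
    addM : ∀ {β β′ S c v} → Colored m β′ (S − v) c →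
      (∀ u → u ∈ S − v → u ∈ c → β u + μ v u ≤ β′ u) →
      row μ v ⟦ (S − v) ∩ c ⟧ ≤ 1ℤ → row μ v ⟦ (S − v) ∩ c ⟧ + β v ≤ D →
      Colored m β S (c [ v ↦ true ])
    addM {β} {β′} {S} {c} {v} C slack le le-v = record
      { forestM = acyclic-leaf m v (forestM C) M⊆ le
      ; forestF = acyclic-mono F⊆ (forestF C)
      ; degree  = deg
      }
      where
      c′ = c [ v ↦ true ]
      M⊆ : ∀ u → u ∈ S ∩ c′ → v ≢ u → u ∈ (S − v) ∩ c
      M⊆ u p v≢u = ∈-∩⁺ (∈-−⁺ (∈-∩ˡ p) v≢u) (upd-∈ v≢u (∈-∩ʳ p))
      F⊆ : S ∖ c′ ⊆ (S − v) ∖ c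
      F⊆ u p = ∈-∖⁺ (∈-−⁺ (∈-∖ˡ p) v≢u) (upd-∉ v≢u (∈-∖ʳ p))
        where
        v≢u : v ≢ u
        v≢u refl = ∈-contra upd-true (∈-∖ʳ p)
      ⟦⟧≤ : ∀ u → ⟦ S ∩ c′ ⟧ u ≤ (⟦ (S − v) ∩ c ⟧ ⊞ δ v) u
      ⟦⟧≤ u = case v ≟ u of λ
        { (yes refl) → ≤-trans (χ≤1 ((S ∩ c′) v)) (subst (λ t → 1ℤ ≤ ⟦ (S − v) ∩ c ⟧ v + χ t) (sym (==-refl v)) (⟦⟧≥0 ((S − v) ∩ c) v ⊕ ≤-refl {1ℤ}))
        ; (no v≢u) → subst (λ t → ⟦ S ∩ c′ ⟧ u ≤ ⟦ (S − v) ∩ c ⟧ u + χ t) (sym (==-≢ v≢u))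
            (subst (⟦ S ∩ c′ ⟧ u ≤_) (sym (+-identityʳ (⟦ (S − v) ∩ c ⟧ u))) (χ-mono λ p → is-true (M⊆ u (mem p) v≢u))) }
      row≤ : ∀ u → row μ u ⟦ S ∩ c′ ⟧ ≤ row μ u ⟦ (S − v) ∩ c ⟧ + μ u v
      row≤ u = subst (row μ u ⟦ S ∩ c′ ⟧ ≤_) (trans (row-+ μ u ⟦ (S − v) ∩ c ⟧ (δ v)) (cong (_+_ (row μ u ⟦ (S − v) ∩ c ⟧)) (row-δ μ u v))) (row-mono μ≥0 u ⟦⟧≤)
      arith : ∀ r r′ x b b′ → r ≤ r′ + x → b + x ≤ b′ → r′ + b′ ≤ D → r + b ≤ D
      arith r r′ x b b′ p q s = lin (p ⊕ q ⊕ s) (solve (r ∷ r′ ∷ x ∷ b ∷ b′ ∷ D ∷ []))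
      deg : ∀ u → u ∈ S → u ∈ c′ → row μ u ⟦ S ∩ c′ ⟧ + β u ≤ D
      deg u u∈S u∈c′ = case v ≟ u of λ
        { (yes refl) → ≤-trans (+-monoˡ-≤ (β u) (subst (row μ u ⟦ S ∩ c′ ⟧ ≤_) (trans (cong (_+_ (row μ u ⟦ (S − u) ∩ c ⟧)) (μ-irr u)) (+-identityʳ (row μ u ⟦ (S − u) ∩ c ⟧))) (row≤ u))) le-v
        ; (no v≢u) → let u∈ = ∈-−⁺ u∈S v≢u ; u∈c = upd-∈ v≢u u∈c′ in
            arith (row μ u ⟦ S ∩ c′ ⟧) (row μ u ⟦ (S − v) ∩ c ⟧) (μ u v) (β u) (β′ u) (row≤ u)
              (subst (λ t → β u + t ≤ β′ u) (μ-sym v u) (slack u u∈ u∈c)) (degree C u u∈ u∈c) }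

    row-∩∖ : ∀ v (A B : VSet N) → row μ v ⟦ A ⟧ ≡ row μ v ⟦ A ∩ B ⟧ + row μ v ⟦ A ∖ B ⟧
    row-∩∖ v A B = trans (row-cong μ v (⟦⟧-∩∖ A B)) (row-+ μ v ⟦ A ∩ B ⟧ ⟦ A ∖ B ⟧)

    extend : ∀ {β β′ S c v} → Colored m β′ (S − v) c →
      (∀ u → u ∈ S − v → u ∈ c → β u ≤ β′ u) →
      (row μ v ⟦ (S − v) ∖ c ⟧ ≤ 1ℤ ⊎
        (∀ u → u ∈ S − v → u ∈ c → β u + μ v u ≤ β′ u) ×
        row μ v ⟦ (S − v) ∩ c ⟧ ≤ 1ℤ × row μ v ⟦ (S − v) ∩ c ⟧ + β v ≤ D) →
      Colorable m β S
    extend {c = c} {v} C le (inj₁ p)             = c [ v ↦ false ] , addF (weaken C le) p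
    extend {c = c} {v} C le (inj₂ (s , p , q)) = c [ v ↦ true ] , addM C s p q

-- The potential

-- `anySubset?` ranges over bit vectors, which represent a Boolean function only up to pointwise
-- equality; hence the first argument.
search : {P : VSet N → Set} → (∀ {B B′} → (∀ u → B u ≡ B′ u) → P B → P B′) → (∀ B → Dec (P B)) → (∃[ B ] P B) ⊎ (∀ B → ¬ P B)
search resp P? with anySubset? (λ X → P? (lookup X))
... | yes (X , p) = inj₁ (lookup X , p)
... | no ¬p       = inj₂ λ B p → ¬p (tabulate B , resp (λ u → sym (lookup∘tabulate B u)) p)

opaque
  dot : (Fin N → ℤ) → (Fin N → ℤ) → ℤ
  dot a f = sum λ u → a u * f u

  dot-cong : {a a′ f f′ : Fin N → ℤ} → (∀ u → a u ≡ a′ u) → (∀ u → f u ≡ f′ u) → dot a f ≡ dot a′ f′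
  dot-cong p q = ∑-cong λ u → cong₂ _*_ (p u) (q u)

  dot-+ˡ : (a a′ f : Fin N → ℤ) → dot (a ⊞ a′) f ≡ dot a f + dot a′ f
  dot-+ˡ a a′ f = trans (∑-cong λ u → *-distribʳ-+ (f u) (a u) (a′ u)) (∑-+ _ _)

  dot-+ʳ : (a f f′ : Fin N → ℤ) → dot a (f ⊞ f′) ≡ dot a f + dot a f′
  dot-+ʳ a f f′ = trans (∑-cong λ u → *-distribˡ-+ (a u) (f u) (f′ u)) (∑-+ _ _)

  dot-*ʳ : (a f : Fin N → ℤ) (k : ℤ) → dot a (λ u → k * f u) ≡ k * dot a f
  dot-*ʳ a f k = trans (∑-cong λ u → exch (a u) k (f u)) (sym (∑-*ˡ k _))
    where
    exch : ∀ x y z → x * (y * z) ≡ y * (x * z)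
    exch = solve-∀

  dot-δ : (v : Fin N) (f : Fin N → ℤ) → dot (δ v) f ≡ f v
  dot-δ = ∑-δ

  dot-monoʳ : {a f f′ : Fin N → ℤ} → (∀ u → 0ℤ ≤ a u) → (∀ u → f u ≤ f′ u) → dot a f ≤ dot a f′
  dot-monoʳ {a = a} p q = ∑-mono λ u → *-monoˡ (a u) (p u) (q u)

  dot-mono-∈ : {B : VSet N} {f f′ : Fin N → ℤ} → (∀ u → u ∈ B → f u ≤ f′ u) → dot ⟦ B ⟧ f ≤ dot ⟦ B ⟧ f′
  dot-mono-∈ {B = B} {f} {f′} q = ∑-mono λ u → case u ∈? B of λ
    { (inj₁ p) → *-monoˡ (⟦ B ⟧ u) (⟦⟧≥0 B u) (q u p)
    ; (inj₂ p) → ≤-reflexive (trans (cong (_* f u) (⟦⟧-∉ p)) (cong (_* f′ u) (sym (⟦⟧-∉ p)))) }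

  dot-size : (B : VSet N) (k : ℤ) → dot ⟦ B ⟧ (λ _ → k) ≡ k * size B
  dot-size B k = trans (∑-cong λ u → *-comm (⟦ B ⟧ u) k) (sym (∑-*ˡ k ⟦ B ⟧))

  dot-≥ : {B : VSet N} {f : Fin N → ℤ} → (∀ u → u ∈ B → 0ℤ ≤ f u) → 0ℤ ≤ dot ⟦ B ⟧ f
  dot-≥ {B = B} {f} q = ∑-nonneg λ u → case u ∈? B of λ
    { (inj₁ p) → *-nonneg (⟦⟧≥0 B u) (q u p)
    ; (inj₂ p) → ≤-reflexive (sym (cong (_* f u) (⟦⟧-∉ p))) }

  dot-∈ : {B : VSet N} {f : Fin N → ℤ} → (∀ u → u ∈ B → 0ℤ ≤ f u) → ∀ u → u ∈ B → f u ≤ dot ⟦ B ⟧ f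
  dot-∈ {B = B} {f} q u p = subst (_≤ dot ⟦ B ⟧ f) (trans (cong (_* f u) (⟦⟧-∈ p)) (*-identityˡ (f u)))
    (∑-term (λ w → case w ∈? B of λ
      { (inj₁ p) → *-nonneg (⟦⟧≥0 B w) (q w p)
      ; (inj₂ p) → ≤-reflexive (sym (cong (_* f w) (⟦⟧-∉ p))) }) u)

opaque
  unfolding dot row quad

  quad-dot : (μ : Mat N) (a b : Fin N → ℤ) → quad μ a b ≡ dot a (λ u → row μ u b)
  quad-dot μ a b = refl

  row-dot : (μ : Mat N) (v : Fin N) (a : Fin N → ℤ) → row μ v a ≡ dot a (μ v)
  row-dot μ v a = refl

module Potential {N : ℕ} (D : ℤ) (1≤D : 1ℤ ≤ D) where
  open Coloring {N} D public

  0≤D+1 : 0ℤ ≤ D + 1ℤ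
  0≤D+1 = lin (1≤D ⊕ 0≤+ 2) (solve (D ∷ []))

  0≤2D : 0ℤ ≤ + 2 * D
  0≤2D = lin (1≤D ⊕ 1≤D ⊕ 0≤+ 2) (solve (D ∷ []))

  IsLoad : (Fin N → ℤ) → Set
  IsLoad β = ∀ v → 0ℤ ≤ β v × β v ≤ D + 1ℤ

  -- For β = 0 the sparsity hypothesis says ρ ≥ −1. One unit of load costs 2, so
  -- that the full load D + 1 costs as much as an edge, namely 2 (D + 1).
  weight : (Fin N → ℤ) → Fin N → ℤ
  weight β v = + 4 * D + + 3 - + 2 * β v

  opaque
    ρ : Mult N → (Fin N → ℤ) → (Fin N → ℤ) → ℤ
    ρ m β a = dot a (weight β) - (D + 1ℤ) * quad (Mult.μ m) a a

    ρ-def : ∀ m β a → ρ m β a ≡ dot a (weight β) - (D + 1ℤ) * quad (Mult.μ m) a a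
    ρ-def m β a = refl

  module _ (m : Mult N) (β : Fin N → ℤ) where
    open Mult m

    ρ-cong : ∀ {a b} → (∀ u → a u ≡ b u) → ρ m β a ≡ ρ m β b
    ρ-cong {a} {b} p = trans (ρ-def m β a) (trans (cong₂ (λ s t → s - (D + 1ℤ) * t) (dot-cong p λ _ → refl) (quad-cong μ p p)) (sym (ρ-def m β b)))

    ρ-⊞ : ∀ a b → ρ m β (a ⊞ b) ≡ ρ m β a + ρ m β b - + 2 * (D + 1ℤ) * quad μ b a
    ρ-⊞ a b = trans (ρ-def m β (a ⊞ b)) (trans (cong₂ (λ s t → s - (D + 1ℤ) * t) (dot-+ˡ a b (weight β)) (quad-square m a b))
      (trans (regroup (dot a (weight β)) (dot b (weight β)) (quad μ a a) (quad μ b a) (quad μ b b) (D + 1ℤ))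
      (cong₂ (λ s t → s + t - + 2 * (D + 1ℤ) * quad μ b a) (sym (ρ-def m β a)) (sym (ρ-def m β b)))))
      where
      regroup : ∀ s t x y z k → s + t - k * (x + + 2 * y + z) ≡ s - k * x + (t - k * z) - + 2 * k * y
      regroup = solve-∀

    ρ-δ : ∀ v → ρ m β (δ v) ≡ weight β v
    ρ-δ v = trans (ρ-def m β (δ v)) (trans (cong₂ (λ s t → s - (D + 1ℤ) * t) (dot-δ v (weight β)) (trans (quad-δ μ v (δ v)) (trans (row-δ μ v v) (μ-irr v)))) (vanish (weight β v) (D + 1ℤ)))
      where
      vanish : ∀ s k → s - k * 0ℤ ≡ s
      vanish = solve-∀

    ρ-insert : ∀ {A v} → v ∉ A → ρ m β ⟦ A ⁺ v ⟧ ≡ ρ m β ⟦ A ⟧ + weight β v - + 2 * (D + 1ℤ) * row μ v ⟦ A ⟧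
    ρ-insert {A} {v} p = trans (ρ-cong (⟦⟧-insert p)) (trans (ρ-⊞ ⟦ A ⟧ (δ v)) (cong₂ (λ s t → ρ m β ⟦ A ⟧ + s - + 2 * (D + 1ℤ) * t) (ρ-δ v) (quad-δ μ v ⟦ A ⟧)))

    -- Even under full load one vertex weighs 4D + 3 - 2 (D + 1) = 2D + 1. This covers the
    -- singletons, about which `Sparse` and `Gap` say nothing.
    single-or-two : IsLoad β → ∀ {B v} → v ∈ B → + 2 ≤ size B ⊎ + 2 * D + 1ℤ ≤ ρ m β ⟦ B ⟧
    single-or-two load {B} {v} v∈B with nonempty? (B − v)
    ... | inj₁ (u , u∈) = inj₁ (subst (+ 2 ≤_) (sym (size-remove v∈B)) (size-nonempty u∈ ⊕ ≤-refl {1ℤ}))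
    ... | inj₂ e = inj₂ (subst (+ 2 * D + 1ℤ ≤_) (sym (trans (ρ-cong eq) (ρ-δ v))) (arith (β v) (proj₂ (load v))))
      where
      eq : ∀ u → ⟦ B ⟧ u ≡ δ v u
      eq u = trans (⟦⟧-remove v∈B u) (trans (cong (_+ δ v u) (empty-⟦⟧ {B = B − v} e u)) (+-identityˡ (δ v u)))
      arith : ∀ b → b ≤ D + 1ℤ → + 2 * D + 1ℤ ≤ + 4 * D + + 3 - + 2 * b
      arith b p = lin (p ⊕ p) (solve (b ∷ D ∷ []))

  Sparse : Mult N → (Fin N → ℤ) → VSet N → Set
  Sparse m β S = ∀ B → B ⊆ S → + 2 ≤ size B → - 1ℤ ≤ ρ m β ⟦ B ⟧

  sparse-⊆ : ∀ {m β S S′} → S′ ⊆ S → Sparse m β S → Sparse m β S′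
  sparse-⊆ s sp B B⊆ = sp B (λ u p → s u (B⊆ u p))

  Gap : Mult N → (Fin N → ℤ) → VSet N → ℤ → Set
  Gap m β S g = ∀ B → B ⊆ S → ∀ w → w ∈ S → w ∉ B → + 2 ≤ size B → g ≤ ρ m β ⟦ B ⟧

  ρ-load : ∀ m {β β′ f} (a : Fin N → ℤ) → (∀ u → 0ℤ ≤ a u) → (∀ u → β′ u ≤ β u + f u) → ρ m β a ≤ ρ m β′ a + + 2 * dot a f
  ρ-load m {β} {β′} {f} a a≥0 p = subst₂ (λ s t → s ≤ t + + 2 * dot a f) (sym (ρ-def m β a)) (sym (ρ-def m β′ a))
    (arith (dot a (weight β)) (dot a (weight β′)) (dot a f) ((D + 1ℤ) * quad (Mult.μ m) a a)
      (subst (dot a (weight β) ≤_) (trans (dot-+ʳ a (weight β′) (λ u → + 2 * f u)) (cong (_+_ (dot a (weight β′))) (dot-*ʳ a f (+ 2))))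
        (dot-monoʳ a≥0 λ u → step (β u) (β′ u) (f u) (p u))))
    where
    arith : ∀ x y z q → x ≤ y + + 2 * z → x - q ≤ y - q + + 2 * z
    arith x y z q h = lin h (solve (x ∷ y ∷ z ∷ q ∷ []))
    step : ∀ b b′ x → b′ ≤ b + x → + 4 * D + + 3 - + 2 * b ≤ + 4 * D + + 3 - + 2 * b′ + + 2 * x
    step b b′ x h = lin (h ⊕ h) (solve (b ∷ b′ ∷ x ∷ D ∷ []))

  -- The cap preserves `IsLoad` and loses nothing: a vertex that reaches it must go to F, where load
  -- does not matter.
  raise : (Fin N → ℤ) → (Fin N → ℤ) → Fin N → ℤ
  raise β f v = (β v + f v) ⊓ (D + 1ℤ)

  raise-≤ : ∀ β f v → raise β f v ≤ β v + f v
  raise-≤ β f v = i⊓j≤i (β v + f v) (D + 1ℤ)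

  module _ {β f : Fin N → ℤ} (load : IsLoad β) (f≥0 : ∀ v → 0ℤ ≤ f v) where

    raise-≥ : ∀ v → β v ≤ raise β f v
    raise-≥ v = ⊓-glb (subst (_≤ β v + f v) (+-identityʳ (β v)) (+-monoʳ-≤ (β v) (f≥0 v))) (proj₂ (load v))

    raise-load : IsLoad (raise β f)
    raise-load v = ≤-trans (proj₁ (load v)) (raise-≥ v) , i⊓j≤j (β v + f v) (D + 1ℤ)

  -- A vertex colored M is below the cap, so all of `f v` has really been reserved.
  raise-M : ∀ β f v → raise β f v ≤ D → β v + f v ≤ raise β f v
  raise-M β f v p with ≤-total (β v + f v) (D + 1ℤ)
  ... | inj₁ q = ≤-reflexive (sym (i≤j⇒i⊓j≡i q))
  ... | inj₂ q = ⊥-elim (1≰0 (lin (subst (_≤ D) (i≥j⇒i⊓j≡j q) p) (solve (D ∷ []))))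

  χ-true : ∀ {x} → 1ℤ ≤ χ x → x ≡ true
  χ-true {true}  _ = refl
  χ-true {false} p = ⊥-elim (1≰0 p)

  search-gap : ∀ m β S g → Gap m β S g ⊎ (∃[ B ] B ⊆ S × (∃[ w ] w ∈ S × w ∉ B) × + 2 ≤ size B × ρ m β ⟦ B ⟧ + 1ℤ ≤ g)
  search-gap m β S g = case search {P = Bad} respects bad? of λ
    { (inj₁ (B , (a , (w , b)) , (c , d))) → inj₂ (B , sub B a , (w , strict B w b) , c , d)
    ; (inj₂ none) → inj₁ λ B B⊆ w w∈ w∉ two → case g ≤⊎> ρ m β ⟦ B ⟧ of λ
      { (inj₁ p) → p
      ; (inj₂ p) → ⊥-elim (none B ((⟦⟧-mono B⊆ , (w , ≤-reflexive (trans (cong (_+ 1ℤ) (⟦⟧-∉ w∉)) (sym (⟦⟧-∈ w∈))))) , (two , p))) } }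
    where
    Bad : VSet N → Set
    Bad B = ((∀ u → ⟦ B ⟧ u ≤ ⟦ S ⟧ u) × (∃[ w ] ⟦ B ⟧ w + 1ℤ ≤ ⟦ S ⟧ w)) × (+ 2 ≤ size B × ρ m β ⟦ B ⟧ + 1ℤ ≤ g)
    respects : ∀ {B B′} → (∀ u → B u ≡ B′ u) → Bad B → Bad B′
    respects {B} {B′} eq ((a , (w , b)) , (c , d)) =
      ((λ u → subst (_≤ ⟦ S ⟧ u) (cong χ (eq u)) (a u)) , (w , subst (λ t → χ t + 1ℤ ≤ ⟦ S ⟧ w) (eq w) b)) ,
      (subst (+ 2 ≤_) (∑-cong (cong χ ∘ eq)) c , subst (λ t → t + 1ℤ ≤ g) (ρ-cong m β (cong χ ∘ eq)) d)
    bad? : ∀ B → Dec (Bad B)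
    bad? B = (all? (λ u → ⟦ B ⟧ u ≤? ⟦ S ⟧ u) ×-dec any? (λ w → (⟦ B ⟧ w + 1ℤ) ≤? ⟦ S ⟧ w)) ×-dec ((+ 2 ≤? size B) ×-dec ((ρ m β ⟦ B ⟧ + 1ℤ) ≤? g))
    sub : ∀ B → (∀ u → ⟦ B ⟧ u ≤ ⟦ S ⟧ u) → B ⊆ S
    sub B a u (mem p) = mem (χ-true (subst (λ t → χ t ≤ ⟦ S ⟧ u) p (a u)))
    strict : ∀ B w → ⟦ B ⟧ w + 1ℤ ≤ ⟦ S ⟧ w → w ∈ S × w ∉ B
    strict B w b with B w in eq | S w in eq′
    ... | false | true  = mem eq′ , nmem eq
    ... | false | false = ⊥-elim (1≰0 b)
    ... | true  | false = ⊥-elim (1≰0 (≤-trans (+≤+ (ℕ.s≤s ℕ.z≤n)) b))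
    ... | true  | true  = ⊥-elim (1≰0 (lin b refl))

  -- The induction hypothesis. It ranges over all multigraphs and loads on the same vertex type,
  -- because the reductions contract sets and add edges; only the set of active vertices shrinks.
  Below : VSet N → Set
  Below S = ∀ m β S′ → IsLoad β → size S′ + 1ℤ ≤ size S → Sparse m β S′ → Colorable m β S′

dot-cong-∈ : {B : VSet N} {f f′ : Fin N → ℤ} → (∀ u → u ∈ B → f u ≡ f′ u) → dot ⟦ B ⟧ f ≡ dot ⟦ B ⟧ f′
dot-cong-∈ p = ≤-antisym (dot-mono-∈ λ u q → ≤-reflexive (p u q)) (dot-mono-∈ λ u q → ≤-reflexive (sym (p u q)))

opaque
  unfolding dot

  dot-comm : (a f : Fin N → ℤ) → dot a f ≡ dot f a
  dot-comm a f = ∑-cong λ u → *-comm (a u) (f u)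

  dot-sum : ∀ {M} (a : Fin N → ℤ) (F : Fin M → Fin N → ℤ) → dot a (λ v → sum λ e → F e v) ≡ sum (λ e → dot a (F e))
  dot-sum a F = trans (∑-cong λ v → ∑-*ˡ (a v) (λ e → F e v)) (∑-comm (λ v e → a v * F e v))

  dot-positive : {B : VSet N} {f : Fin N → ℤ} → 1ℤ ≤ dot ⟦ B ⟧ f → ∃[ u ] u ∈ B × 1ℤ ≤ f u
  dot-positive {B = B} {f} p with ∑-positive p
  ... | u , q with u ∈? B
  ...   | inj₁ u∈ = u , u∈ , subst (1ℤ ≤_) (trans (cong (_* f u) (⟦⟧-∈ u∈)) (*-identityˡ (f u))) q
  ...   | inj₂ u∉ = ⊥-elim (1≰0 (subst (1ℤ ≤_) (cong (_* f u) (⟦⟧-∉ u∉)) q))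

dot-⟦⟧δ : (B : VSet N) (v : Fin N) → dot ⟦ B ⟧ (δ v) ≡ ⟦ B ⟧ v
dot-⟦⟧δ B v = trans (dot-comm ⟦ B ⟧ (δ v)) (dot-δ v ⟦ B ⟧)

δ-refl : (v : Fin N) → δ v v ≡ 1ℤ
δ-refl v = cong χ (==-refl v)

δ-≢ : {u v : Fin N} → u ≢ v → δ u v ≡ 0ℤ
δ-≢ p = cong χ (==-≢ p)

⟦⟧-∩∖-empty : {A B : VSet N} → (∀ u → u ∉ A ∩ B) → ∀ u → ⟦ A ⟧ u ≡ ⟦ A ∖ B ⟧ u
⟦⟧-∩∖-empty {A = A} {B} e u = trans (⟦⟧-∩∖ A B u) (trans (cong (_+ ⟦ A ∖ B ⟧ u) (⟦⟧-∉ (e u))) (+-identityˡ (⟦ A ∖ B ⟧ u)))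

⟦⟧-∖∩-empty : {A B : VSet N} → (∀ u → u ∉ A ∖ B) → ∀ u → ⟦ A ⟧ u ≡ ⟦ A ∩ B ⟧ u
⟦⟧-∖∩-empty {A = A} {B} e u = trans (⟦⟧-∩∖ A B u) (trans (cong (_+_ (⟦ A ∩ B ⟧ u)) (⟦⟧-∉ (e u))) (+-identityʳ (⟦ A ∩ B ⟧ u)))

size-∩∖ : (A B : VSet N) → size A ≡ size (A ∩ B) + size (A ∖ B)
size-∩∖ A B = trans (∑-cong (⟦⟧-∩∖ A B)) (∑-+ ⟦ A ∩ B ⟧ ⟦ A ∖ B ⟧)

size-insert : {A : VSet N} {v : Fin N} → v ∉ A → size (A ⁺ v) ≡ size A + 1ℤ
size-insert {A = A} {v} v∉ = trans (∑-cong (⟦⟧-insert v∉)) (trans (∑-+ ⟦ A ⟧ (δ v)) (cong (_+_ (size A)) (trans (∑-cong λ u → sym (*-identityʳ (δ v u))) (∑-δ v λ _ → 1ℤ))))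

quad-∩∖ : (m : Mult N) (B A : VSet N) → let open Mult m in
  quad μ ⟦ B ⟧ ⟦ B ⟧ ≡ quad μ ⟦ B ∩ A ⟧ ⟦ B ∩ A ⟧ + + 2 * quad μ ⟦ B ∖ A ⟧ ⟦ B ∩ A ⟧ + quad μ ⟦ B ∖ A ⟧ ⟦ B ∖ A ⟧
quad-∩∖ m B A = trans (quad-cong μ (⟦⟧-∩∖ B A) (⟦⟧-∩∖ B A)) (quad-square m ⟦ B ∩ A ⟧ ⟦ B ∖ A ⟧)
  where open Mult m

row-∈₂ : (m : Mult N) {v x u : Fin N} {P : VSet N} → let open Mult m in x ∈ P → u ∈ P → x ≢ u → μ v u + μ v x ≤ row μ v ⟦ P ⟧
row-∈₂ m {v} {x} {u} {P} x∈ u∈ x≢u = subst (μ v u + μ v x ≤_) (sym (trans (row-cong μ v (⟦⟧-remove x∈)) (trans (row-+ μ v ⟦ P − x ⟧ (δ x)) (cong (_+_ (row μ v ⟦ P − x ⟧)) (row-δ μ v x)))))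
  (+-monoˡ-≤ (μ v x) (row-∈ μ≥0 v (∈-−⁺ u∈ x≢u)))
  where open Mult m

-- Think of `P ∩ A` as contracted to a point: the last hypothesis allows `B` together with that
-- point, |B| + 1 vertices, to span at most |B| edges. The edges inside `A`, at most one fewer than
-- the vertices there, complete the count.
acyclic-glue : (m : Mult N) {P : VSet N} (A : VSet N) → let open Mult m in
  Acyclic μ (P ∩ A) → Acyclic μ (P ∖ A) →
  (∀ B C u → B ⊆ P ∖ A → C ⊆ P ∩ A → u ∈ B → quad μ ⟦ B ⟧ ⟦ B ⟧ + + 2 * quad μ ⟦ B ⟧ ⟦ C ⟧ ≤ + 2 * size B) →
  Acyclic μ P
acyclic-glue m {P} A acA acR glue B B⊆P u u∈B with nonempty? (B ∩ A) | nonempty? (B ∖ A)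
... | inj₂ e | _ = subst₂ (λ s t → s + + 2 ≤ + 2 * t) (sym (quad-cong μ eq eq)) (sym (∑-cong eq))
      (acR (B ∖ A) (λ w p → ∈-∖⁺ (B⊆P w (∈-∖ˡ p)) (∈-∖ʳ p)) u (case u ∈? A of λ
        { (inj₁ q) → ∈-contra (∈-∩⁺ u∈B q) (e u) ; (inj₂ q) → ∈-∖⁺ u∈B q }))
  where
  open Mult m
  eq = ⟦⟧-∩∖-empty {A = B} {A} e
... | inj₁ _ | inj₂ e = subst₂ (λ s t → s + + 2 ≤ + 2 * t) (sym (quad-cong μ eq eq)) (sym (∑-cong eq))
      (acA (B ∩ A) (λ w p → ∈-∩⁺ (B⊆P w (∈-∩ˡ p)) (∈-∩ʳ p)) u (case u ∈? A of λ
        { (inj₁ q) → ∈-∩⁺ u∈B q ; (inj₂ q) → ∈-contra (∈-∖⁺ u∈B q) (e u) }))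
  where
  open Mult m
  eq = ⟦⟧-∖∩-empty {A = B} {A} e
... | inj₁ (v , v∈) | inj₁ (w , w∈) = subst₂ (λ s t → s + + 2 ≤ + 2 * t) (sym (quad-∩∖ m B A)) (sym (size-∩∖ B A))
      (arith (quad μ ⟦ B ∩ A ⟧ ⟦ B ∩ A ⟧) (quad μ ⟦ B ∖ A ⟧ ⟦ B ∩ A ⟧) (quad μ ⟦ B ∖ A ⟧ ⟦ B ∖ A ⟧) (size (B ∩ A)) (size (B ∖ A))
        (acA (B ∩ A) inA v v∈) (glue (B ∖ A) (B ∩ A) w (λ w p → ∈-∖⁺ (B⊆P w (∈-∖ˡ p)) (∈-∖ʳ p)) inA w∈))
  where
  open Mult m
  inA : B ∩ A ⊆ P ∩ A
  inA w p = ∈-∩⁺ (B⊆P w (∈-∩ˡ p)) (∈-∩ʳ p)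
  arith : ∀ a x b s t → a + + 2 ≤ + 2 * s → b + + 2 * x ≤ + 2 * t → a + + 2 * x + b + + 2 ≤ + 2 * (s + t)
  arith a x b s t p q = lin (p ⊕ q) (solve (a ∷ x ∷ b ∷ s ∷ t ∷ []))

-- Contraction of a set of small potential

module Contraction {N : ℕ} (D : ℤ) (1≤D : 1ℤ ≤ D) where
  open Potential {N} D 1≤D

  module Piece
    (m : Mult N) {β : Fin N → ℤ} (load : IsLoad β) {S A : VSet N} (A⊆S : A ⊆ S)
    {βA : Fin N → ℤ} {c : VSet N} (C : Colored m βA A c) (β≤βA : ∀ u → u ∈ A → u ∈ c → β u ≤ βA u)
    {x z₀ : Fin N} (x∈A : x ∈ A) (z₀∈S : z₀ ∈ S) (z₀∉A : z₀ ∉ A)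
    (sp : Bool) (slack : sp ≡ true → x ∈ c × β x + 1ℤ ≤ βA x × 1ℤ ≤ Mult.μ m z₀ x)
    where
    open Mult m

    R MA FA : VSet N
    R  = S ∖ A
    MA = A ∩ c
    FA = A ∖ c

    toM toF : Fin N → ℤ
    toM z = row μ z ⟦ MA ⟧
    toF z = row μ z ⟦ FA ⟧

    toM≥0 : ∀ z → 0ℤ ≤ toM z
    toM≥0 z = row≥0 μ≥0 z (⟦⟧≥0 MA)

    -- An edge from z to M ∩ A forces z into F, except that z₀ may use up the slack left at x.
    data NewLoad (z : Fin N) : ℤ → Set where
      free   : toM z ≤ 0ℤ → NewLoad z (β z)
      single : sp ≡ true → z₀ ≡ z → toM z ≤ 1ℤ → 1ℤ ≤ toM z → NewLoad z ((β z + 1ℤ) ⊓ (D + 1ℤ))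
      forced : 1ℤ ≤ toM z → (sp ≡ true → z₀ ≡ z → + 2 ≤ toM z) → NewLoad z (D + 1ℤ)

    newLoad : ∀ z → ∃[ b ] NewLoad z b
    newLoad z with n≤0⊎1≤n (toM z)
    ... | inj₁ p = _ , free p
    ... | inj₂ p with sp Bool.≟ true
    ...   | no ¬sp = _ , forced p (λ q → ⊥-elim (¬sp q))
    ...   | yes q with z₀ ≟ z
    ...     | no ne = _ , forced p (λ _ e → ⊥-elim (ne e))
    ...     | yes e with toM z ≤⊎> 1ℤ
    ...       | inj₁ r = _ , single q e r p
    ...       | inj₂ r = _ , forced p (λ _ _ → r)

    β′ : Fin N → ℤ
    -- The contracted vertex stands for vertices of F, so full load keeps it in F.
    β′ z = if x == z then D + 1ℤ else proj₁ (newLoad z)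

    β′-x : β′ x ≡ D + 1ℤ
    β′-x rewrite ==-refl x = refl

    β′-≢ : ∀ {z} → x ≢ z → NewLoad z (β′ z)
    β′-≢ {z} p rewrite ==-≢ p = proj₂ (newLoad z)

    load′ : IsLoad β′
    load′ z = case x ≟ z of λ
      { (yes refl) → subst (λ b → 0ℤ ≤ b × b ≤ D + 1ℤ) (sym β′-x) (0≤D+1 , ≤-refl)
      ; (no p) → bounds (β′-≢ p) }
      where
      bounds : ∀ {b} → NewLoad z b → 0ℤ ≤ b × b ≤ D + 1ℤ
      bounds (free _)         = load z
      bounds (single _ _ _ _) = ⊓-glb (proj₁ (load z) ⊕ 0≤+ 1) 0≤D+1 , i⊓j≤j (β z + 1ℤ) (D + 1ℤ)
      bounds (forced _ _)     = 0≤D+1 , ≤-refl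

    -- x is reused as the vertex to which F ∩ A is contracted.
    μ′ : Mat N
    μ′ u v = if x == u then (if x == v then 0ℤ else toF v) else (if x == v then toF u else μ u v)

    toF≥0 : ∀ z → 0ℤ ≤ toF z
    toF≥0 z = row≥0 μ≥0 z (⟦⟧≥0 FA)

    m′ : Mult N
    m′ = record { μ = μ′ ; μ-sym = symm ; μ≥0 = nonneg ; μ-irr = irr }
      where
      symm : ∀ u v → μ′ u v ≡ μ′ v u
      symm u v with x == u | x == v
      ... | true  | true  = refl
      ... | true  | false = refl
      ... | false | true  = refl
      ... | false | false = μ-sym u v
      nonneg : ∀ u v → 0ℤ ≤ μ′ u v
      nonneg u v with x == u | x == v
      ... | true  | true  = ≤-refl
      ... | true  | false = toF≥0 v
      ... | false | true  = toF≥0 u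
      ... | false | false = μ≥0 u v
      irr : ∀ v → μ′ v v ≡ 0ℤ
      irr v with x == v
      ... | true  = refl
      ... | false = μ-irr v

    S′ : VSet N
    S′ = R ⁺ x

    x≢ : ∀ {u} → u ∈ R → x ≢ u
    x≢ u∈R refl = ∈-contra x∈A (∈-∖ʳ u∈R)

    μ′-R : ∀ {u v} → u ∈ R → v ∈ R → μ′ u v ≡ μ u v
    μ′-R u∈ v∈ rewrite ==-≢ (x≢ u∈) | ==-≢ (x≢ v∈) = refl

    μ′-x : ∀ {v} → v ∈ R → μ′ x v ≡ toF v
    μ′-x v∈ rewrite ==-refl x | ==-≢ (x≢ v∈) = refl

    module _ {B : VSet N} (B⊆R : B ⊆ R) where

      row′-R : ∀ {u} → u ∈ R → row μ′ u ⟦ B ⟧ ≡ row μ u ⟦ B ⟧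
      row′-R {u} u∈ = trans (row-dot μ′ u ⟦ B ⟧) (trans (dot-cong-∈ {B = B} λ v v∈ → μ′-R u∈ (B⊆R v v∈)) (sym (row-dot μ u ⟦ B ⟧)))

      row′-x : row μ′ x ⟦ B ⟧ ≡ quad μ ⟦ B ⟧ ⟦ FA ⟧
      row′-x = trans (row-dot μ′ x ⟦ B ⟧) (trans (dot-cong-∈ {B = B} λ v v∈ → μ′-x (B⊆R v v∈)) (sym (quad-dot μ ⟦ B ⟧ ⟦ FA ⟧)))

      quad′ : quad μ′ ⟦ B ⟧ ⟦ B ⟧ ≡ quad μ ⟦ B ⟧ ⟦ B ⟧
      quad′ = trans (quad-dot μ′ ⟦ B ⟧ ⟦ B ⟧) (trans (dot-cong-∈ {B = B} λ v v∈ → row′-R (B⊆R v v∈)) (sym (quad-dot μ ⟦ B ⟧ ⟦ B ⟧)))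

    -- The net gain at `z`: each edge to M ∩ A disappears and returns 2 (D + 1), while each unit of
    -- new load costs 2.
    saved : Fin N → ℤ
    saved z = + 2 * (D + 1ℤ) * toM z - + 2 * (β′ z - β z)

    saved-free : ∀ b t → 0ℤ ≤ t → 0ℤ ≤ + 2 * (D + 1ℤ) * t - + 2 * (b - b)
    saved-free b t p = lin (q ⊕ q) (solve (D ∷ b ∷ t ∷ []))
      where q = *-nonneg 0≤D+1 p

    saved-single : ∀ b b′ t → b′ ≤ b + 1ℤ → 1ℤ ≤ t → + 2 * D ≤ + 2 * (D + 1ℤ) * t - + 2 * (b′ - b)
    saved-single b b′ t p q = lin (r ⊕ r ⊕ p ⊕ p) (solve (D ∷ b ∷ b′ ∷ t ∷ []))
      where r = *-nonneg 0≤D+1 (i≤j⇒0≤j-i q)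

    saved-forced₁ : ∀ b t → 0ℤ ≤ b → 1ℤ ≤ t → 0ℤ ≤ + 2 * (D + 1ℤ) * t - + 2 * (D + 1ℤ - b)
    saved-forced₁ b t p q = lin (r ⊕ r ⊕ p ⊕ p) (solve (D ∷ b ∷ t ∷ []))
      where r = *-nonneg 0≤D+1 (i≤j⇒0≤j-i q)

    saved-forced₂ : ∀ b t → 0ℤ ≤ b → + 2 ≤ t → + 2 * D ≤ + 2 * (D + 1ℤ) * t - + 2 * (D + 1ℤ - b)
    saved-forced₂ b t p q = lin (r ⊕ r ⊕ p ⊕ p ⊕ 0≤+ 2) (solve (D ∷ b ∷ t ∷ []))
      where r = *-nonneg 0≤D+1 (i≤j⇒0≤j-i q)

    saved≥0 : ∀ z → z ∈ R → 0ℤ ≤ saved z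
    saved≥0 z z∈ = from (β′-≢ (x≢ z∈))
      where
      from : ∀ {b} → NewLoad z b → 0ℤ ≤ + 2 * (D + 1ℤ) * toM z - + 2 * (b - β z)
      from (free _)         = saved-free (β z) (toM z) (toM≥0 z)
      from (single _ _ _ p) = ≤-trans 0≤2D (saved-single (β z) _ (toM z) (i⊓j≤i (β z + 1ℤ) (D + 1ℤ)) p)
      from (forced p _)     = saved-forced₁ (β z) (toM z) (proj₁ (load z)) p

    z₀∈R : z₀ ∈ R
    z₀∈R = ∈-∖⁺ z₀∈S z₀∉A

    -- A single edge traded for one unit of load leaves 2 (D + 1) - 2 = 2D. With two or more edges
    -- `z₀` may be forced into F, at a cost of at most 2 (D + 1) against at least 4 (D + 1).
    saved-z₀ : sp ≡ true → + 2 * D ≤ saved z₀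
    saved-z₀ q = from (β′-≢ (x≢ z₀∈R))
      where
      1≤toM : 1ℤ ≤ toM z₀
      1≤toM = ≤-trans (proj₂ (proj₂ (slack q))) (row-∈ μ≥0 z₀ (∈-∩⁺ x∈A (proj₁ (slack q))))
      from : ∀ {b} → NewLoad z₀ b → + 2 * D ≤ + 2 * (D + 1ℤ) * toM z₀ - + 2 * (b - β z₀)
      from (free p)         = ⊥-elim (1≰0 (≤-trans 1≤toM p))
      from (single _ _ _ p) = saved-single (β z₀) _ (toM z₀) (i⊓j≤i (β z₀ + 1ℤ) (D + 1ℤ)) p
      from (forced _ p)     = saved-forced₂ (β z₀) (toM z₀) (proj₁ (load z₀)) (p q refl)

    disjoint : ∀ {B} → B ⊆ R → ∀ u → u ∈ A → u ∉ B
    disjoint {B} B⊆R u u∈A = case u ∈? B of λ { (inj₁ p) → ∈-contra u∈A (∈-∖ʳ (B⊆R u p)) ; (inj₂ q) → q }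

    module _ {B : VSet N} (B⊆R : B ⊆ R) where

      weight′ : dot ⟦ B ⟧ (weight β′) ≡ dot ⟦ B ⟧ (weight β) - + 2 * (D + 1ℤ) * quad μ ⟦ B ⟧ ⟦ MA ⟧ + dot ⟦ B ⟧ saved
      weight′ = begin
        dot ⟦ B ⟧ (weight β′)                                                     ≡⟨ dot-cong {a = ⟦ B ⟧} (λ _ → refl) (λ z → split (β z) (β′ z) (toM z)) ⟩
        dot ⟦ B ⟧ (weight β ⊞ (λ z → - (+ 2 * (D + 1ℤ)) * toM z) ⊞ saved)         ≡⟨ dot-+ʳ ⟦ B ⟧ (weight β ⊞ (λ z → - (+ 2 * (D + 1ℤ)) * toM z)) saved ⟩
        dot ⟦ B ⟧ (weight β ⊞ (λ z → - (+ 2 * (D + 1ℤ)) * toM z)) + dot ⟦ B ⟧ saved ≡⟨ cong (_+ dot ⟦ B ⟧ saved) (dot-+ʳ ⟦ B ⟧ (weight β) (λ z → - (+ 2 * (D + 1ℤ)) * toM z)) ⟩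
        dot ⟦ B ⟧ (weight β) + dot ⟦ B ⟧ (λ z → - (+ 2 * (D + 1ℤ)) * toM z) + dot ⟦ B ⟧ saved ≡⟨ cong (λ t → dot ⟦ B ⟧ (weight β) + t + dot ⟦ B ⟧ saved) (dot-*ʳ ⟦ B ⟧ toM (- (+ 2 * (D + 1ℤ)))) ⟩
        dot ⟦ B ⟧ (weight β) + - (+ 2 * (D + 1ℤ)) * dot ⟦ B ⟧ toM + dot ⟦ B ⟧ saved ≡⟨ cong (λ t → dot ⟦ B ⟧ (weight β) + - (+ 2 * (D + 1ℤ)) * t + dot ⟦ B ⟧ saved) (sym (quad-dot μ ⟦ B ⟧ ⟦ MA ⟧)) ⟩
        dot ⟦ B ⟧ (weight β) + - (+ 2 * (D + 1ℤ)) * quad μ ⟦ B ⟧ ⟦ MA ⟧ + dot ⟦ B ⟧ saved ≡⟨ minus (dot ⟦ B ⟧ (weight β)) (+ 2 * (D + 1ℤ)) (quad μ ⟦ B ⟧ ⟦ MA ⟧) (dot ⟦ B ⟧ saved) ⟩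
        dot ⟦ B ⟧ (weight β) - + 2 * (D + 1ℤ) * quad μ ⟦ B ⟧ ⟦ MA ⟧ + dot ⟦ B ⟧ saved ∎
        where
        open ≡-Reasoning
        split : ∀ b b′ t → + 4 * D + + 3 - + 2 * b′ ≡ + 4 * D + + 3 - + 2 * b + - (+ 2 * (D + 1ℤ)) * t + (+ 2 * (D + 1ℤ) * t - + 2 * (b′ - b))
        split b b′ t = solve (D ∷ b ∷ b′ ∷ t ∷ [])
        minus : ∀ x k y z → x + - k * y + z ≡ x - k * y + z
        minus = solve-∀

      ρ-∪ : ρ m β ⟦ A ∪ B ⟧ ≡ ρ m β ⟦ A ⟧ + ρ m β ⟦ B ⟧ - + 2 * (D + 1ℤ) * (quad μ ⟦ B ⟧ ⟦ MA ⟧ + quad μ ⟦ B ⟧ ⟦ FA ⟧)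
      ρ-∪ = trans (ρ-cong m β (⟦⟧-∪ (disjoint B⊆R))) (trans (ρ-⊞ m β ⟦ A ⟧ ⟦ B ⟧)
        (cong (λ t → ρ m β ⟦ A ⟧ + ρ m β ⟦ B ⟧ - + 2 * (D + 1ℤ) * t)
          (trans (quad-cong μ {a = ⟦ B ⟧} (λ _ → refl) (⟦⟧-∩∖ A c)) (quad-+ʳ μ ⟦ B ⟧ ⟦ MA ⟧ ⟦ FA ⟧))))

      -- Edges from `B` to M ∩ A survive as load, up to `saved`; edges to F ∩ A are not seen while
      -- `x` is left out, hence the middle gain. With `x` they are counted again, and `ρ′-x` has the
      -- weight 2D + 1 of `x` in their place.
      ρ′-R : ρ m′ β′ ⟦ B ⟧ ≡ ρ m β ⟦ A ∪ B ⟧ - ρ m β ⟦ A ⟧ + + 2 * (D + 1ℤ) * quad μ ⟦ B ⟧ ⟦ FA ⟧ + dot ⟦ B ⟧ saved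
      ρ′-R = trans (ρ-def m′ β′ ⟦ B ⟧) (trans (cong₂ (λ s t → s - (D + 1ℤ) * t) weight′ (quad′ B⊆R))
        (trans (regroup (dot ⟦ B ⟧ (weight β)) (D + 1ℤ) (quad μ ⟦ B ⟧ ⟦ MA ⟧) (quad μ ⟦ B ⟧ ⟦ FA ⟧) (dot ⟦ B ⟧ saved) (quad μ ⟦ B ⟧ ⟦ B ⟧) (ρ m β ⟦ A ⟧))
        (cong (λ t → t - ρ m β ⟦ A ⟧ + + 2 * (D + 1ℤ) * quad μ ⟦ B ⟧ ⟦ FA ⟧ + dot ⟦ B ⟧ saved)
          (trans (cong (λ t → ρ m β ⟦ A ⟧ + t - + 2 * (D + 1ℤ) * (quad μ ⟦ B ⟧ ⟦ MA ⟧ + quad μ ⟦ B ⟧ ⟦ FA ⟧)) (sym (ρ-def m β ⟦ B ⟧))) (sym ρ-∪)))))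
        where
        regroup : ∀ w k x y s q r → w - + 2 * k * x + s - k * q ≡ r + (w - k * q) - + 2 * k * (x + y) - r + + 2 * k * y + s
        regroup = solve-∀

      ρ′-x : ρ m′ β′ (⟦ B ⟧ ⊞ δ x) ≡ ρ m β ⟦ A ∪ B ⟧ - ρ m β ⟦ A ⟧ + (+ 2 * D + 1ℤ) + dot ⟦ B ⟧ saved
      ρ′-x = trans (ρ-⊞ m′ β′ ⟦ B ⟧ (δ x)) (trans (cong₂ (λ s t → s + t - + 2 * (D + 1ℤ) * quad μ′ (δ x) ⟦ B ⟧) ρ′-R (trans (ρ-δ m′ β′ x) (cong (λ b → + 4 * D + + 3 - + 2 * b) β′-x)))
        (trans (cong (λ t → ρ m β ⟦ A ∪ B ⟧ - ρ m β ⟦ A ⟧ + + 2 * (D + 1ℤ) * quad μ ⟦ B ⟧ ⟦ FA ⟧ + dot ⟦ B ⟧ saved + (+ 4 * D + + 3 - + 2 * (D + 1ℤ)) - + 2 * (D + 1ℤ) * t) (trans (quad-δ μ′ x ⟦ B ⟧) (row′-x B⊆R)))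
          (regroup (ρ m β ⟦ A ∪ B ⟧) (ρ m β ⟦ A ⟧) D (quad μ ⟦ B ⟧ ⟦ FA ⟧) (dot ⟦ B ⟧ saved))))
        where
        regroup : ∀ r r′ d q s → r - r′ + + 2 * (d + 1ℤ) * q + s + (+ 4 * d + + 3 - + 2 * (d + 1ℤ)) - + 2 * (d + 1ℤ) * q ≡ r - r′ + (+ 2 * d + 1ℤ) + s
        regroup = solve-∀

    module _
      (grow : ∀ {B} → B ⊆ R → ∀ w → w ∈ R → w ∉ B → ρ m β ⟦ A ⟧ ≤ ρ m β ⟦ A ∪ B ⟧)
      (whole₁ : - 1ℤ ≤ ρ m β ⟦ S ⟧ - ρ m β ⟦ A ⟧ + + 2 * (D + 1ℤ) * quad μ ⟦ R ⟧ ⟦ FA ⟧ + dot ⟦ R ⟧ saved)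
      (whole₂ : - 1ℤ ≤ ρ m β ⟦ S ⟧ - ρ m β ⟦ A ⟧ + (+ 2 * D + 1ℤ) + dot ⟦ R ⟧ saved)
      where

      -- If `B` misses a vertex of `R`, then `A ∪ B` is still proper and `grow` suffices. Only
      -- `B = R` has to fall back on the potential of `S` itself, without `x` by `whole₁` and with
      -- `x` by `whole₂`.
      sparse′ : Sparse m′ β′ S′
      sparse′ B′ B′⊆ _ = case x ∈? B′ of λ
        { (inj₁ x∈) → subst (- 1ℤ ≤_) (sym (ρ-cong m′ β′ (⟦⟧-remove x∈))) with-x
        ; (inj₂ x∉) → subst (- 1ℤ ≤_) (sym (ρ-cong m′ β′ (⟦⟧-remove-∉ x∉))) without-x }
        where
        B = B′ − x
        B⊆R : B ⊆ R
        B⊆R u p = case ∈-⁺⁻ (B′⊆ u (∈-−ˡ p)) of λ { (inj₁ e) → ⊥-elim (∈-−ʳ p e) ; (inj₂ q) → q }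
        B≡R : (∀ u → u ∉ R ∖ B) → ∀ u → ⟦ B ⟧ u ≡ ⟦ R ⟧ u
        B≡R e u = ≤-antisym (⟦⟧-mono B⊆R u) (χ-mono λ p → case u ∈? B of λ { (inj₁ q) → is-true q ; (inj₂ q) → ∈-contra (∈-∖⁺ (mem {A = R} p) q) (e u) })
        A∪R : (∀ u → u ∉ R ∖ B) → ∀ u → ⟦ A ∪ B ⟧ u ≡ ⟦ S ⟧ u
        A∪R e u = trans (⟦⟧-∪ (disjoint B⊆R) u) (trans (cong (_+_ (⟦ A ⟧ u)) (B≡R e u)) (sym (⟦⟧-split A⊆S u)))
        s≥0 : 0ℤ ≤ dot ⟦ B ⟧ saved
        s≥0 = dot-≥ λ u p → saved≥0 u (B⊆R u p)
        q≥0 : 0ℤ ≤ + 2 * (D + 1ℤ) * quad μ ⟦ B ⟧ ⟦ FA ⟧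
        q≥0 = *-nonneg (*-nonneg (0≤+ 2) 0≤D+1) (quad≥0 μ≥0 (⟦⟧≥0 B) (⟦⟧≥0 FA))
        arith : ∀ r r′ y s → r ≤ r′ → 0ℤ ≤ y → 0ℤ ≤ s → - 1ℤ ≤ r′ - r + y + s
        arith r r′ y s p q t = lin (p ⊕ q ⊕ t ⊕ 0≤+ 1) (solve (r ∷ r′ ∷ y ∷ s ∷ []))
        without-x : - 1ℤ ≤ ρ m′ β′ ⟦ B ⟧
        without-x = subst (- 1ℤ ≤_) (sym (ρ′-R B⊆R)) (case nonempty? (R ∖ B) of λ
          { (inj₁ (w , w∈)) → arith _ _ _ _ (grow B⊆R w (∈-∖ˡ w∈) (∈-∖ʳ w∈)) q≥0 s≥0
          ; (inj₂ e) → subst (- 1ℤ ≤_) (cong₂ _+_ (cong₂ (λ s t → s - ρ m β ⟦ A ⟧ + + 2 * (D + 1ℤ) * t) (sym (ρ-cong m β (A∪R e))) (quad-cong μ (sym ∘ B≡R e) (λ _ → refl))) (dot-cong (sym ∘ B≡R e) (λ _ → refl))) whole₁ })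
        with-x : - 1ℤ ≤ ρ m′ β′ (⟦ B ⟧ ⊞ δ x)
        with-x = subst (- 1ℤ ≤_) (sym (ρ′-x B⊆R)) (case nonempty? (R ∖ B) of λ
          { (inj₁ (w , w∈)) → arith _ _ _ _ (grow B⊆R w (∈-∖ˡ w∈) (∈-∖ʳ w∈)) (0≤2D ⊕ 0≤+ 1) s≥0
          ; (inj₂ e) → subst (- 1ℤ ≤_) (cong₂ (λ s t → s - ρ m β ⟦ A ⟧ + (+ 2 * D + 1ℤ) + t) (sym (ρ-cong m β (A∪R e))) (dot-cong (sym ∘ B≡R e) (λ _ → refl))) whole₂ })

    size′ : + 2 ≤ size A → size S′ + 1ℤ ≤ size S
    size′ two = subst₂ _≤_ (cong (_+ 1ℤ) (sym (size-insert (nmem-R)))) (sym size-S) (arith (size R) (size A) two)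
      where
      nmem-R : x ∉ R
      nmem-R = disjoint (λ _ p → p) x x∈A
      size-S : size S ≡ size A + size R
      size-S = trans (∑-cong (⟦⟧-split A⊆S)) (∑-+ ⟦ A ⟧ ⟦ R ⟧)
      arith : ∀ r a → + 2 ≤ a → r + 1ℤ + 1ℤ ≤ a + r
      arith r a p = lin p (solve (r ∷ a ∷ []))

    module _ {c′ : VSet N} (C′ : Colored m′ β′ S′ c′) where

      glued : VSet N
      glued u = if A u then c u else c′ u

      glued-A : ∀ {u} → u ∈ A → glued u ≡ c u
      glued-A (mem p) rewrite p = refl

      glued-R : ∀ {u} → u ∉ A → glued u ≡ c′ u
      glued-R (nmem p) rewrite p = refl

      MR : VSet N
      MR = R ∩ c′

      MR⊆ : MR ⊆ S′ ∩ c′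
      MR⊆ u p = ∈-∩⁺ (∈-⁺ˡ (∈-∩ˡ p)) (∈-∩ʳ p)

      deg′ : ∀ {v} → v ∈ S′ → v ∈ c′ → β′ v ≤ D
      deg′ {v} v∈ v∈c = lin (degree C′ v v∈ v∈c ⊕ row≥0 (Mult.μ≥0 m′) v (⟦⟧≥0 (S′ ∩ c′))) (solve′ (row μ′ v ⟦ S′ ∩ c′ ⟧) (β′ v) D)
        where
        solve′ : ∀ r b d → d - b ≡ d + r - (r + b + 0ℤ)
        solve′ = solve-∀

      x∉c′ : x ∉ c′
      x∉c′ = case x ∈? c′ of λ
        { (inj₁ p) → ⊥-elim (1≰0 (lin (subst (_≤ D) β′-x (deg′ ∈-⁺≡ p)) (solve (D ∷ []))))
        ; (inj₂ q) → q }

      MR-load : ∀ z → z ∈ MR → toM z ≤ δ z₀ z × toM z + β z ≤ β′ z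
      MR-load z z∈ = from (β′-≢ (x≢ (∈-∩ˡ z∈))) (deg′ (∈-⁺ˡ (∈-∩ˡ z∈)) (∈-∩ʳ z∈))
        where
        from : ∀ {b} → NewLoad z b → b ≤ D → toM z ≤ δ z₀ z × toM z + β z ≤ b
        from (free p) _ = ≤-trans p (χ≥0 (z₀ == z)) , subst (toM z + β z ≤_) (+-identityˡ (β z)) (+-monoˡ-≤ (β z) p)
        from (single _ refl p _) q = subst (toM z ≤_) (sym (δ-refl z)) p ,
          ≤-trans (subst (toM z + β z ≤_) (+-comm 1ℤ (β z)) (+-monoˡ-≤ (β z) p)) (raise-M β (λ _ → 1ℤ) z q)
        from (forced _ _) q = ⊥-elim (1≰0 (lin q (solve (D ∷ []))))

      -- Being in M, `z` is not `forced`. If it is `free`, it has no edge to `MA`; if it is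
      -- `single`, it is `z₀` with exactly one such edge, and that edge ends in `x`.
      cross : ∀ {u z} → u ∈ MA → z ∈ MR → μ u z ≤ χ sp * δ x u * δ z₀ z
      cross {u} {z} u∈ z∈ = subst (_≤ χ sp * δ x u * δ z₀ z) (μ-sym z u) (from (β′-≢ (x≢ (∈-∩ˡ z∈))) (deg′ (∈-⁺ˡ (∈-∩ˡ z∈)) (∈-∩ʳ z∈)))
        where
        rhs≥0 : 0ℤ ≤ χ sp * δ x u * δ z₀ z
        rhs≥0 = *-nonneg (*-nonneg (χ≥0 sp) (χ≥0 (x == u))) (χ≥0 (z₀ == z))
        from : ∀ {b} → NewLoad z b → b ≤ D → μ z u ≤ χ sp * δ x u * δ z₀ z
        from (free p) _ = ≤-trans (row-∈ μ≥0 z u∈) (≤-trans p rhs≥0)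
        from (forced _ _) q = ⊥-elim (1≰0 (lin q (solve (D ∷ []))))
        from (single q refl p _) _ = case x ≟ u of λ
          { (yes refl) → ≤-trans (row-∈ μ≥0 z u∈) (≤-trans p (≤-reflexive (sym (cong₂ _*_ (cong₂ _*_ (cong χ q) (δ-refl x)) (δ-refl z)))))
          ; (no x≢u) → ≤-trans (none (μ z u) (μ z x) (toM z) (row-∈₂ m (∈-∩⁺ x∈A (proj₁ (slack q))) u∈ x≢u) p (proj₂ (proj₂ (slack q)))) rhs≥0 }
          where
          none : ∀ a b t → a + b ≤ t → t ≤ 1ℤ → 1ℤ ≤ b → a ≤ 0ℤ
          none a b t p q r = lin (p ⊕ q ⊕ r) (solve (a ∷ b ∷ t ∷ []))

      M∩A⊆ : (S ∩ glued) ∩ A ⊆ MA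
      M∩A⊆ u p = ∈-∩⁺ (∈-∩ʳ p) (mem (trans (sym (glued-A (∈-∩ʳ p))) (is-true (∈-∩ʳ (∈-∩ˡ p)))))

      M∖A⊆ : (S ∩ glued) ∖ A ⊆ MR
      M∖A⊆ u p = ∈-∩⁺ (∈-∖⁺ (∈-∩ˡ (∈-∖ˡ p)) (∈-∖ʳ p)) (mem (trans (sym (glued-R (∈-∖ʳ p))) (is-true (∈-∩ʳ (∈-∖ˡ p)))))

      F∩A⊆ : (S ∖ glued) ∩ A ⊆ FA
      F∩A⊆ u p = ∈-∖⁺ (∈-∩ʳ p) (nmem (trans (sym (glued-A (∈-∩ʳ p))) (is-false (∈-∖ʳ (∈-∩ˡ p)))))

      F∖A⊆ : (S ∖ glued) ∖ A ⊆ R ∖ c′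
      F∖A⊆ u p = ∈-∖⁺ (∈-∖⁺ (∈-∖ˡ (∈-∖ˡ p)) (∈-∖ʳ p)) (nmem (trans (sym (glued-R (∈-∖ʳ p))) (is-false (∈-∖ʳ (∈-∖ˡ p)))))

      acyclic-R : ∀ {P} → P ⊆ R → Acyclic μ′ P → Acyclic μ P
      acyclic-R P⊆R ac B B⊆ u u∈ = subst (λ t → t + + 2 ≤ + 2 * size B) (quad′ {B} (λ w p → P⊆R w (B⊆ w p))) (ac B B⊆ u u∈)

      -- In M at most one edge joins the two parts, so no cycle crosses between them. In F a cycle
      -- through `A` would contract to a cycle through `x`, and `x` is in F because of its load.
      lift : Colored m β S glued
      lift = record
        { forestM = acyclic-glue m A (acyclic-mono M∩A⊆ (forestM C)) (acyclic-mono M∖A⊆ acMR) glueM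
        ; forestF = acyclic-glue m A (acyclic-mono F∩A⊆ (forestF C)) (acyclic-mono F∖A⊆ acFR) glueF
        ; degree  = deg
        }
        where
        acMR : Acyclic μ MR
        acMR = acyclic-R (λ u → ∈-∩ˡ) (acyclic-mono MR⊆ (forestM C′))
        acFR : Acyclic μ (R ∖ c′)
        acFR = acyclic-R (λ u → ∈-∖ˡ) (acyclic-mono (λ u p → ∈-∖⁺ (∈-⁺ˡ (∈-∖ˡ p)) (∈-∖ʳ p)) (forestF C′))
        glueM : ∀ B E u → B ⊆ (S ∩ glued) ∖ A → E ⊆ (S ∩ glued) ∩ A → u ∈ B → quad μ ⟦ B ⟧ ⟦ B ⟧ + + 2 * quad μ ⟦ B ⟧ ⟦ E ⟧ ≤ + 2 * size B
        glueM B E u B⊆ E⊆ u∈ = arith (quad μ ⟦ B ⟧ ⟦ B ⟧) (quad μ ⟦ B ⟧ ⟦ E ⟧) (size B) (acMR B (λ w p → M∖A⊆ w (B⊆ w p)) u u∈)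
          (subst (_≤ 1ℤ) (sym (quad-dot μ ⟦ B ⟧ ⟦ E ⟧)) (≤-trans (dot-mono-∈ λ z z∈ → ≤-trans (row-mono μ≥0 z (⟦⟧-mono λ w p → M∩A⊆ w (E⊆ w p))) (proj₁ (MR-load z (M∖A⊆ z (B⊆ z z∈)))))
            (subst (_≤ 1ℤ) (sym (dot-⟦⟧δ B z₀)) (χ≤1 (B z₀)))))
          where
          arith : ∀ q e s → q + + 2 ≤ + 2 * s → e ≤ 1ℤ → q + + 2 * e ≤ + 2 * s
          arith q e s p r = lin (p ⊕ r ⊕ r) (solve (q ∷ e ∷ s ∷ []))
        glueF : ∀ B E u → B ⊆ (S ∖ glued) ∖ A → E ⊆ (S ∖ glued) ∩ A → u ∈ B → quad μ ⟦ B ⟧ ⟦ B ⟧ + + 2 * quad μ ⟦ B ⟧ ⟦ E ⟧ ≤ + 2 * size B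
        glueF B E u B⊆ E⊆ u∈ = arith (quad μ ⟦ B ⟧ ⟦ B ⟧) (quad μ ⟦ B ⟧ ⟦ E ⟧) (quad μ ⟦ B ⟧ ⟦ FA ⟧) (size B)
          (subst₂ (λ s t → s + + 2 ≤ + 2 * t) quad-B⁺x (size-insert x∉B) (forestF C′ (B ⁺ x) B⁺x⊆ x ∈-⁺≡))
          (quad-monoʳ μ≥0 (⟦⟧≥0 B) (⟦⟧-mono λ w p → F∩A⊆ w (E⊆ w p)))
          where
          B⊆R : B ⊆ R
          B⊆R w p = ∈-∖ˡ (F∖A⊆ w (B⊆ w p))
          x∉B : x ∉ B
          x∉B = disjoint B⊆R x x∈A
          B⁺x⊆ : B ⁺ x ⊆ S′ ∖ c′
          B⁺x⊆ w p = case ∈-⁺⁻ p of λ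
            { (inj₁ refl) → ∈-∖⁺ ∈-⁺≡ x∉c′
            ; (inj₂ q) → ∈-∖⁺ (∈-⁺ˡ (B⊆R w q)) (∈-∖ʳ (F∖A⊆ w (B⊆ w q))) }
          quad-B⁺x : quad μ′ ⟦ B ⁺ x ⟧ ⟦ B ⁺ x ⟧ ≡ quad μ ⟦ B ⟧ ⟦ B ⟧ + + 2 * quad μ ⟦ B ⟧ ⟦ FA ⟧
          quad-B⁺x = trans (quad-cong μ′ (⟦⟧-insert x∉B) (⟦⟧-insert x∉B)) (trans (quad-⊞δ m′ ⟦ B ⟧ x) (cong₂ (λ s t → s + + 2 * t) (quad′ B⊆R) (row′-x B⊆R)))
          arith : ∀ q e f s → q + + 2 * f + + 2 ≤ + 2 * (s + 1ℤ) → e ≤ f → q + + 2 * e ≤ + 2 * s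
          arith q e f s p r = lin (p ⊕ r ⊕ r) (solve (q ∷ e ∷ f ∷ s ∷ []))
        rows : ∀ v → row μ v ⟦ S ∩ glued ⟧ ≤ row μ v ⟦ MA ⟧ + row μ v ⟦ MR ⟧
        rows v = subst (_≤ row μ v ⟦ MA ⟧ + row μ v ⟦ MR ⟧) (sym (row-∩∖ {m = m} v (S ∩ glued) A)) (row-mono μ≥0 v (⟦⟧-mono M∩A⊆) ⊕ row-mono μ≥0 v (⟦⟧-mono M∖A⊆))
        deg : ∀ v → v ∈ S → v ∈ glued → row μ v ⟦ S ∩ glued ⟧ + β v ≤ D
        deg v v∈S v∈g = case v ∈? A of λ
          { (inj₁ v∈A) → inA v∈A (mem (trans (sym (glued-A v∈A)) (is-true v∈g)))
          ; (inj₂ v∉A) → inR (∈-∩⁺ (∈-∖⁺ v∈S v∉A) (mem (trans (sym (glued-R v∉A)) (is-true v∈g)))) }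
          where
          arithA : ∀ r a e b b′ → r ≤ a + e → b + e ≤ b′ → a + b′ ≤ D → r + b ≤ D
          arithA r a e b b′ p q s = lin (p ⊕ q ⊕ s) (solve (r ∷ a ∷ e ∷ b ∷ b′ ∷ D ∷ []))
          inA : v ∈ A → v ∈ c → row μ v ⟦ S ∩ glued ⟧ + β v ≤ D
          inA v∈A v∈c = arithA (row μ v ⟦ S ∩ glued ⟧) (row μ v ⟦ MA ⟧) (χ sp * δ x v) (β v) (βA v)
            (≤-trans (rows v) (+-monoʳ-≤ (row μ v ⟦ MA ⟧) row-R)) β+ (degree C v v∈A v∈c)
            where
            e≥0 : 0ℤ ≤ χ sp * δ x v
            e≥0 = *-nonneg (χ≥0 sp) (χ≥0 (x == v))
            row-R : row μ v ⟦ MR ⟧ ≤ χ sp * δ x v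
            row-R = subst (_≤ χ sp * δ x v) (sym (row-dot μ v ⟦ MR ⟧)) (≤-trans (dot-mono-∈ {B = MR} λ z z∈ → cross (∈-∩⁺ v∈A v∈c) z∈)
              (subst (_≤ χ sp * δ x v) (sym (trans (dot-*ʳ ⟦ MR ⟧ (δ z₀) (χ sp * δ x v)) (cong (_*_ (χ sp * δ x v)) (dot-⟦⟧δ MR z₀))))
                (subst (χ sp * δ x v * ⟦ MR ⟧ z₀ ≤_) (*-identityʳ (χ sp * δ x v)) (*-monoˡ (χ sp * δ x v) e≥0 (χ≤1 (MR z₀))))))
            β+ : β v + χ sp * δ x v ≤ βA v
            β+ = case sp Bool.≟ true of λ
              { (no q) → subst (λ t → β v + t ≤ βA v) (sym (cong (λ t → χ t * δ x v) (≢true q))) (subst (_≤ βA v) (sym (+-identityʳ (β v))) (β≤βA v v∈A v∈c))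
              ; (yes q) → case x ≟ v of λ
                { (yes refl) → subst (λ t → β v + t ≤ βA v) (sym (cong₂ _*_ (cong χ q) (δ-refl x))) (proj₁ (proj₂ (slack q)))
                ; (no ne) → subst (λ t → β v + t ≤ βA v) (sym (trans (cong (χ sp *_) (δ-≢ ne)) (*-zeroʳ (χ sp)))) (subst (_≤ βA v) (sym (+-identityʳ (β v))) (β≤βA v v∈A v∈c)) } }
              where
              ≢true : ∀ {b} → b ≢ true → b ≡ false
              ≢true {false} _ = refl
              ≢true {true} p = ⊥-elim (p refl)
          arithR : ∀ r a e e′ b b′ → r ≤ a + e → e ≤ e′ → a + b ≤ b′ → e′ + b′ ≤ D → r + b ≤ D
          arithR r a e e′ b b′ p q s t = lin (p ⊕ q ⊕ s ⊕ t) (solve (r ∷ a ∷ e ∷ e′ ∷ b ∷ b′ ∷ D ∷ []))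
          inR : v ∈ MR → row μ v ⟦ S ∩ glued ⟧ + β v ≤ D
          inR v∈ = arithR (row μ v ⟦ S ∩ glued ⟧) (toM v) (row μ v ⟦ MR ⟧) (row μ′ v ⟦ S′ ∩ c′ ⟧) (β v) (β′ v) (rows v)
            (subst (_≤ row μ′ v ⟦ S′ ∩ c′ ⟧) (row′-R {MR} (λ u → ∈-∩ˡ) (∈-∩ˡ v∈)) (row-mono (Mult.μ≥0 m′) v (⟦⟧-mono MR⊆)))
            (proj₂ (MR-load v v∈)) (degree C′ v (∈-⁺ˡ (∈-∩ˡ v∈)) (∈-∩ʳ v∈))

-- Raising the gap by one unit

module GapStep {N : ℕ} (D : ℤ) (1≤D : 1ℤ ≤ D) where
  open Potential {N} D 1≤D public
  open Contraction {N} D 1≤D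

  sparse-raise : ∀ {m β f A g} t → (∀ B → B ⊆ A → + 2 ≤ size B → g ≤ ρ m β ⟦ B ⟧) → - 1ℤ ≤ g - + 2 * t →
    (∀ B → B ⊆ A → dot ⟦ B ⟧ f ≤ t) → Sparse m (raise β f) A
  sparse-raise {m} {β} {f} {A} {g} t gap g≥ f≤ B B⊆ two =
    arith (ρ m β ⟦ B ⟧) (ρ m (raise β f) ⟦ B ⟧) (dot ⟦ B ⟧ f) g t (gap B B⊆ two) g≥ (f≤ B B⊆) (ρ-load m ⟦ B ⟧ (⟦⟧≥0 B) (raise-≤ β f))
    where
    arith : ∀ r r′ e g t → g ≤ r → - 1ℤ ≤ g - + 2 * t → e ≤ t → r ≤ r′ + + 2 * e → - 1ℤ ≤ r′
    arith r r′ e g t p q s u = lin (p ⊕ q ⊕ s ⊕ s ⊕ u) (solve (r ∷ r′ ∷ e ∷ g ∷ t ∷ []))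

  module _ (m : Mult N) {β : Fin N → ℤ} (load : IsLoad β) {S : VSet N} (sparse : Sparse m β S) (below : Below S) where
    open Mult m

    -- A proper set A of potential exactly g is colored with the load of one vertex x,
    -- an end of an edge leaving A, raised by t, and then contracted. If x lands in F, that edge
    -- goes to the contracted vertex; if x lands in M, its spare capacity serves the other end.
    -- Either way the whole graph gains at least g.
    gap-step : ∀ {g} t → 0ℤ ≤ t → g ≤ + 2 * D + 1ℤ → - 1ℤ ≤ g - + 2 * t →
      g ≤ 0ℤ ⊎ 1ℤ ≤ t × (g ≤ + 2 * D ⊎ D + 1ℤ ≤ t) →
      Gap m β S g → Colorable m β S ⊎ Gap m β S (g + 1ℤ)
    gap-step {g} t 0≤t g≤ g≥ cond gap = case search-gap m β S (g + 1ℤ) of λ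
      { (inj₁ gap′) → inj₂ gap′
      ; (inj₂ (A , A⊆S , (w , w∈S , w∉A) , two , le)) → inj₁ (reduce A A⊆S w w∈S w∉A two (gap A A⊆S w w∈S w∉A two) (lin le (cancel g (ρ m β ⟦ A ⟧)))) }
      where
      cancel : ∀ g r → g - r ≡ g + 1ℤ - (r + 1ℤ)
      cancel = solve-∀
      reduce : ∀ A → A ⊆ S → ∀ w → w ∈ S → w ∉ A → + 2 ≤ size A → g ≤ ρ m β ⟦ A ⟧ → ρ m β ⟦ A ⟧ ≤ g → Colorable m β S
      reduce A A⊆S w w∈S w∉A two g≤A A≤g = case n≤0⊎1≤n (quad μ ⟦ R₀ ⟧ ⟦ A ⟧) of λ
        { (inj₁ q≤0) → no-edge q≤0
        ; (inj₂ q≥1) → edge q≥1 }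
        where
        R₀ = S ∖ A
        w∈R : w ∈ R₀
        w∈R = ∈-∖⁺ w∈S w∉A
        ρS : - 1ℤ ≤ ρ m β ⟦ S ⟧
        ρS = sparse S (λ _ p → p) (≤-trans two (size-mono A⊆S))
        smaller : size A + 1ℤ ≤ size S
        smaller = subst (size A + 1ℤ ≤_) (sym (size-remove w∈S)) (+-monoˡ-≤ 1ℤ (size-mono λ u p → ∈-−⁺ (A⊆S u p) λ { refl → ∈-contra p w∉A }))
        gapA : ∀ B → B ⊆ A → + 2 ≤ size B → g ≤ ρ m β ⟦ B ⟧
        gapA B B⊆ = gap B (λ u p → A⊆S u (B⊆ u p)) w w∈S (∉-⊆ B⊆ w∉A)
        grow : ∀ {B} → B ⊆ R₀ → ∀ z → z ∈ R₀ → z ∉ B → ρ m β ⟦ A ⟧ ≤ ρ m β ⟦ A ∪ B ⟧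
        grow {B} B⊆ z z∈ z∉ = ≤-trans A≤g (gap (A ∪ B)
          (λ u p → case ∈-∪⁻ p of λ { (inj₁ q) → A⊆S u q ; (inj₂ q) → ∈-∖ˡ (B⊆ u q) })
          z (∈-∖ˡ z∈) (∉-∪ (∈-∖ʳ z∈) z∉) (≤-trans two (size-mono λ u → ∈-∪ˡ)))

        finish : ∀ {βA c x z₀} (C : Colored m βA A c) (le : ∀ u → u ∈ A → u ∈ c → β u ≤ βA u) (x∈A : x ∈ A) (z∈S : z₀ ∈ S) (z∉A : z₀ ∉ A)
          (sp : Bool) (sl : sp ≡ true → x ∈ c × β x + 1ℤ ≤ βA x × 1ℤ ≤ μ z₀ x) →
          - 1ℤ ≤ ρ m β ⟦ S ⟧ - ρ m β ⟦ A ⟧ + + 2 * (D + 1ℤ) * quad μ ⟦ R₀ ⟧ ⟦ A ∖ c ⟧ + dot ⟦ R₀ ⟧ (Piece.saved m load A⊆S C le x∈A z∈S z∉A sp sl) →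
          - 1ℤ ≤ ρ m β ⟦ S ⟧ - ρ m β ⟦ A ⟧ + (+ 2 * D + 1ℤ) →
          Colorable m β S
        finish C le x∈A z∈S z∉A sp sl whole₁ whole₂ =
          let c′ , C′ = below J.m′ J.β′ J.S′ J.load′ (J.size′ two) (J.sparse′ grow whole₁ (padʳ whole₂ (dot-≥ J.saved≥0))) in J.glued C′ , J.lift C′
          where module J = Piece m load A⊆S C le x∈A z∈S z∉A sp sl

        -- With no edge leaving `A`, the potential of `S` minus that of `A` is the potential of the
        -- rest, already at least -1. No gain has to be produced, and any vertex of `A` may serve as
        -- `x`.
        no-edge : quad μ ⟦ R₀ ⟧ ⟦ A ⟧ ≤ 0ℤ → Colorable m β S
        no-edge q≤0 =
          let x , x∈A = dot-one
              c , C = below m β A load smaller (sparse-⊆ A⊆S sparse)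
          in finish C (λ _ _ _ → ≤-refl) x∈A w∈S w∉A false (λ ())
               (whole (+ 2 * (D + 1ℤ) * quad μ ⟦ R₀ ⟧ ⟦ A ∖ c ⟧) (dot ⟦ R₀ ⟧ (Piece.saved m load A⊆S C (λ _ _ _ → ≤-refl) x∈A w∈S w∉A false (λ ())))
                  (*-nonneg (*-nonneg (0≤+ 2) 0≤D+1) (quad≥0 μ≥0 (⟦⟧≥0 R₀) (⟦⟧≥0 (A ∖ c)))) (dot-≥ (Piece.saved≥0 m load A⊆S C (λ _ _ _ → ≤-refl) x∈A w∈S w∉A false (λ ()))))
               (lin (whole (+ 2 * D + 1ℤ) 0ℤ 0≤2D+1 ≤-refl) (drop (ρ m β ⟦ S ⟧ - ρ m β ⟦ A ⟧ + (+ 2 * D + 1ℤ))))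
          where
          drop : ∀ a → a - - 1ℤ ≡ a + 0ℤ - - 1ℤ
          drop = solve-∀
          0≤2D+1 : 0ℤ ≤ + 2 * D + 1ℤ
          0≤2D+1 = lin (1≤D ⊕ 1≤D ⊕ 0≤+ 3) (solve (D ∷ []))
          dot-one : ∃[ x ] x ∈ A
          dot-one = case nonempty? A of λ { (inj₁ p) → p ; (inj₂ e) → ⊥-elim (1≰0 (≤-trans (≤-trans (+≤+ (ℕ.s≤s ℕ.z≤n)) two) (≤-reflexive (size-empty e)))) }
          ρR : - 1ℤ ≤ ρ m β ⟦ R₀ ⟧
          ρR = case single-or-two m β load w∈R of λ
            { (inj₁ p) → sparse R₀ (λ _ → ∈-∖ˡ) p
            ; (inj₂ p) → ≤-trans -≤+ (≤-trans 0≤2D+1 p) }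
          ρS≡ : ρ m β ⟦ S ⟧ ≡ ρ m β ⟦ A ⟧ + ρ m β ⟦ R₀ ⟧ - + 2 * (D + 1ℤ) * quad μ ⟦ R₀ ⟧ ⟦ A ⟧
          ρS≡ = trans (ρ-cong m β (⟦⟧-split A⊆S)) (ρ-⊞ m β ⟦ A ⟧ ⟦ R₀ ⟧)
          arith : ∀ a r y s q → - 1ℤ ≤ r → 0ℤ ≤ y → 0ℤ ≤ s → 0ℤ ≤ (D + 1ℤ) * (0ℤ - q) → - 1ℤ ≤ a + r - + 2 * (D + 1ℤ) * q - a + y + s
          arith a r y s q p e f h = lin (p ⊕ e ⊕ f ⊕ h ⊕ h) (solve (D ∷ a ∷ r ∷ y ∷ s ∷ q ∷ []))
          whole : ∀ y s → 0ℤ ≤ y → 0ℤ ≤ s → - 1ℤ ≤ ρ m β ⟦ S ⟧ - ρ m β ⟦ A ⟧ + y + s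
          whole y s y≥0 s≥0 = subst (λ t → - 1ℤ ≤ t - ρ m β ⟦ A ⟧ + y + s) (sym ρS≡) (arith (ρ m β ⟦ A ⟧) (ρ m β ⟦ R₀ ⟧) y s (quad μ ⟦ R₀ ⟧ ⟦ A ⟧) ρR y≥0 s≥0 (*-nonneg 0≤D+1 (i≤j⇒0≤j-i q≤0)))

        edge : 1ℤ ≤ quad μ ⟦ R₀ ⟧ ⟦ A ⟧ → Colorable m β S
        edge q≥1 =
          let z₀ , z∈R , r≥1 = dot-positive {B = R₀} (subst (1ℤ ≤_) (quad-dot μ ⟦ R₀ ⟧ ⟦ A ⟧) q≥1)
              x , x∈A , e≥1 = dot-positive {B = A} (subst (1ℤ ≤_) (row-dot μ z₀ ⟦ A ⟧) r≥1)
          in at-edge x z₀ x∈A z∈R e≥1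
          where
          at-edge : ∀ x z₀ → x ∈ A → z₀ ∈ R₀ → 1ℤ ≤ μ z₀ x → Colorable m β S
          at-edge x z₀ x∈A z∈R e≥1 =
            let c , C = below m βA A (raise-load load f≥0) smaller (sparse-raise t gapA g≥ f≤) in go c C cond
            where
            f : Fin N → ℤ
            f u = t * δ x u
            f≥0 : ∀ u → 0ℤ ≤ f u
            f≥0 u = *-nonneg 0≤t (χ≥0 (x == u))
            βA = raise β f
            f≤ : ∀ B → B ⊆ A → dot ⟦ B ⟧ f ≤ t
            f≤ B _ = subst (_≤ t) (sym (trans (dot-*ʳ ⟦ B ⟧ (δ x) t) (cong (t *_) (dot-⟦⟧δ B x)))) (subst (t * ⟦ B ⟧ x ≤_) (*-identityʳ t) (*-monoˡ t 0≤t (χ≤1 (B x))))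
            z∈S = ∈-∖ˡ z∈R
            z∉A = ∈-∖ʳ z∈R
            whole₂ : - 1ℤ ≤ ρ m β ⟦ S ⟧ - ρ m β ⟦ A ⟧ + (+ 2 * D + 1ℤ)
            whole₂ = arith (ρ m β ⟦ S ⟧) (ρ m β ⟦ A ⟧) g ρS A≤g g≤
              where
              arith : ∀ s a g → - 1ℤ ≤ s → a ≤ g → g ≤ + 2 * D + 1ℤ → - 1ℤ ≤ s - a + (+ 2 * D + 1ℤ)
              arith s a g p q r = lin (p ⊕ q ⊕ r) (solve (D ∷ s ∷ a ∷ g ∷ []))
            whole₁ : ∀ y s → g ≤ y + s → - 1ℤ ≤ ρ m β ⟦ S ⟧ - ρ m β ⟦ A ⟧ + y + s
            whole₁ y s le = arith (ρ m β ⟦ S ⟧) (ρ m β ⟦ A ⟧) g y s ρS A≤g le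
              where
              arith : ∀ r a g y s → - 1ℤ ≤ r → a ≤ g → g ≤ y + s → - 1ℤ ≤ r - a + y + s
              arith r a g y s p q h = lin (p ⊕ q ⊕ h) (solve (r ∷ a ∷ g ∷ y ∷ s ∷ []))
            go : ∀ c → Colored m βA A c → g ≤ 0ℤ ⊎ 1ℤ ≤ t × (g ≤ + 2 * D ⊎ D + 1ℤ ≤ t) → Colorable m β S
            go c C cnd = go′ cnd
              where
              le : ∀ u → u ∈ A → u ∈ c → β u ≤ βA u
              le u _ _ = raise-≥ load f≥0 u
              qF = quad μ ⟦ R₀ ⟧ ⟦ A ∖ c ⟧
              qF≥0 : 0ℤ ≤ + 2 * (D + 1ℤ) * qF
              qF≥0 = *-nonneg (*-nonneg (0≤+ 2) 0≤D+1) (quad≥0 μ≥0 (⟦⟧≥0 R₀) (⟦⟧≥0 (A ∖ c)))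
              unslacked : g ≤ + 2 * (D + 1ℤ) * qF → Colorable m β S
              unslacked h = finish C le x∈A z∈S z∉A false (λ ())
                (whole₁ (+ 2 * (D + 1ℤ) * qF) (dot ⟦ R₀ ⟧ (Piece.saved m load A⊆S C le x∈A z∈S z∉A false (λ ())))
                  (padʳ h (dot-≥ (Piece.saved≥0 m load A⊆S C le x∈A z∈S z∉A false (λ ()))))) whole₂
              go′ : g ≤ 0ℤ ⊎ 1ℤ ≤ t × (g ≤ + 2 * D ⊎ D + 1ℤ ≤ t) → Colorable m β S
              go′ (inj₁ g≤0) = unslacked (≤-trans g≤0 qF≥0)
              go′ (inj₂ (1≤t , alt)) = case x ∈? c of λ
                { (inj₂ x∉c) → unslacked (≤-trans g≤ (big qF (qF≥1 x∉c)))
                ; (inj₁ x∈c) → slacked x∈c alt }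
                where
                big : ∀ q → 1ℤ ≤ q → + 2 * D + 1ℤ ≤ + 2 * (D + 1ℤ) * q
                big q p = lin (r ⊕ r ⊕ 0≤+ 1) (solve (D ∷ q ∷ []))
                  where r = *-nonneg 0≤D+1 (i≤j⇒0≤j-i p)
                qF≥1 : x ∉ c → 1ℤ ≤ qF
                qF≥1 x∉c = ≤-trans e≥1 (≤-trans (row-∈ μ≥0 z₀ (∈-∖⁺ x∈A x∉c)) (subst (row μ z₀ ⟦ A ∖ c ⟧ ≤_) (sym (quad-dot μ ⟦ R₀ ⟧ ⟦ A ∖ c ⟧)) (dot-∈ (λ u _ → row≥0 μ≥0 u (⟦⟧≥0 (A ∖ c))) z₀ z∈R)))
                -- The spare unit at `x` returns 2D and no more. In the alternative the raise is at
                -- least D + 1; a vertex of M cannot carry that, so `x` would have been in F.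
                slacked : x ∈ c → g ≤ + 2 * D ⊎ D + 1ℤ ≤ t → Colorable m β S
                slacked x∈c alt = case alt of λ
                  { (inj₁ g≤2D) → finish C le x∈A z∈S z∉A true sl
                      (whole₁ (+ 2 * (D + 1ℤ) * qF) (dot ⟦ R₀ ⟧ (Piece.saved m load A⊆S C le x∈A z∈S z∉A true sl))
                        (padˡ qF≥0 (≤-trans g≤2D (≤-trans (Piece.saved-z₀ m load A⊆S C le x∈A z∈S z∉A true sl refl) (dot-∈ (Piece.saved≥0 m load A⊆S C le x∈A z∈S z∉A true sl) z₀ z∈R))))) whole₂
                  ; (inj₂ D<t) → ⊥-elim (1≰0 (too-much (β x) t (βA x) (proj₁ (load x)) D<t βx+t βx≤D)) }
                  where
                  βx≤D : βA x ≤ D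
                  βx≤D = lin (degree C x x∈A x∈c ⊕ row≥0 μ≥0 x (⟦⟧≥0 (A ∩ c))) (drop (row μ x ⟦ A ∩ c ⟧) (βA x) D)
                    where
                    drop : ∀ r b d → d - b ≡ d + r - (r + b + 0ℤ)
                    drop = solve-∀
                  βx+t : β x + t ≤ βA x
                  βx+t = subst (λ s → β x + s ≤ βA x) (trans (cong (t *_) (δ-refl x)) (*-identityʳ t)) (raise-M β f x βx≤D)
                  too-much : ∀ b t b′ → 0ℤ ≤ b → D + 1ℤ ≤ t → b + t ≤ b′ → b′ ≤ D → 1ℤ ≤ 0ℤ
                  too-much b t b′ p q r s = lin (p ⊕ q ⊕ r ⊕ s) (solve (D ∷ b ∷ t ∷ b′ ∷ []))
                  sl : true ≡ true → x ∈ c × β x + 1ℤ ≤ βA x × 1ℤ ≤ μ z₀ x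
                  sl _ = x∈c , ≤-trans (+-monoʳ-≤ (β x) 1≤t) βx+t , e≥1

-- The constructive form of "unless the graph is already colorable, every vertex has the property":
-- `X` is the early exit.
choose : ∀ {N} {X : Set} {Q : Fin N → Set} → (∀ v → X ⊎ Q v) → X ⊎ (∀ v → Q v)
choose {ℕ.zero}  f = inj₂ λ ()
choose {ℕ.suc N} f with f zero | choose (f ∘ suc)
... | inj₁ x | _      = inj₁ x
... | inj₂ _ | inj₁ x = inj₁ x
... | inj₂ q | inj₂ r = inj₂ λ { zero → q ; (suc v) → r v }

-- Charges and vertices of small degree

module Reduction {N : ℕ} (D : ℤ) (1≤D : 1ℤ ≤ D) where
  open GapStep {N} D 1≤D public

  load≤D : ∀ {m β S c} → Colored m β S c → ∀ {v} → v ∈ S → v ∈ c → β v ≤ D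
  load≤D {m} {β} {S} {c} C {v} v∈S v∈c = arith (row μ v ⟦ S ∩ c ⟧) (β v) (row≥0 μ≥0 v (⟦⟧≥0 (S ∩ c))) (degree C v v∈S v∈c)
    where
    open Mult m
    arith : ∀ r b → 0ℤ ≤ r → r + b ≤ D → b ≤ D
    arith r b p q = lin (p ⊕ q) (solve (r ∷ b ∷ D ∷ []))

  empty-colorable : ∀ {m β S} → (∀ u → u ∉ S) → Colorable m β S
  empty-colorable {S = S} e = (λ _ → false) , record
    { forestM = λ B B⊆ u u∈ → ∈-contra (∈-∩ˡ (B⊆ u u∈)) (e u)
    ; forestF = λ B B⊆ u u∈ → ∈-contra (∈-∖ˡ (B⊆ u u∈)) (e u)
    ; degree  = λ v v∈ _ → ∈-contra v∈ (e v)
    }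

  module _ (m : Mult N) where
    open Mult m

    row-self : ∀ {S v} → v ∈ S → row μ v ⟦ S ⟧ ≡ row μ v ⟦ S − v ⟧
    row-self {S} {v} v∈S = trans (row-cong μ v (⟦⟧-remove v∈S)) (trans (row-+ μ v ⟦ S − v ⟧ (δ v))
      (trans (cong (_+_ (row μ v ⟦ S − v ⟧)) (trans (row-δ μ v v) (μ-irr v))) (+-identityʳ (row μ v ⟦ S − v ⟧))))

    -- If `v` does not fit into F, at least two of its edges lead there. For degree 1 this is
    -- impossible; for degree 2 no edge is left for M, where `v` becomes isolated and load D is
    -- still admissible.
    extend-low : ∀ {β S v c} → Colored m β (S − v) c → row μ v ⟦ S − v ⟧ ≤ 1ℤ ⊎ row μ v ⟦ S − v ⟧ ≤ + 2 × β v ≤ D → Colorable m β S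
    extend-low {β} {S} {v} {c} C deg = extend C (λ _ _ _ → ≤-refl) (case rF ≤⊎> 1ℤ of λ
      { (inj₁ p) → inj₁ p
      ; (inj₂ p) → inj₂ (case deg of λ
        { (inj₁ q) → ⊥-elim (1≰0 (over rM rF (row≥0 μ≥0 v (⟦⟧≥0 ((S − v) ∩ c))) p (subst (_≤ 1ℤ) split q)))
        ; (inj₂ (q , b)) → let rM≤0 = none rM rF p (subst (_≤ + 2) split q) in
            (λ u u∈ u∈c → subst (β u + μ v u ≤_) (+-identityʳ (β u)) (+-monoʳ-≤ (β u) (≤-trans (row-∈ μ≥0 v (∈-∩⁺ u∈ u∈c)) rM≤0))) ,
            ≤-trans rM≤0 (0≤+ 1) , subst (rM + β v ≤_) (+-identityˡ D) (rM≤0 ⊕ b) }) })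
      where
      rM = row μ v ⟦ (S − v) ∩ c ⟧
      rF = row μ v ⟦ (S − v) ∖ c ⟧
      split : row μ v ⟦ S − v ⟧ ≡ rM + rF
      split = row-∩∖ {m = m} v (S − v) c
      over : ∀ a b → 0ℤ ≤ a → 1ℤ + 1ℤ ≤ b → a + b ≤ 1ℤ → 1ℤ ≤ 0ℤ
      over a b p q r = lin (p ⊕ q ⊕ r) (solve (a ∷ b ∷ []))
      none : ∀ a b → 1ℤ + 1ℤ ≤ b → a + b ≤ + 2 → a ≤ 0ℤ
      none a b p q = lin (p ⊕ q) (solve (a ∷ b ∷ []))

    -- A vertex with three incident edges goes to F unless two of them lead to F;
    -- the third edge is then covered by the raised load of its other end.
    extend-three : ∀ {β f S v c} → Colored m (raise β f) (S − v) c → IsLoad β → (∀ u → 0ℤ ≤ f u) →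
      row μ v ⟦ S − v ⟧ ≤ + 3 → β v + 1ℤ ≤ D →
      (∀ u → u ∈ S − v → u ∈ c → row μ v ⟦ (S − v) ∩ c ⟧ ≤ 1ℤ → μ v u ≤ f u) → Colorable m β S
    extend-three {β} {f} {S} {v} {c} C load f≥0 deg βv slack = extend C (λ u _ _ → raise-≥ load f≥0 u) (case rF ≤⊎> 1ℤ of λ
      { (inj₁ p) → inj₁ p
      ; (inj₂ p) → let rM≤1 = one rM rF p (subst (_≤ + 3) (row-∩∖ {m = m} v (S − v) c) deg) in
          inj₂ ((λ u u∈ u∈c → ≤-trans (+-monoʳ-≤ (β u) (slack u u∈ u∈c rM≤1)) (raise-M β f u (load≤D C u∈ u∈c))) ,
            rM≤1 , fits rM (β v) rM≤1 βv) })
      where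
      rM = row μ v ⟦ (S − v) ∩ c ⟧
      rF = row μ v ⟦ (S − v) ∖ c ⟧
      one : ∀ a b → 1ℤ + 1ℤ ≤ b → a + b ≤ + 3 → a ≤ 1ℤ
      one a b p q = lin (p ⊕ q) (solve (a ∷ b ∷ []))
      fits : ∀ a b → a ≤ 1ℤ → b + 1ℤ ≤ D → a + b ≤ D
      fits a b p q = lin (p ⊕ q) (solve (a ∷ b ∷ D ∷ []))

  -- The cost 2 (D + 1) of an edge is shared equally by its two ends.
  charge : Mult N → (Fin N → ℤ) → VSet N → Fin N → ℤ
  charge m β S v = weight β v - (D + 1ℤ) * row (Mult.μ m) v ⟦ S ⟧

  ρ-charge : ∀ m β S → ρ m β ⟦ S ⟧ ≡ dot ⟦ S ⟧ (charge m β S)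
  ρ-charge m β S = trans (ρ-def m β ⟦ S ⟧) (sym (begin
    dot ⟦ S ⟧ (charge m β S)                                                  ≡⟨ dot-cong {a = ⟦ S ⟧} (λ _ → refl) (λ v → minus (weight β v) (D + 1ℤ) (row μ v ⟦ S ⟧)) ⟩
    dot ⟦ S ⟧ (weight β ⊞ (λ v → - (D + 1ℤ) * row μ v ⟦ S ⟧))                 ≡⟨ dot-+ʳ ⟦ S ⟧ (weight β) (λ v → - (D + 1ℤ) * row μ v ⟦ S ⟧) ⟩
    dot ⟦ S ⟧ (weight β) + dot ⟦ S ⟧ (λ v → - (D + 1ℤ) * row μ v ⟦ S ⟧)       ≡⟨ cong (_+_ (dot ⟦ S ⟧ (weight β))) (trans (dot-*ʳ ⟦ S ⟧ (λ v → row μ v ⟦ S ⟧) (- (D + 1ℤ))) (cong (_*_ (- (D + 1ℤ))) (sym (quad-dot μ ⟦ S ⟧ ⟦ S ⟧)))) ⟩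
    dot ⟦ S ⟧ (weight β) + - (D + 1ℤ) * quad μ ⟦ S ⟧ ⟦ S ⟧                    ≡⟨ minus (dot ⟦ S ⟧ (weight β)) (D + 1ℤ) (quad μ ⟦ S ⟧ ⟦ S ⟧) ⟨
    dot ⟦ S ⟧ (weight β) - (D + 1ℤ) * quad μ ⟦ S ⟧ ⟦ S ⟧                      ∎))
    where
    open Mult m
    open ≡-Reasoning
    minus : ∀ x k y → x - k * y ≡ x + - k * y
    minus = solve-∀

  module Critical (m : Mult N) {β : Fin N → ℤ} (load : IsLoad β) {S : VSet N} (sparse : Sparse m β S) (below : Below S) where
    open Mult m

    smaller : ∀ {v} → v ∈ S → size (S − v) + 1ℤ ≤ size S
    smaller v∈S = ≤-reflexive (sym (size-remove v∈S))

    color-rest : ∀ {v} → v ∈ S → Colorable m β (S − v)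
    color-rest v∈S = below m β (S − _) load (smaller v∈S) (sparse-⊆ (λ u → ∈-−ˡ) sparse)

    color-low : ∀ {v} → v ∈ S → row μ v ⟦ S ⟧ ≤ 1ℤ ⊎ row μ v ⟦ S ⟧ ≤ + 2 × β v ≤ D → Colorable m β S
    color-low {v} v∈S deg = let c , C = color-rest v∈S in
      extend-low m C (subst (λ t → t ≤ 1ℤ ⊎ t ≤ + 2 × β v ≤ D) (row-self m v∈S) deg)

    Light : Fin N → Set
    Light v = row μ v ⟦ S ⟧ ≡ + 3 × β v + 1ℤ ≤ D

    ch : Fin N → ℤ
    ch = charge m β S

    -- The borderline cases: degree 2 with load D + 1 has charge -1, degree 3 with load at least D
    -- has charge at most -D, and degree 4 has charge at most -1. Further edges only lower the
    -- charge, and `extend-low` takes the remaining small degrees.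
    classify : ∀ v → v ∈ S → Colorable m β S ⊎ Light v ⊎ ch v ≤ - 1ℤ
    classify v v∈S with row μ v ⟦ S ⟧ ≤⊎> 1ℤ
    ... | inj₁ p = inj₁ (color-low v∈S (inj₁ p))
    ... | inj₂ p with row μ v ⟦ S ⟧ ≤⊎> + 2
    ...   | inj₁ q with β v ≤⊎> D
    ...     | inj₁ r = inj₁ (color-low v∈S (inj₂ (q , r)))
    ...     | inj₂ r = inj₂ (inj₂ (arith (row μ v ⟦ S ⟧) (β v) r (*-nonneg 0≤D+1 (i≤j⇒0≤j-i p))))
      where
      arith : ∀ d b → D + 1ℤ ≤ b → 0ℤ ≤ (D + 1ℤ) * (d - (1ℤ + 1ℤ)) → + 4 * D + + 3 - + 2 * b - (D + 1ℤ) * d ≤ - 1ℤ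
      arith d b r s = lin (r ⊕ r ⊕ s) (solve (D ∷ d ∷ b ∷ []))
    classify v v∈S | inj₂ p | inj₂ q with row μ v ⟦ S ⟧ ≤⊎> + 3
    ...     | inj₁ s with (β v + 1ℤ) ≤⊎> D
    ...       | inj₁ r = inj₂ (inj₁ (≤-antisym s q , r))
    ...       | inj₂ r = inj₂ (inj₂ (arith (row μ v ⟦ S ⟧) (β v) r (*-nonneg 0≤D+1 (i≤j⇒0≤j-i q))))
      where
      arith : ∀ d b → D + 1ℤ ≤ b + 1ℤ → 0ℤ ≤ (D + 1ℤ) * (d - (+ 2 + 1ℤ)) → + 4 * D + + 3 - + 2 * b - (D + 1ℤ) * d ≤ - 1ℤ
      arith d b r s = lin (r ⊕ r ⊕ s ⊕ 1≤D) (solve (D ∷ d ∷ b ∷ []))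
    classify v v∈S | inj₂ p | inj₂ q | inj₂ s = inj₂ (inj₂ (arith (row μ v ⟦ S ⟧) (β v) (proj₁ (load v)) (*-nonneg 0≤D+1 (i≤j⇒0≤j-i s))))
      where
      arith : ∀ d b → 0ℤ ≤ b → 0ℤ ≤ (D + 1ℤ) * (d - (+ 3 + 1ℤ)) → + 4 * D + + 3 - + 2 * b - (D + 1ℤ) * d ≤ - 1ℤ
      arith d b r s = lin (r ⊕ r ⊕ s) (solve (D ∷ d ∷ b ∷ []))

    -1≤ρ : ∀ {v} → v ∈ S → - 1ℤ ≤ ρ m β ⟦ S ⟧
    -1≤ρ v∈S = case single-or-two m β load v∈S of λ
      { (inj₁ p) → sparse S (λ _ q → q) p
      ; (inj₂ p) → ≤-trans (≤-trans -≤+ (padʳ 0≤2D (0≤+ 1))) p }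

    -- The charges would add up to at most -|S|. For two or more vertices this is below -1, and a
    -- single vertex has potential at least 2D + 1.
    no-light : (∀ v → v ∈ S → ch v ≤ - 1ℤ) → Colorable m β S
    no-light neg = case nonempty? S of λ
      { (inj₂ e) → empty-colorable e
      ; (inj₁ (v , v∈)) → ⊥-elim (case single-or-two m β load v∈ of λ
        { (inj₁ two) → 1≰0 (arith₁ (ρ m β ⟦ S ⟧) (size S) ρ≤ (-1≤ρ v∈) two)
        ; (inj₂ one) → 1≰0 (arith₂ (ρ m β ⟦ S ⟧) (size S) ρ≤ one (size-nonempty v∈)) }) }
      where
      ρ≤ : ρ m β ⟦ S ⟧ ≤ - 1ℤ * size S
      ρ≤ = subst₂ _≤_ (sym (ρ-charge m β S)) (dot-size S (- 1ℤ)) (dot-mono-∈ neg)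
      arith₁ : ∀ r s → r ≤ - 1ℤ * s → - 1ℤ ≤ r → + 2 ≤ s → 1ℤ ≤ 0ℤ
      arith₁ r s p q t = lin (p ⊕ q ⊕ t) (solve (r ∷ s ∷ []))
      arith₂ : ∀ r s → r ≤ - 1ℤ * s → + 2 * D + 1ℤ ≤ r → 1ℤ ≤ s → 1ℤ ≤ 0ℤ
      arith₂ r s p q t = lin (p ⊕ q ⊕ t ⊕ 0≤2D ⊕ 0≤+ 1) (solve (D ∷ r ∷ s ∷ []))

    gapS−v : ∀ {g v} → v ∈ S → Gap m β S g → ∀ B → B ⊆ S − v → + 2 ≤ size B → g ≤ ρ m β ⟦ B ⟧
    gapS−v {v = v} v∈S gap B B⊆ = gap B (λ u p → ∈-−ˡ (B⊆ u p)) v v∈S (∉-⊆ B⊆ ∉-−)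

    light-reduces : Gap m β S (+ 5) → ∀ v → v ∈ S → Light v → Colorable m β S
    light-reduces gap v v∈S (deg , βv) =
      let c , C = below m (raise β (μ v)) (S − v) (raise-load load (μ≥0 v)) (smaller v∈S)
            (sparse-raise (+ 3) (gapS−v v∈S gap) ≤-refl λ B B⊆ → subst (_≤ + 3) (row-dot μ v ⟦ B ⟧)
              (≤-trans (row-mono μ≥0 v (⟦⟧-mono λ u p → ∈-−ˡ (B⊆ u p))) (≤-reflexive deg)))
      in extend-three m C load (μ≥0 v) (≤-reflexive (trans (sym (row-self m v∈S)) deg)) βv (λ _ _ _ _ → ≤-refl)

    step-large : + 2 ≤ D → Colorable m β S
    step-large 2≤D = case gap₅ of λ
      { (inj₁ col) → col
      ; (inj₂ gap) → case choose (λ v → case v ∈? S of λ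
          { (inj₂ v∉) → inj₂ λ v∈ → ∈-contra v∈ v∉
          ; (inj₁ v∈) → case classify v v∈ of λ
            { (inj₁ col) → inj₁ col
            ; (inj₂ (inj₁ light)) → inj₁ (light-reduces gap v v∈ light)
            ; (inj₂ (inj₂ neg)) → inj₂ λ _ → neg } }) of λ
        { (inj₁ col) → col
        ; (inj₂ neg) → no-light neg } }
      where
      bound : ∀ k → + k ≤ + 4 → + k ≤ + 2 * D
      bound k p = ≤-trans p (lin (2≤D ⊕ 2≤D) (solve (D ∷ [])))
      next : ∀ {g} t → 0ℤ ≤ t → g ≤ + 2 * D + 1ℤ → - 1ℤ ≤ g - + 2 * t → g ≤ 0ℤ ⊎ 1ℤ ≤ t × (g ≤ + 2 * D ⊎ D + 1ℤ ≤ t) →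
        Colorable m β S ⊎ Gap m β S g → Colorable m β S ⊎ Gap m β S (g + 1ℤ)
      next t a b c d (inj₁ col) = inj₁ col
      next t a b c d (inj₂ gap) = gap-step m load sparse below t a b c d gap
      next₁ : ∀ k → + k ≤ + 4 → - 1ℤ ≤ + k - + 2 → Colorable m β S ⊎ Gap m β S (+ k) → Colorable m β S ⊎ Gap m β S (+ k + 1ℤ)
      next₁ k p q = next 1ℤ (0≤+ 1) (padʳ (bound k p) (0≤+ 1)) q (inj₂ (≤-refl , inj₁ (bound k p)))
      -- No load is raised at `g = −1` and `g = 0`, one unit at 1, 2, 3 and 4. The last two of these
      -- need 2D ≥ 4.
      gap₅ : Colorable m β S ⊎ Gap m β S (+ 5)
      gap₅ = next₁ 4 (+≤+ (ℕ.s≤s (ℕ.s≤s (ℕ.s≤s (ℕ.s≤s ℕ.z≤n))))) -≤+ (next₁ 3 (+≤+ (ℕ.s≤s (ℕ.s≤s (ℕ.s≤s ℕ.z≤n)))) -≤+ (next₁ 2 (+≤+ (ℕ.s≤s (ℕ.s≤s ℕ.z≤n))) -≤+ (next₁ 1 (+≤+ (ℕ.s≤s ℕ.z≤n)) ≤-refl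
        (next 0ℤ ≤-refl (padʳ 0≤2D (0≤+ 1)) -≤+ (inj₁ ≤-refl) (next 0ℤ ≤-refl (≤-trans -≤+ (padʳ 0≤2D (0≤+ 1))) ≤-refl (inj₁ -≤+) (inj₂ λ B B⊆ _ _ _ → sparse B B⊆))))))

-- Adding an edge and subdividing it

δ-sym : (u v : Fin N) → δ u v ≡ δ v u
δ-sym u v with u ≟ v
... | yes refl = refl
... | no p = trans (δ-≢ p) (sym (δ-≢ (p ∘ sym)))

-- The adjacency matrix of a single edge from `x` to `z`.
link : Fin N → Fin N → Mat N
link x z v u = δ x v * δ z u + δ z v * δ x u

link-irr : {x z : Fin N} → x ≢ z → ∀ v → link x z v v ≡ 0ℤ
link-irr {x = x} {z} x≢z v = case x ≟ v of λ
  { (yes refl) → trans (cong (λ t → δ x x * t + t * δ x x) (δ-≢ (x≢z ∘ sym))) (vanish (δ x x))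
  ; (no p) → trans (cong (λ t → t * δ z v + δ z v * t) (δ-≢ p)) (vanish′ (δ z v)) }
  where
  vanish : ∀ a → a * 0ℤ + 0ℤ * a ≡ 0ℤ
  vanish = solve-∀
  vanish′ : ∀ a → 0ℤ * a + a * 0ℤ ≡ 0ℤ
  vanish′ = solve-∀

link-sym : (x z u v : Fin N) → link x z u v ≡ link x z v u
link-sym x z u v = swap (δ x u) (δ z v) (δ z u) (δ x v)
  where
  swap : ∀ a b c d → a * b + c * d ≡ d * c + b * a
  swap = solve-∀

link≥0 : (x z u v : Fin N) → 0ℤ ≤ link x z u v
link≥0 x z u v = *-nonneg (χ≥0 (x == u)) (χ≥0 (z == v)) ⊕ *-nonneg (χ≥0 (z == u)) (χ≥0 (x == v))

dot-link : (a : Fin N → ℤ) (x z v : Fin N) → dot a (link x z v) ≡ δ x v * a z + δ z v * a x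
dot-link a x z v = trans (dot-+ʳ a (λ u → δ x v * δ z u) (λ u → δ z v * δ x u)) (cong₂ _+_ (part x z) (part z x))
  where
  part : ∀ s t → dot a (λ u → δ s v * δ t u) ≡ δ s v * a t
  part s t = trans (dot-*ʳ a (δ t) (δ s v)) (cong (_*_ (δ s v)) (trans (dot-comm a (δ t)) (dot-δ t a)))

dot-ends : (a b : Fin N → ℤ) (x z : Fin N) → dot a (λ v → δ x v * b z + δ z v * b x) ≡ a x * b z + a z * b x
dot-ends a b x z = trans (dot-cong {a = a} (λ _ → refl) (λ v → cong₂ _+_ (*-comm (δ x v) (b z)) (*-comm (δ z v) (b x))))
  (trans (dot-+ʳ a (λ v → b z * δ x v) (λ v → b x * δ z v)) (cong₂ _+_ (part (b z) x) (part (b x) z)))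
  where
  part : ∀ k t → dot a (λ v → k * δ t v) ≡ a t * k
  part k t = trans (dot-*ʳ a (δ t) k) (trans (cong (_*_ k) (trans (dot-comm a (δ t)) (dot-δ t a))) (*-comm k (a t)))

addEdge : (m : Mult N) {x z : Fin N} → x ≢ z → Mult N
addEdge m {x} {z} x≢z = record
  { μ     = λ v u → μ v u + link x z v u
  ; μ-sym = λ u v → cong₂ _+_ (μ-sym u v) (link-sym x z u v)
  ; μ≥0   = λ u v → μ≥0 u v ⊕ link≥0 x z u v
  ; μ-irr = λ v → cong₂ _+_ (μ-irr v) (link-irr x≢z v)
  }
  where open Mult m

module _ (m : Mult N) {x z : Fin N} (x≢z : x ≢ z) where
  open Mult m
  private
    m₁ = addEdge m x≢z
    μ₁ = Mult.μ m₁

  row-addEdge : ∀ v a → row μ₁ v a ≡ row μ v a + (δ x v * a z + δ z v * a x)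
  row-addEdge v a = trans (row-dot μ₁ v a) (trans (dot-+ʳ a (μ v) (link x z v)) (cong₂ _+_ (sym (row-dot μ v a)) (dot-link a x z v)))

  quad-addEdge : ∀ a → quad μ₁ a a ≡ quad μ a a + + 2 * (a x * a z)
  quad-addEdge a = begin
    quad μ₁ a a                                                       ≡⟨ quad-dot μ₁ a a ⟩
    dot a (λ v → row μ₁ v a)                                          ≡⟨ dot-cong {a = a} (λ _ → refl) (λ v → row-addEdge v a) ⟩
    dot a ((λ v → row μ v a) ⊞ (λ v → δ x v * a z + δ z v * a x))     ≡⟨ dot-+ʳ a (λ v → row μ v a) (λ v → δ x v * a z + δ z v * a x) ⟩
    dot a (λ v → row μ v a) + dot a (λ v → δ x v * a z + δ z v * a x) ≡⟨ cong₂ _+_ (sym (quad-dot μ a a)) (dot-ends a a x z) ⟩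
    quad μ a a + (a x * a z + a z * a x)                              ≡⟨ regroup (quad μ a a) (a x) (a z) ⟩
    quad μ a a + + 2 * (a x * a z)                                    ∎
    where
    open ≡-Reasoning
    regroup : ∀ q s t → q + (s * t + t * s) ≡ q + + 2 * (s * t)
    regroup = solve-∀

  quad-≤-addEdge : ∀ B → quad μ ⟦ B ⟧ ⟦ B ⟧ ≤ quad μ₁ ⟦ B ⟧ ⟦ B ⟧
  quad-≤-addEdge B = subst (quad μ ⟦ B ⟧ ⟦ B ⟧ ≤_) (sym (quad-addEdge ⟦ B ⟧)) (padʳ ≤-refl (*-nonneg (0≤+ 2) (*-nonneg (⟦⟧≥0 B x) (⟦⟧≥0 B z))))

  module _ (D : ℤ) where
    open Coloring {N} D

    -- `v` goes to F. If both `x` and `z` are in F, it subdivides the added edge between them;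
    -- otherwise it has at most one edge to F. For M the coloring of `m₁` was at least as
    -- restrictive.
    subdivide : ∀ {β S c v} → Colored m₁ β (S − v) c → (∀ B → B ⊆ S − v → row μ v ⟦ B ⟧ ≤ ⟦ B ⟧ x + ⟦ B ⟧ z) →
      Colored m β S (c [ v ↦ false ])
    subdivide {β} {S} {c} {v} C le = record
      { forestM = λ B B⊆ u u∈ → ≤-trans (+-monoˡ-≤ (+ 2) (quad-≤-addEdge B)) (forestM C B (λ w p → M⊆ w (B⊆ w p)) u u∈)
      ; forestF = acyclic-insert m v (forestF C) F⊆ (λ B _ → quad-≤-addEdge B)
          λ B B⊆ → subst (λ t → quad μ ⟦ B ⟧ ⟦ B ⟧ + + 2 * row μ v ⟦ B ⟧ ≤ t + + 2) (sym (quad-addEdge ⟦ B ⟧))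
            (arith (quad μ ⟦ B ⟧ ⟦ B ⟧) (row μ v ⟦ B ⟧) (⟦ B ⟧ x) (⟦ B ⟧ z) (le B (λ w p → ∈-∖ˡ (B⊆ w p)))
              (*-nonneg (i≤j⇒0≤j-i (χ≤1 (B x))) (i≤j⇒0≤j-i (χ≤1 (B z)))))
      ; degree  = λ u u∈S u∈c′ → let v≢u = v≢ u u∈c′ in
          ≤-trans (+-monoˡ-≤ (β u) (≤-trans (row-mono μ≥0 u (⟦⟧-mono M⊆)) (row≤ u)))
                  (degree C u (∈-−⁺ u∈S v≢u) (upd-∈ v≢u u∈c′))
      }
      where
      c′ = c [ v ↦ false ]
      v≢ : ∀ u → u ∈ c′ → v ≢ u
      v≢ u p refl = ∈-contra p upd-false
      M⊆ : S ∩ c′ ⊆ (S − v) ∩ c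
      M⊆ u p = let v≢u = v≢ u (∈-∩ʳ p) in ∈-∩⁺ (∈-−⁺ (∈-∩ˡ p) v≢u) (upd-∈ v≢u (∈-∩ʳ p))
      F⊆ : ∀ u → u ∈ S ∖ c′ → v ≢ u → u ∈ (S − v) ∖ c
      F⊆ u p v≢u = ∈-∖⁺ (∈-−⁺ (∈-∖ˡ p) v≢u) (upd-∉ v≢u (∈-∖ʳ p))
      -- For indicator values, (1 - a)(1 - b) ≥ 0 reads a + b ≤ ab + 1, which treats all cases of
      -- `x` and `z` at once.
      arith : ∀ q r a b → r ≤ a + b → 0ℤ ≤ (1ℤ - a) * (1ℤ - b) → q + + 2 * r ≤ q + + 2 * (a * b) + + 2
      arith q r a b p s = lin (p ⊕ p ⊕ s ⊕ s) (solve (q ∷ r ∷ a ∷ b ∷ []))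
      row≤ : ∀ u → row μ u ⟦ (S − v) ∩ c ⟧ ≤ row μ₁ u ⟦ (S − v) ∩ c ⟧
      row≤ u = let P = (S − v) ∩ c in subst (row μ u ⟦ P ⟧ ≤_) (sym (row-addEdge u ⟦ P ⟧))
        (padʳ ≤-refl (*-nonneg (χ≥0 (x == u)) (⟦⟧≥0 P z) ⊕ *-nonneg (χ≥0 (z == u)) (⟦⟧≥0 P x)))

peel : {f : Fin N → ℤ} (P : VSet N) → (∀ u → 0ℤ ≤ f u) → 1ℤ ≤ dot ⟦ P ⟧ f →
  ∃[ v ] v ∈ P × 1ℤ ≤ f v × ∃[ f′ ] (∀ u → 0ℤ ≤ f′ u) × (∀ u → f u ≡ δ v u + f′ u) × (∀ a → dot a f ≡ a v + dot a f′)
peel {f = f} P f≥0 p with dot-positive {B = P} p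
... | v , v∈P , 1≤f = v , v∈P , 1≤f , f′ , f′≥0 , f≡ , λ a →
  trans (dot-cong {a = a} (λ _ → refl) f≡) (trans (dot-+ʳ a (δ v) f′) (cong (_+ dot a f′) (trans (dot-comm a (δ v)) (dot-δ v a))))
  where
  f′ = λ u → f u - δ v u
  f≡ : ∀ u → f u ≡ δ v u + (f u - δ v u)
  f≡ u = cancel (f u) (δ v u)
    where
    cancel : ∀ a b → a ≡ b + (a - b)
    cancel = solve-∀
  f′≥0 : ∀ u → 0ℤ ≤ f′ u
  f′≥0 u = case v ≟ u of λ
    { (yes refl) → i≤j⇒0≤j-i (subst (_≤ f v) (sym (δ-refl v)) 1≤f)
    ; (no ne) → subst (0ℤ ≤_) (sym (trans (cong (_-_ (f u)) (δ-≢ ne)) (+-identityʳ (f u)))) (f≥0 u) }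

∅ : VSet N
∅ _ = false

⟦⁅⁆⟧ : (v u : Fin N) → ⟦ ∅ ⁺ v ⟧ u ≡ δ v u
⟦⁅⁆⟧ v u = trans (⟦⟧-insert {A = ∅} (nmem refl) u) (+-identityˡ (δ v u))

∈-⁅⁆ : {v u : Fin N} → u ∈ ∅ ⁺ v → v ≡ u
∈-⁅⁆ p = case ∈-⁺⁻ p of λ { (inj₁ e) → e ; (inj₂ (mem ())) }

-- Submodularity of the potential

module Submodular {N : ℕ} (D : ℤ) (1≤D : 1ℤ ≤ D) where
  open Reduction {N} D 1≤D

  -- The two sides differ by the cost of the edges joining the part of `A` outside `B` to the part
  -- of `B` outside `A`; only the union counts these.
  ρ-submodular : ∀ m β A B → ρ m β ⟦ A ∪ B ⟧ + ρ m β ⟦ A ∩ B ⟧ ≤ ρ m β ⟦ A ⟧ + ρ m β ⟦ B ⟧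
  ρ-submodular m β A B = subst₂ _≤_ (sym (cong (_+ ρ m β i) ρ∪)) (sym (cong (_+_ (ρ m β ⟦ A ⟧)) ρB))
    (arith (ρ m β ⟦ A ⟧) (ρ m β i) (ρ m β b) (quad μ b i) (quad μ b a) (*-nonneg 0≤D+1 (quad≥0 μ≥0 (⟦⟧≥0 (B ∖ A)) (⟦⟧≥0 (A ∖ B)))))
    where
    open Mult m
    i = ⟦ A ∩ B ⟧
    a = ⟦ A ∖ B ⟧
    b = ⟦ B ∖ A ⟧
    iB : ∀ u → ⟦ B ⟧ u ≡ (i ⊞ b) u
    iB u = trans (⟦⟧-∩∖ B A u) (cong (_+ b u) (⟦⟧-≐ (λ _ p → ∈-∩⁺ (∈-∩ʳ p) (∈-∩ˡ p)) (λ _ p → ∈-∩⁺ (∈-∩ʳ p) (∈-∩ˡ p)) u))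
    union : ∀ u → ⟦ A ∪ B ⟧ u ≡ (⟦ A ⟧ ⊞ b) u
    union u = trans (⟦⟧-≐ (λ _ → to) (λ _ → from) u) (⟦⟧-∪ {A = A} {B ∖ A} disj u)
      where
      disj : ∀ u → u ∈ A → u ∉ B ∖ A
      disj u p = case u ∈? (B ∖ A) of λ { (inj₁ q) → ∈-contra p (∈-∖ʳ q) ; (inj₂ q) → q }
      to : ∀ {u} → u ∈ A ∪ B → u ∈ A ∪ (B ∖ A)
      to {u} p = case u ∈? A of λ { (inj₁ q) → ∈-∪ˡ q ; (inj₂ q) → case ∈-∪⁻ p of λ { (inj₁ r) → ∈-∪ˡ r ; (inj₂ r) → ∈-∪ʳ (∈-∖⁺ r q) } }
      from : ∀ {u} → u ∈ A ∪ (B ∖ A) → u ∈ A ∪ B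
      from p = case ∈-∪⁻ p of λ { (inj₁ q) → ∈-∪ˡ q ; (inj₂ q) → ∈-∪ʳ (∈-∖ˡ q) }
    ρB : ρ m β ⟦ B ⟧ ≡ ρ m β i + ρ m β b - + 2 * (D + 1ℤ) * quad μ b i
    ρB = trans (ρ-cong m β iB) (ρ-⊞ m β i b)
    ρ∪ : ρ m β ⟦ A ∪ B ⟧ ≡ ρ m β ⟦ A ⟧ + ρ m β b - + 2 * (D + 1ℤ) * (quad μ b i + quad μ b a)
    ρ∪ = trans (ρ-cong m β union) (trans (ρ-⊞ m β ⟦ A ⟧ b) (cong (λ t → ρ m β ⟦ A ⟧ + ρ m β b - + 2 * (D + 1ℤ) * t)
      (trans (quad-cong μ {a = b} (λ _ → refl) (⟦⟧-∩∖ A B)) (quad-+ʳ μ b i a))))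
    arith : ∀ x y z s t → 0ℤ ≤ (D + 1ℤ) * t → x + z - + 2 * (D + 1ℤ) * (s + t) + y ≤ x + (y + z - + 2 * (D + 1ℤ) * s)
    arith x y z s t p = lin (p ⊕ p) (solve (D ∷ x ∷ y ∷ z ∷ s ∷ t ∷ []))

-- The case D = 1

sumAt : ∀ {N k} → (Fin N → ℤ) → Vec (Fin N) k → ℤ
sumAt a Vec.[]       = 0ℤ
sumAt a (u Vec.∷ us) = a u + sumAt a us

sumAt-∈ : ∀ {N k} {P : VSet N} {us : Vec (Fin N) k} → All (_∈ P) us → sumAt ⟦ P ⟧ us ≡ + k
sumAt-∈ All.[]       = refl
sumAt-∈ (p All.∷ ps) = cong₂ _+_ (⟦⟧-∈ p) (sumAt-∈ ps)

-- A non-negative `f` is read as a multiset of vertices, from which `k` members of `P` are drawn,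
-- repetitions standing for parallel edges. The final identity, valid for every `a`, describes the
-- multiset by the sums taken over it.
peels : ∀ {N} k {f : Fin N → ℤ} (P : VSet N) → (∀ u → 0ℤ ≤ f u) → + k ≤ dot ⟦ P ⟧ f →
  ∃[ us ] All (_∈ P) us × ∃[ f′ ] (∀ u → 0ℤ ≤ f′ u) × (∀ a → dot a f ≡ sumAt {k = k} a us + dot a f′)
peels ℕ.zero {f} P f≥0 _ = Vec.[] , All.[] , f , f≥0 , λ a → sym (+-identityˡ (dot a f))
peels (ℕ.suc k) {f} P f≥0 le =
  let v , v∈ , _ , f₁ , f₁≥0 , _ , e₁ = peel P f≥0 (≤-trans (+≤+ (ℕ.s≤s ℕ.z≤n)) le)
      us , us∈ , f₂ , f₂≥0 , e₂ = peels k P f₁≥0 (rest (dot ⟦ P ⟧ f₁) (subst (+ ℕ.suc k ≤_) (trans (e₁ ⟦ P ⟧) (cong (_+ dot ⟦ P ⟧ f₁) (⟦⟧-∈ v∈))) le))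
  in v Vec.∷ us , v∈ All.∷ us∈ , f₂ , f₂≥0 , λ a → trans (e₁ a) (trans (cong (_+_ (a v)) (e₂ a)) (sym (+-assoc (a v) (sumAt a us) (dot a f₂))))
  where
  rest : ∀ d → 1ℤ + + k ≤ 1ℤ + d → + k ≤ d
  rest d p = lin p (cancel (+ k) d)
    where
    cancel : ∀ a b → b - a ≡ 1ℤ + b - (1ℤ + a)
    cancel = solve-∀

from-does : {P : Set} (d : Dec P) → does d ≡ true → P
from-does (yes p) _ = p

module DegreeOne {N : ℕ} where
  open Reduction {N} 1ℤ ≤-refl public
  open Submodular {N} 1ℤ ≤-refl public

  module LightVertices (m : Mult N) {β : Fin N → ℤ} (load : IsLoad β) {S : VSet N} (sparse : Sparse m β S) (below : Below S)
    (gap : Gap m β S (+ 4)) where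
    open Mult m
    open Critical m load sparse below public

    -- The vertices of positive charge.
    T₀ : VSet N
    T₀ v = S v ∧ (does (row μ v ⟦ S ⟧ ℤ.≟ + 3) ∧ does (β v ℤ.≟ 0ℤ))

    T₀⁻ : ∀ {v} → v ∈ T₀ → v ∈ S × row μ v ⟦ S ⟧ ≡ + 3 × β v ≡ 0ℤ
    T₀⁻ {v} (mem p) = let q , r = ∧-true {S v} p ; s , t = ∧-true {does (row μ v ⟦ S ⟧ ℤ.≟ + 3)} r in
      mem q , from-does (row μ v ⟦ S ⟧ ℤ.≟ + 3) s , from-does (β v ℤ.≟ 0ℤ) t

    T₀⁺ : ∀ {v} → v ∈ S → row μ v ⟦ S ⟧ ≡ + 3 → β v ≡ 0ℤ → v ∈ T₀
    T₀⁺ {v} (mem p) q r = mem (cong₂ _∧_ p (cong₂ _∧_ (dec-true (row μ v ⟦ S ⟧ ℤ.≟ + 3) q) (dec-true (β v ℤ.≟ 0ℤ) r)))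

    nbrs : Fin N → Fin N → ℤ
    nbrs v u = ⟦ S ⟧ u * μ v u

    nbrs≥0 : ∀ v u → 0ℤ ≤ nbrs v u
    nbrs≥0 v u = *-nonneg (⟦⟧≥0 S u) (μ≥0 v u)

    dot-nbrs : ∀ v B → B ⊆ S → dot ⟦ B ⟧ (nbrs v) ≡ row μ v ⟦ B ⟧
    dot-nbrs v B B⊆ = trans (dot-cong-∈ {B = B} λ u u∈ → trans (cong (_* μ v u) (⟦⟧-∈ (B⊆ u u∈))) (*-identityˡ (μ v u))) (sym (row-dot μ v ⟦ B ⟧))

    vanishing : ∀ {f} → (∀ u → 0ℤ ≤ f u) → dot ⟦ S ⟧ f ≤ 0ℤ → ∀ B → B ⊆ S → dot ⟦ B ⟧ f ≡ 0ℤ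
    vanishing {f} f≥0 p B B⊆ = ≤-antisym (≤-trans (subst₂ _≤_ (dot-comm f ⟦ B ⟧) (dot-comm f ⟦ S ⟧) (dot-monoʳ f≥0 (⟦⟧-mono B⊆))) p) (dot-≥ λ u _ → f≥0 u)

    -- `x`, `y`, `z` are the neighbours of `v` in `S` listed with multiplicity, in the form in which
    -- rows enter the potential.
    Row₃ : Fin N → Fin N → Fin N → Fin N → Set
    Row₃ v x y z = ∀ B → B ⊆ S → row μ v ⟦ B ⟧ ≡ ⟦ B ⟧ x + ⟦ B ⟧ y + ⟦ B ⟧ z

    neighbours : ∀ k {f} → (∀ u → 0ℤ ≤ f u) → dot ⟦ S ⟧ f ≡ + k →
      ∃[ us ] All (_∈ S) us × (∀ B → B ⊆ S → dot ⟦ B ⟧ f ≡ sumAt {k = k} ⟦ B ⟧ us)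
    neighbours k {f} f≥0 eq =
      let us , us∈ , f′ , f′≥0 , split = peels k S f≥0 (≤-reflexive (sym eq))
          rest = cancel (+ k) (dot ⟦ S ⟧ f′) (trans (sym eq) (trans (split ⟦ S ⟧) (cong (_+ dot ⟦ S ⟧ f′) (sumAt-∈ us∈))))
      in us , us∈ , λ B B⊆ → trans (split ⟦ B ⟧) (trans (cong (_+_ (sumAt ⟦ B ⟧ us)) (vanishing f′≥0 (≤-reflexive rest) B B⊆)) (+-identityʳ (sumAt ⟦ B ⟧ us)))
      where
      cancel : ∀ a b → a ≡ a + b → b ≡ 0ℤ
      cancel a b p = trans (shift a b) (trans (cong (_- a) (sym p)) (+-inverseʳ a))
        where
        shift : ∀ a b → b ≡ a + b - a
        shift = solve-∀

    three : ∀ v → row μ v ⟦ S ⟧ ≡ + 3 → ∃[ x ] ∃[ y ] ∃[ z ] x ∈ S × y ∈ S × z ∈ S × Row₃ v x y z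
    three v deg = unpack (neighbours 3 (nbrs≥0 v) (trans (dot-nbrs v S λ _ p → p) deg))
      where
      assoc : ∀ a b c → a + (b + (c + 0ℤ)) ≡ a + b + c
      assoc = solve-∀
      unpack : (∃[ us ] All (_∈ S) us × (∀ B → B ⊆ S → dot ⟦ B ⟧ (nbrs v) ≡ sumAt {k = 3} ⟦ B ⟧ us)) →
        ∃[ x ] ∃[ y ] ∃[ z ] x ∈ S × y ∈ S × z ∈ S × Row₃ v x y z
      unpack (x Vec.∷ y Vec.∷ z Vec.∷ Vec.[] , x∈ All.∷ y∈ All.∷ z∈ All.∷ All.[] , eq) = x , y , z , x∈ , y∈ , z∈ , λ B B⊆ →
        trans (sym (dot-nbrs v B B⊆)) (trans (eq B B⊆) (assoc (⟦ B ⟧ x) (⟦ B ⟧ y) (⟦ B ⟧ z)))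

    μ-row : ∀ {v x y z u} → Row₃ v x y z → u ∈ S → μ v u ≡ δ u x + δ u y + δ u z
    μ-row {v} {x} {y} {z} {u} row₃ u∈ = trans (sym (row-δ μ v u)) (trans (row-cong μ v (λ w → sym (⟦⁅⁆⟧ u w)))
      (trans (row₃ (∅ ⁺ u) (λ w p → subst (_∈ S) (∈-⁅⁆ p) u∈)) (cong₂ _+_ (cong₂ _+_ (⟦⁅⁆⟧ u x) (⟦⁅⁆⟧ u y)) (⟦⁅⁆⟧ u z))))

    rotate : ∀ {v x y z} → Row₃ v x y z → Row₃ v y z x
    rotate {x = x} {y} {z} row₃ B B⊆ = trans (row₃ B B⊆) (cycle (⟦ B ⟧ x) (⟦ B ⟧ y) (⟦ B ⟧ z))
      where
      cycle : ∀ a b c → a + b + c ≡ b + c + a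
      cycle = solve-∀

    -- What is left for a light vertex after `double`, `saturated` and `adjacent-light` have been
    -- applied at each of its neighbours.
    record Tri (v x y z : Fin N) : Set where
      field
        row₃ : Row₃ v x y z
        x∈ : x ∈ S
        y∈ : y ∈ S
        z∈ : z ∈ S
        x≢y : x ≢ y
        y≢z : y ≢ z
        z≢x : z ≢ x
        x≤1 : β x ≤ 1ℤ
        y≤1 : β y ≤ 1ℤ
        z≤1 : β z ≤ 1ℤ
        x∉ : x ∉ T₀
        y∉ : y ∉ T₀
        z∉ : z ∉ T₀

    rotate-tri : ∀ {v x y z} → Tri v x y z → Tri v y z x
    rotate-tri t = record
      { row₃ = rotate row₃ ; x∈ = y∈ ; y∈ = z∈ ; z∈ = x∈ ; x≢y = y≢z ; y≢z = z≢x ; z≢x = x≢y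
      ; x≤1 = y≤1 ; y≤1 = z≤1 ; z≤1 = x≤1 ; x∉ = y∉ ; y∉ = z∉ ; z∉ = x∉ }
      where open Tri t

    module _ {v} (v∈T : v ∈ T₀) where
      private
        v∈S = proj₁ (T₀⁻ v∈T)
        deg = proj₁ (proj₂ (T₀⁻ v∈T))
        βv  = proj₂ (proj₂ (T₀⁻ v∈T))

      -- Potential 4 pays for two units of load, 4 - 4 ≥ -1, but not for three. The reductions below
      -- therefore find an `f` that leaves out a neighbour.
      color-slack : ∀ f → (∀ u → 0ℤ ≤ f u) → (∀ B → B ⊆ S − v → dot ⟦ B ⟧ f ≤ + 2) →
        (∀ {c} → Colored m (raise β f) (S − v) c → ∀ u → u ∈ S − v → u ∈ c → row μ v ⟦ (S − v) ∩ c ⟧ ≤ 1ℤ → μ v u ≤ f u) →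
        Colorable m β S
      color-slack f f≥0 f≤2 slack =
        let c , C = below m (raise β f) (S − v) (raise-load load f≥0) (smaller v∈S) (sparse-raise (+ 2) (gapS−v v∈S gap) -≤+ f≤2)
        in extend-three m C load f≥0 (≤-reflexive (trans (sym (row-self m v∈S)) deg)) (≤-reflexive (cong (_+ 1ℤ) βv)) (slack C)

      module _ {x y z} (row₃ : Row₃ v x y z) (x∈ : x ∈ S) (y∈ : y ∈ S) (z∈ : z ∈ S) where

        -- When `v` goes to M, at most one of its edges leads to M, so the doubled neighbour is in F
        -- and only `z` needs room.
        double : x ≡ y → Colorable m β S
        double refl = color-slack (δ z) (λ u → χ≥0 (z == u)) (λ B _ → subst (_≤ + 2) (sym (dot-⟦⟧δ B z)) (≤-trans (χ≤1 (B z)) (+≤+ (ℕ.s≤s ℕ.z≤n))))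
          λ {c} C u u∈ u∈c rM → case u ≟ x of λ
            { (yes refl) → ⊥-elim (1≰0 (over (row μ v ⟦ (S − v) ∩ c ⟧) (μ v u) (δ u z) (trans (μ-row row₃ x∈) (cong (λ t → t + t + δ u z) (δ-refl u))) (χ≥0 (u == z)) (row-∈ μ≥0 v (∈-∩⁺ u∈ u∈c)) rM))
            ; (no ne) → ≤-reflexive (trans (μ-row row₃ (∈-−ˡ u∈)) (trans (cong (λ t → t + t + δ u z) (δ-≢ ne)) (trans (+-identityˡ (δ u z)) (δ-sym u z)))) }
          where
          over : ∀ r a d → a ≡ 1ℤ + 1ℤ + d → 0ℤ ≤ d → a ≤ r → r ≤ 1ℤ → 1ℤ ≤ 0ℤ
          over r a d refl p q s = lin (p ⊕ q ⊕ s) (solve (r ∷ d ∷ []))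

        -- The load D + 1 = 2 already keeps `x` in F, so room at `y` and `z` is enough.
        saturated : + 2 ≤ β x → Colorable m β S
        saturated 2≤β = color-slack (δ y ⊞ δ z) f≥0
          (λ B _ → subst (_≤ + 2) (sym (trans (dot-+ʳ ⟦ B ⟧ (δ y) (δ z)) (cong₂ _+_ (dot-⟦⟧δ B y) (dot-⟦⟧δ B z)))) (χ≤1 (B y) ⊕ χ≤1 (B z)))
          λ {c} C u u∈ u∈c _ → case u ≟ x of λ
            { (yes refl) → ⊥-elim (1≰0 (lin (≤-trans 2≤β (≤-trans (raise-≥ load f≥0 u) (load≤D C u∈ u∈c))) refl))
            ; (no ne) → ≤-reflexive (trans (μ-row row₃ (∈-−ˡ u∈)) (trans (cong (λ t → t + δ u y + δ u z) (δ-≢ ne)) (cong₂ _+_ (trans (+-identityˡ (δ u y)) (δ-sym u y)) (δ-sym u z)))) }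
          where
          f≥0 : ∀ u → 0ℤ ≤ (δ y ⊞ δ z) u
          f≥0 u = χ≥0 (y == u) ⊕ χ≥0 (z == u)

        -- Deleting `x` together with `v` makes the raise at `x` free of charge. `x` is put back
        -- first: without `v` it has degree at most 2, and its raised load 1 is still at most D.
        adjacent-light : x ≢ y → z ≢ x → x ∈ T₀ → Colorable m β S
        adjacent-light x≢y z≢x x∈T =
          let c , C = below m (raise β f) (S − v − x) (raise-load load f≥0) size≤ (sparse-raise (+ 2) gap₂ -≤+ f≤2)
              c₁ , C₁ = extend-low m {S = S − v} {v = x} C (inj₂ (deg-x , load-x))
          in extend-three m C₁ load f≥0 (≤-reflexive (trans (sym (row-self m v∈S)) deg)) (≤-reflexive (cong (_+ 1ℤ) βv))
               λ u u∈ _ _ → ≤-reflexive (trans (μ-row row₃ (∈-−ˡ u∈)) (cong₂ _+_ (cong₂ _+_ (δ-sym u x) (δ-sym u y)) (δ-sym u z)))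
          where
          f = δ x ⊞ δ y ⊞ δ z
          f≥0 : ∀ u → 0ℤ ≤ f u
          f≥0 u = (χ≥0 (x == u) ⊕ χ≥0 (y == u)) ⊕ χ≥0 (z == u)
          v≢x : v ≢ x
          v≢x refl = 1≰0 (subst₂ _≤_ refl (μ-irr v) (subst (1ℤ ≤_) (sym (μ-row row₃ x∈)) (padʳ (padʳ (≤-reflexive (sym (δ-refl x))) (χ≥0 (x == y))) (χ≥0 (x == z)))))
          x∈S−v : x ∈ S − v
          x∈S−v = ∈-−⁺ x∈ v≢x
          size≤ : size (S − v − x) + 1ℤ ≤ size S
          size≤ = ≤-trans (≤-reflexive (sym (size-remove x∈S−v))) (size-mono λ u → ∈-−ˡ)
          gap₂ : ∀ B → B ⊆ S − v − x → + 2 ≤ size B → + 4 ≤ ρ m β ⟦ B ⟧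
          gap₂ B B⊆ = gapS−v v∈S gap B (λ u p → ∈-−ˡ (B⊆ u p))
          f≤2 : ∀ B → B ⊆ S − v − x → dot ⟦ B ⟧ f ≤ + 2
          f≤2 B B⊆ = subst (_≤ + 2) (sym (trans (dot-+ʳ ⟦ B ⟧ (δ x ⊞ δ y) (δ z)) (cong₂ _+_ (trans (dot-+ʳ ⟦ B ⟧ (δ x) (δ y)) (cong₂ _+_ (trans (dot-⟦⟧δ B x) (⟦⟧-∉ x∉B)) (dot-⟦⟧δ B y))) (dot-⟦⟧δ B z))))
            ((≤-refl {0ℤ} ⊕ χ≤1 (B y)) ⊕ χ≤1 (B z))
            where
            x∉B : x ∉ B
            x∉B = ∉-⊆ B⊆ ∉-−
          μxv : 1ℤ ≤ μ x v
          μxv = subst (1ℤ ≤_) (sym (trans (μ-sym x v) (μ-row row₃ x∈))) (padʳ (padʳ (≤-reflexive (sym (δ-refl x))) (χ≥0 (x == y))) (χ≥0 (x == z)))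
          deg-x : row μ x ⟦ S − v − x ⟧ ≤ + 2
          deg-x = arith (row μ x ⟦ S − v − x ⟧) (row μ x ⟦ S − v ⟧) (μ x v) (row-mono μ≥0 x (⟦⟧-mono λ u → ∈-−ˡ)) μxv
            (trans (sym (trans (row-cong μ x (⟦⟧-remove v∈S)) (trans (row-+ μ x ⟦ S − v ⟧ (δ v)) (cong (_+_ (row μ x ⟦ S − v ⟧)) (row-δ μ x v))))) (proj₁ (proj₂ (T₀⁻ x∈T))))
            where
            arith : ∀ a b e → a ≤ b → 1ℤ ≤ e → b + e ≡ + 3 → a ≤ + 2
            arith a b e p q r = lin (p ⊕ q ⊕ ≤-reflexive r) (solve (a ∷ b ∷ e ∷ []))
          load-x : raise β f x ≤ 1ℤ
          load-x = ≤-trans (raise-≤ β f x) (≤-reflexive (cong₂ _+_ (proj₂ (proj₂ (T₀⁻ x∈T))) (cong₂ _+_ (cong₂ _+_ (δ-refl x) (δ-≢ (x≢y ∘ sym))) (δ-≢ z≢x))))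

      light-tri : Colorable m β S ⊎ (∃[ x ] ∃[ y ] ∃[ z ] Tri v x y z)
      light-tri = let x , y , z , x∈ , y∈ , z∈ , row₃ = three v deg in go x∈ y∈ z∈ row₃
        where
        go : ∀ {x y z} → x ∈ S → y ∈ S → z ∈ S → Row₃ v x y z → Colorable m β S ⊎ (∃[ x ] ∃[ y ] ∃[ z ] Tri v x y z)
        go {x} {y} {z} x∈ y∈ z∈ r with x ≟ y | y ≟ z | z ≟ x
        ... | yes e | _ | _ = inj₁ (double r x∈ y∈ z∈ e)
        ... | no _ | yes e | _ = inj₁ (double (rotate r) y∈ z∈ x∈ e)
        ... | no _ | no _ | yes e = inj₁ (double (rotate (rotate r)) z∈ x∈ y∈ e)
        ... | no x≢y | no y≢z | no z≢x with β x ≤⊎> 1ℤ | β y ≤⊎> 1ℤ | β z ≤⊎> 1ℤ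
        ...   | inj₂ p | _ | _ = inj₁ (saturated r x∈ y∈ z∈ p)
        ...   | inj₁ _ | inj₂ p | _ = inj₁ (saturated (rotate r) y∈ z∈ x∈ p)
        ...   | inj₁ _ | inj₁ _ | inj₂ p = inj₁ (saturated (rotate (rotate r)) z∈ x∈ y∈ p)
        ...   | inj₁ x≤1 | inj₁ y≤1 | inj₁ z≤1 with x ∈? T₀ | y ∈? T₀ | z ∈? T₀
        ...     | inj₁ p | _ | _ = inj₁ (adjacent-light r x∈ y∈ z∈ x≢y z≢x p)
        ...     | inj₂ _ | inj₁ p | _ = inj₁ (adjacent-light (rotate r) y∈ z∈ x∈ y≢z x≢y p)
        ...     | inj₂ _ | inj₂ _ | inj₁ p = inj₁ (adjacent-light (rotate (rotate r)) z∈ x∈ y∈ z≢x y≢z p)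
        ...     | inj₂ x∉ | inj₂ y∉ | inj₂ z∉ = inj₂ (x , y , z , record
          { row₃ = r ; x∈ = x∈ ; y∈ = y∈ ; z∈ = z∈ ; x≢y = x≢y ; y≢z = y≢z ; z≢x = z≢x
          ; x≤1 = x≤1 ; y≤1 = y≤1 ; z≤1 = z≤1 ; x∉ = x∉ ; y∉ = y∉ ; z∉ = z∉ })

-- Vertices of degree 3 and load 1 with three light neighbours

both? : ∀ {N} (B : VSet N) (p q : Fin N) → p ∈ B × q ∈ B ⊎ ⟦ B ⟧ p * ⟦ B ⟧ q ≡ 0ℤ
both? B p q with p ∈? B | q ∈? B
... | inj₁ p∈ | inj₁ q∈ = inj₁ (p∈ , q∈)
... | inj₂ p∉ | _       = inj₂ (trans (cong (_* ⟦ B ⟧ q) (⟦⟧-∉ p∉)) (*-zeroˡ (⟦ B ⟧ q)))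
... | inj₁ _  | inj₂ q∉ = inj₂ (trans (cong (⟦ B ⟧ p *_) (⟦⟧-∉ q∉)) (*-zeroʳ (⟦ B ⟧ p)))

both-∈ : ∀ {N} {B : VSet N} {p q : Fin N} → p ∈ B → q ∈ B → ⟦ B ⟧ p * ⟦ B ⟧ q ≡ 1ℤ
both-∈ p q = cong₂ _*_ (⟦⟧-∈ p) (⟦⟧-∈ q)

module CubicReduction {N : ℕ} (m : Mult N) {β : Fin N → ℤ} (load : DegreeOne.IsLoad {N} β) {S : VSet N} (sparse : DegreeOne.Sparse m β S) (below : DegreeOne.Below S)
  (gap : DegreeOne.Gap m β S (+ 4)) where
  open DegreeOne {N}
  open Mult m
  open LightVertices m load sparse below gap public

  ρ-addEdge : ∀ (m : Mult N) β {x z} (x≢z : x ≢ z) a → ρ (addEdge m x≢z) β a ≡ ρ m β a - + 4 * (a x * a z)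
  ρ-addEdge m β {x} {z} x≢z a = trans (ρ-def (addEdge m x≢z) β a) (trans (cong (λ t → dot a (weight β) - + 2 * t) (quad-addEdge m x≢z a))
    (trans (regroup (dot a (weight β)) (quad (Mult.μ m) a a) (a x * a z)) (cong (_- + 4 * (a x * a z)) (sym (ρ-def m β a)))))
    where
    regroup : ∀ w q p → w - + 2 * (q + + 2 * p) ≡ w - + 2 * q - + 4 * p
    regroup = solve-∀

  tri-simple : ∀ {v x y z u} → Tri v x y z → u ∈ S → μ v u ≤ 1ℤ
  tri-simple {v} {x} {y} {z} {u} t u∈ = subst (_≤ 1ℤ) (sym (μ-row row₃ u∈)) (case u ≟ x of λ
    { (yes refl) → ≤-reflexive (cong₂ _+_ (cong₂ _+_ (δ-refl u) (δ-≢ x≢y)) (δ-≢ (z≢x ∘ sym)))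
    ; (no p) → case u ≟ y of λ
      { (yes refl) → ≤-reflexive (cong₂ _+_ (cong₂ _+_ (δ-≢ p) (δ-refl u)) (δ-≢ y≢z))
      ; (no q) → ≤-trans (≤-reflexive (cong (_+ δ u z) (cong₂ _+_ (δ-≢ p) (δ-≢ q)))) (subst (_≤ 1ℤ) (sym (+-identityˡ (δ u z))) (χ≤1 (u == z))) } })
    where open Tri t

  tri-at : ∀ {v x y z u} → Tri v x y z → u ∈ S → 1ℤ ≤ μ v u → ∃[ a ] ∃[ b ] Tri v u a b
  tri-at {v} {x} {y} {z} {u} t u∈ le = case u ≟ x of λ
    { (yes refl) → _ , _ , t
    ; (no p) → case u ≟ y of λ
      { (yes refl) → _ , _ , rotate-tri t
      ; (no q) → case u ≟ z of λ
        { (yes refl) → _ , _ , rotate-tri (rotate-tri t)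
        ; (no r) → ⊥-elim (1≰0 (≤-trans le (≤-reflexive (trans (μ-row (Tri.row₃ t) u∈) (cong₂ _+_ (cong₂ _+_ (δ-≢ p) (δ-≢ q)) (δ-≢ r)))))) } } }

  ∈∉-≢ : ∀ {A : VSet N} {u v} → u ∈ A → v ∉ A → u ≢ v
  ∈∉-≢ p q refl = ∈-contra p q

  gap-∉ : ∀ {w B} → w ∈ S → B ⊆ S → w ∉ B → + 2 ≤ size B → + 4 ≤ ρ m β ⟦ B ⟧
  gap-∉ w∈ B⊆ w∉ = gap _ B⊆ _ w∈ w∉

  insert-⊆ : ∀ {B v} → B ⊆ S → v ∈ S → B ⁺ v ⊆ S
  insert-⊆ B⊆ v∈ u p = case ∈-⁺⁻ p of λ { (inj₁ refl) → v∈ ; (inj₂ q) → B⊆ u q }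

  two-⁺ : ∀ {B : VSet N} {v} → + 2 ≤ size B → + 2 ≤ size (B ⁺ v)
  two-⁺ two = ≤-trans two (size-mono λ u → ∈-⁺ˡ)

  module Cubic {y v p q x z} (y∈ : y ∈ S) (βy : β y ≡ 1ℤ) (row-y : Row₃ y v p q)
    (v∈T : v ∈ T₀) (p∈ : p ∈ S) (q∈ : q ∈ S) (p≢q : p ≢ q) (t : Tri v y x z) where
    open Tri t using (row₃) renaming (x∉ to y∉T; z∈ to z∈S; y∈ to x∈S)

    v∈S : v ∈ S
    v∈S = proj₁ (T₀⁻ v∈T)
    v≢y : v ≢ y
    v≢y = ∈∉-≢ v∈T y∉T
    f : Fin N → ℤ
    f = δ x ⊞ δ z
    f≥0 : ∀ u → 0ℤ ≤ f u
    f≥0 u = χ≥0 (x == u) ⊕ χ≥0 (z == u)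
    S₂ = S − v − y
    m₁ = addEdge m p≢q

    -- If `B` contains `p` and `q`, adding `y` changes the potential by 5 - 8 = -3, and the result
    -- still omits `v`; so `B` has potential at least 7. This pays 4 for the new edge and 4 for the
    -- loads of `x` and `z`, leaving -1. For other `B` only the loads are charged to the gap 4.
    sparse₁ : Sparse m₁ (raise β f) S₂
    sparse₁ B B⊆ two = subst (- 1ℤ ≤_) (sym (ρ-addEdge m (raise β f) p≢q ⟦ B ⟧))
      (case both? B p q of λ
        { (inj₂ e) → subst (λ t → - 1ℤ ≤ ρ m (raise β f) ⟦ B ⟧ - + 4 * t) (sym e) (arith₀ (ρ m β ⟦ B ⟧) (ρ m (raise β f) ⟦ B ⟧) (dot ⟦ B ⟧ f) (gap-∉ v∈S B⊆S v∉B two) le f≤2)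
        ; (inj₁ (p∈B , q∈B)) → subst (λ t → - 1ℤ ≤ ρ m (raise β f) ⟦ B ⟧ - + 4 * t) (sym (both-∈ p∈B q∈B))
            (arith₁ (ρ m β ⟦ B ⟧) (ρ m (raise β f) ⟦ B ⟧) (dot ⟦ B ⟧ f) (ρ m β ⟦ B ⁺ y ⟧)
              (gap-∉ v∈S (insert-⊆ B⊆S y∈) (∉-⁺ (v≢y ∘ sym) v∉B) (two-⁺ two))
              (trans (ρ-insert m β y∉B) (cong₂ (λ b r → ρ m β ⟦ B ⟧ + (+ 7 - + 2 * b) - + 4 * r) βy (trans (row-y B B⊆S) (cong₂ _+_ (cong₂ _+_ (⟦⟧-∉ v∉B) (⟦⟧-∈ p∈B)) (⟦⟧-∈ q∈B)))))
              le f≤2) })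
      where
      B⊆S : B ⊆ S
      B⊆S u h = ∈-−ˡ (∈-−ˡ (B⊆ u h))
      v∉B : v ∉ B
      v∉B = ∉-⊆ {B = S − v} (λ u h → ∈-−ˡ (B⊆ u h)) ∉-−
      y∉B : y ∉ B
      y∉B = ∉-⊆ B⊆ ∉-−
      le = ρ-load m {β} {raise β f} {f} ⟦ B ⟧ (⟦⟧≥0 B) (raise-≤ β f)
      f≤2 : dot ⟦ B ⟧ f ≤ + 2
      f≤2 = subst (_≤ + 2) (sym (trans (dot-+ʳ ⟦ B ⟧ (δ x) (δ z)) (cong₂ _+_ (dot-⟦⟧δ B x) (dot-⟦⟧δ B z)))) (χ≤1 (B x) ⊕ χ≤1 (B z))
      arith₀ : ∀ r r′ e → + 4 ≤ r → r ≤ r′ + + 2 * e → e ≤ + 2 → - 1ℤ ≤ r′ - + 4 * 0ℤ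
      arith₀ r r′ e a b c = lin (a ⊕ b ⊕ c ⊕ c ⊕ 0≤+ 1) (solve (r ∷ r′ ∷ e ∷ []))
      arith₁ : ∀ r r′ e s → + 4 ≤ s → s ≡ r + (+ 7 - + 2 * 1ℤ) - + 4 * (0ℤ + 1ℤ + 1ℤ) → r ≤ r′ + + 2 * e → e ≤ + 2 → - 1ℤ ≤ r′ - + 4 * 1ℤ
      arith₁ r r′ e s a h b c = lin (a ⊕ ≤-reflexive h ⊕ b ⊕ c ⊕ c) (solve (r ∷ r′ ∷ e ∷ s ∷ []))

    -- `y` enters F by subdividing the edge from `p` to `q`; hence among the neighbours of `v` only
    -- `x` and `z` need room.
    cubic : Colorable m β S
    cubic =
      let c , C = below m₁ (raise β f) S₂ (raise-load load f≥0) size≤ sparse₁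
          C₁ = subdivide m p≢q 1ℤ {S = S − v} {v = y} C λ B B⊆ → ≤-reflexive (trans (row-y B (λ u h → ∈-−ˡ (∈-−ˡ (B⊆ u h))))
                 (trans (cong (λ s → s + ⟦ B ⟧ p + ⟦ B ⟧ q) (⟦⟧-∉ (∉-⊆ {B = S − v} (λ u h → ∈-−ˡ (B⊆ u h)) ∉-−))) (cong (_+ ⟦ B ⟧ q) (+-identityˡ (⟦ B ⟧ p)))))
      in extend-three m C₁ load f≥0 (≤-reflexive (trans (sym (row-self m v∈S)) (proj₁ (proj₂ (T₀⁻ v∈T))))) (≤-reflexive (cong (_+ 1ℤ) (proj₂ (proj₂ (T₀⁻ v∈T)))))
           λ u u∈ u∈c _ → case u ≟ y of λ
             { (yes refl) → ∈-contra u∈c upd-false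
             ; (no u≢y) → ≤-reflexive (trans (μ-row row₃ (∈-−ˡ u∈)) (cong₂ _+_ (trans (cong (_+ δ u x) (δ-≢ u≢y)) (trans (+-identityˡ (δ u x)) (δ-sym u x))) (δ-sym u z))) }
      where
      size≤ : size S₂ + 1ℤ ≤ size S
      size≤ = ≤-trans (≤-reflexive (sym (size-remove (∈-−⁺ y∈ v≢y)))) (size-mono λ u → ∈-−ˡ)

-- Vertices of degree 4 and load 0 with three light neighbours

module QuarticReduction {N : ℕ} (m : Mult N) {β : Fin N → ℤ} (load : DegreeOne.IsLoad {N} β) {S : VSet N} (sparse : DegreeOne.Sparse m β S) (below : DegreeOne.Below S)
  (gap : DegreeOne.Gap m β S (+ 4)) where
  open DegreeOne {N}
  open Mult m
  open CubicReduction m load sparse below gap public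

  raise-mono : ∀ {f g : Fin N → ℤ} u → f u ≤ g u → raise β f u ≤ raise β g u
  raise-mono {f} {g} u le = ⊓-monoˡ-≤ (1ℤ + 1ℤ) (+-monoʳ-≤ (β u) le)

  -- `Z` is meant to be `S` without `y` and its three light neighbours. As a parameter it stays the
  -- same when the three arms are permuted.
  module Quartic {y r : Fin N} (y∈ : y ∈ S) (βy : β y ≡ 0ℤ) (r∈ : r ∈ S) (Z : VSet N) (Z⊆S : Z ⊆ S) (y∉Z : y ∉ Z) where

    Row₄ : Fin N → Fin N → Fin N → Set
    Row₄ v₁ v₂ v₃ = ∀ B → B ⊆ S → row μ y ⟦ B ⟧ ≡ ⟦ B ⟧ v₁ + ⟦ B ⟧ v₂ + ⟦ B ⟧ v₃ + ⟦ B ⟧ r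

    record Arm (v x z : Fin N) : Set where
      field
        tri : Tri v y x z
        v∈T : v ∈ T₀
        v∉Z : v ∉ Z
      open Tri tri public using (row₃) renaming (x∉ to y∉T; y∉ to x∉T; z∉ to z∉T; y≢z to x≢z; y∈ to x∈S; z∈ to z∈S; x≢y to y≢x; z≢x to z≢y)
      v∈S : v ∈ S
      v∈S = proj₁ (T₀⁻ v∈T)
      βv : β v ≡ 0ℤ
      βv = proj₂ (proj₂ (T₀⁻ v∈T))
      v≢y : v ≢ y
      v≢y = ∈∉-≢ v∈T y∉T

    module Two {v₁ x₁ z₁ v₂ x₂ z₂ v₃ x₃ z₃} (a₁ : Arm v₁ x₁ z₁) (a₂ : Arm v₂ x₂ z₂) (a₃ : Arm v₃ x₃ z₃)
      (v₁≢v₂ : v₁ ≢ v₂) (v₁≢v₃ : v₁ ≢ v₃) (v₂≢v₃ : v₂ ≢ v₃) (row-y : Row₄ v₁ v₂ v₃) where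
      module A₁ = Arm a₁
      module A₂ = Arm a₂
      module A₃ = Arm a₃

      -- Adding `y` contributes 7, less 4 if `r` is in `B`; then `v₁` and `v₂` contribute 7 - 12 =
      -- -5 each. The enlarged set still omits `v₃`, so the gap 4 applies to it.
      both-arms : ∀ {B} → B ⊆ Z → + 2 ≤ size B → x₁ ∈ B → z₁ ∈ B → x₂ ∈ B → z₂ ∈ B → + 7 + + 4 * ⟦ B ⟧ r ≤ ρ m β ⟦ B ⟧
      both-arms {B} B⊆Z two x₁∈ z₁∈ x₂∈ z₂∈ = arith (ρ m β ⟦ B ⟧) (⟦ B ⟧ r) (ρ m β ⟦ B₁ ⟧) (ρ m β ⟦ B₂ ⟧) (ρ m β ⟦ B₃ ⟧)
        (gap-∉ A₃.v∈S B₃⊆ v₃∉ (two-⁺ (two-⁺ (two-⁺ two)))) eq₁ eq₂ eq₃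
        where
        B⊆S : B ⊆ S
        B⊆S u p = Z⊆S u (B⊆Z u p)
        B₁ = B ⁺ y
        B₂ = B₁ ⁺ v₁
        B₃ = B₂ ⁺ v₂
        B₁⊆ : B₁ ⊆ S
        B₁⊆ = insert-⊆ B⊆S y∈
        B₂⊆ : B₂ ⊆ S
        B₂⊆ = insert-⊆ B₁⊆ A₁.v∈S
        B₃⊆ : B₃ ⊆ S
        B₃⊆ = insert-⊆ B₂⊆ A₂.v∈S
        ∉B : ∀ {v} → v ∉ Z → v ∉ B
        ∉B = ∉-⊆ B⊆Z
        v₁∉ : v₁ ∉ B₁
        v₁∉ = ∉-⁺ (A₁.v≢y ∘ sym) (∉B A₁.v∉Z)
        v₂∉ : v₂ ∉ B₂
        v₂∉ = ∉-⁺ v₁≢v₂ (∉-⁺ (A₂.v≢y ∘ sym) (∉B A₂.v∉Z))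
        v₃∉ : v₃ ∉ B₃
        v₃∉ = ∉-⁺ v₂≢v₃ (∉-⁺ v₁≢v₃ (∉-⁺ (A₃.v≢y ∘ sym) (∉B A₃.v∉Z)))
        full : ∀ {v x z} (a : Arm v x z) {C} → C ⊆ S → y ∈ C → x ∈ C → z ∈ C → row μ v ⟦ C ⟧ ≡ + 3
        full a {C} C⊆ p q s = trans (Arm.row₃ a C C⊆) (cong₂ _+_ (cong₂ _+_ (⟦⟧-∈ p) (⟦⟧-∈ q)) (⟦⟧-∈ s))
        eq₁ : ρ m β ⟦ B₁ ⟧ ≡ ρ m β ⟦ B ⟧ + (+ 7 - + 2 * 0ℤ) - + 4 * (0ℤ + 0ℤ + 0ℤ + ⟦ B ⟧ r)
        eq₁ = trans (ρ-insert m β (∉B y∉Z)) (cong₂ (λ b t → ρ m β ⟦ B ⟧ + (+ 7 - + 2 * b) - + 4 * t) βy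
          (trans (row-y B B⊆S) (cong (_+ ⟦ B ⟧ r) (cong₂ _+_ (cong₂ _+_ (⟦⟧-∉ (∉B A₁.v∉Z)) (⟦⟧-∉ (∉B A₂.v∉Z))) (⟦⟧-∉ (∉B A₃.v∉Z))))))
        eq₂ : ρ m β ⟦ B₂ ⟧ ≡ ρ m β ⟦ B₁ ⟧ + (+ 7 - + 2 * 0ℤ) - + 4 * + 3
        eq₂ = trans (ρ-insert m β v₁∉) (cong₂ (λ b t → ρ m β ⟦ B₁ ⟧ + (+ 7 - + 2 * b) - + 4 * t) A₁.βv (full a₁ B₁⊆ ∈-⁺≡ (∈-⁺ˡ x₁∈) (∈-⁺ˡ z₁∈)))
        eq₃ : ρ m β ⟦ B₃ ⟧ ≡ ρ m β ⟦ B₂ ⟧ + (+ 7 - + 2 * 0ℤ) - + 4 * + 3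
        eq₃ = trans (ρ-insert m β v₂∉) (cong₂ (λ b t → ρ m β ⟦ B₂ ⟧ + (+ 7 - + 2 * b) - + 4 * t) A₂.βv (full a₂ B₂⊆ (∈-⁺ˡ ∈-⁺≡) (∈-⁺ˡ (∈-⁺ˡ x₂∈)) (∈-⁺ˡ (∈-⁺ˡ z₂∈))))
        arith : ∀ b e b₁ b₂ b₃ → + 4 ≤ b₃ → b₁ ≡ b + (+ 7 - + 2 * 0ℤ) - + 4 * (0ℤ + 0ℤ + 0ℤ + e) → b₂ ≡ b₁ + (+ 7 - + 2 * 0ℤ) - + 4 * + 3 →
          b₃ ≡ b₂ + (+ 7 - + 2 * 0ℤ) - + 4 * + 3 → + 7 + + 4 * e ≤ b
        arith b e b₁ b₂ b₃ p q s t = lin (p ⊕ ≤-reflexive q ⊕ ≤-reflexive s ⊕ ≤-reflexive t) (solve (b ∷ e ∷ b₁ ∷ b₂ ∷ b₃ ∷ []))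

      -- By submodularity: the union contains both arms and r, so its potential is at least 11.
      no-two-tight : ∀ {B C} → B ⊆ Z → C ⊆ Z → + 2 ≤ size B → x₁ ∈ B → z₁ ∈ B → r ∈ B → ρ m β ⟦ B ⟧ ≤ + 6 →
        x₂ ∈ C → z₂ ∈ C → r ∈ C → ρ m β ⟦ C ⟧ ≤ + 6 → ⊥
      no-two-tight {B} {C} B⊆ C⊆ two x₁∈ z₁∈ r∈B ρB x₂∈ z₂∈ r∈C ρC =
        1≰0 (arith (ρ m β ⟦ B ⟧) (ρ m β ⟦ C ⟧) (ρ m β ⟦ B ∪ C ⟧) (ρ m β ⟦ B ∩ C ⟧) (ρ-submodular m β B C) ρB ρC union inter)
        where
        ∪⊆ : B ∪ C ⊆ Z
        ∪⊆ u p = case ∈-∪⁻ p of λ { (inj₁ q) → B⊆ u q ; (inj₂ q) → C⊆ u q }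
        union : + 7 + + 4 * 1ℤ ≤ ρ m β ⟦ B ∪ C ⟧
        union = subst (λ t → + 7 + + 4 * t ≤ ρ m β ⟦ B ∪ C ⟧) (⟦⟧-∈ (∈-∪ˡ r∈B))
          (both-arms ∪⊆ (≤-trans two (size-mono λ u → ∈-∪ˡ)) (∈-∪ˡ x₁∈) (∈-∪ˡ z₁∈) (∈-∪ʳ x₂∈) (∈-∪ʳ z₂∈))
        inter : + 3 ≤ ρ m β ⟦ B ∩ C ⟧
        inter = case single-or-two m β load (∈-∩⁺ r∈B r∈C) of λ
          { (inj₁ p) → ≤-trans (+≤+ (ℕ.s≤s (ℕ.s≤s (ℕ.s≤s ℕ.z≤n)))) (gap-∉ y∈ (λ u q → Z⊆S u (B⊆ u (∈-∩ˡ q))) (∉-⊆ (λ u q → B⊆ u (∈-∩ˡ q)) y∉Z) p)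
          ; (inj₂ p) → p }
        arith : ∀ b c u i → u + i ≤ b + c → b ≤ + 6 → c ≤ + 6 → + 7 + + 4 * 1ℤ ≤ u → + 3 ≤ i → 1ℤ ≤ 0ℤ
        arith b c u i p q s t w = lin (p ⊕ q ⊕ s ⊕ t ⊕ w ⊕ 0≤+ 1) (solve (b ∷ c ∷ u ∷ i ∷ []))

      module _ (loose₁ : ∀ B → B ⊆ Z → + 2 ≤ size B → x₁ ∈ B → z₁ ∈ B → r ∈ B → + 7 ≤ ρ m β ⟦ B ⟧)
               (loose₂ : ∀ B → B ⊆ Z → + 2 ≤ size B → x₂ ∈ B → z₂ ∈ B → r ∈ B → + 7 ≤ ρ m β ⟦ B ⟧)
               (Z⊇ : ∀ {u} → u ∈ S → y ≢ u → v₁ ≢ u → v₂ ≢ u → v₃ ≢ u → u ∈ Z) where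
        S₁ = S − v₃
        S₂ = S₁ − y
        S₃ = S₂ − v₂
        S₄ = S₃ − v₁
        m₂  = addEdge m A₂.x≢z
        m₁₂ = addEdge m₂ A₁.x≢z
        f g : Fin N → ℤ
        -- Two units force `r` into F, since D + 1 = 2. The unit at `y` is for `v₃`, and costs
        -- nothing on `S₄` because `y` is deleted.
        f = (λ u → + 2 * δ r u) ⊞ δ y
        g = δ y
        g≥0 : ∀ u → 0ℤ ≤ g u
        g≥0 u = χ≥0 (y == u)
        f≥0 : ∀ u → 0ℤ ≤ f u
        f≥0 u = *-nonneg (0≤+ 2) (χ≥0 (r == u)) ⊕ χ≥0 (y == u)

        S₄⊆Z : S₄ ⊆ Z
        S₄⊆Z u p = Z⊇ (∈-−ˡ (∈-−ˡ (∈-−ˡ (∈-−ˡ p)))) (∈-−ʳ (∈-−ˡ (∈-−ˡ p))) (∈-−ʳ p) (∈-−ʳ (∈-−ˡ p)) (∈-−ʳ (∈-−ˡ (∈-−ˡ (∈-−ˡ p))))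

        -- The load of `r` and each of the two new edges cost 4, and the balance may go down to -1.
        -- One of these items is covered by the gap 4, an edge together with `r` by looseness, and
        -- both edges, with or without `r`, by `both-arms`.
        sparse₄ : Sparse m₁₂ (raise β f) S₄
        sparse₄ B B⊆ two = subst (- 1ℤ ≤_) (sym (trans (ρ-addEdge m₂ (raise β f) A₁.x≢z ⟦ B ⟧) (cong (_- + 4 * π₁) (ρ-addEdge m (raise β f) A₂.x≢z ⟦ B ⟧))))
          (arith (ρ m β ⟦ B ⟧) (ρ m (raise β f) ⟦ B ⟧) (⟦ B ⟧ r) π₁ π₂ le bound)
          where
          π₁ = ⟦ B ⟧ x₁ * ⟦ B ⟧ z₁
          π₂ = ⟦ B ⟧ x₂ * ⟦ B ⟧ z₂
          B⊆Z : B ⊆ Z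
          B⊆Z u p = S₄⊆Z u (B⊆ u p)
          y∉B : y ∉ B
          y∉B = ∉-⊆ B⊆Z y∉Z
          cost : dot ⟦ B ⟧ f ≡ + 2 * ⟦ B ⟧ r
          cost = trans (dot-+ʳ ⟦ B ⟧ (λ u → + 2 * δ r u) (δ y)) (trans (cong₂ _+_ (trans (dot-*ʳ ⟦ B ⟧ (δ r) (+ 2)) (cong (_*_ (+ 2)) (dot-⟦⟧δ B r))) (trans (dot-⟦⟧δ B y) (⟦⟧-∉ y∉B))) (+-identityʳ (+ 2 * ⟦ B ⟧ r)))
          le : ρ m β ⟦ B ⟧ ≤ ρ m (raise β f) ⟦ B ⟧ + + 2 * (+ 2 * ⟦ B ⟧ r)
          le = subst (λ t → ρ m β ⟦ B ⟧ ≤ ρ m (raise β f) ⟦ B ⟧ + + 2 * t) cost (ρ-load m ⟦ B ⟧ (⟦⟧≥0 B) (raise-≤ β f))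
          four : + 4 ≤ ρ m β ⟦ B ⟧
          four = gap-∉ y∈ (λ u p → Z⊆S u (B⊆Z u p)) y∉B two
          bound : + 4 * ⟦ B ⟧ r + + 4 * π₁ + + 4 * π₂ ≤ ρ m β ⟦ B ⟧ + 1ℤ
          bound = case both? B x₁ z₁ of λ
            { (inj₁ (x₁∈ , z₁∈)) → case both? B x₂ z₂ of λ
              { (inj₁ (x₂∈ , z₂∈)) → subst₂ (λ s t → + 4 * ⟦ B ⟧ r + + 4 * s + + 4 * t ≤ ρ m β ⟦ B ⟧ + 1ℤ) (sym (both-∈ x₁∈ z₁∈)) (sym (both-∈ x₂∈ z₂∈))
                  (two-π (ρ m β ⟦ B ⟧) (⟦ B ⟧ r) (both-arms B⊆Z two x₁∈ z₁∈ x₂∈ z₂∈))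
              ; (inj₂ e) → subst₂ (λ s t → + 4 * ⟦ B ⟧ r + + 4 * s + + 4 * t ≤ ρ m β ⟦ B ⟧ + 1ℤ) (sym (both-∈ x₁∈ z₁∈)) (sym e)
                  (case r ∈? B of λ
                    { (inj₁ p) → subst (λ t → + 4 * t + + 4 * 1ℤ + + 4 * 0ℤ ≤ ρ m β ⟦ B ⟧ + 1ℤ) (sym (⟦⟧-∈ p)) (+-monoˡ-≤ 1ℤ (loose₁ B B⊆Z two x₁∈ z₁∈ p))
                    ; (inj₂ p) → subst (λ t → + 4 * t + + 4 * 1ℤ + + 4 * 0ℤ ≤ ρ m β ⟦ B ⟧ + 1ℤ) (sym (⟦⟧-∉ p)) (padʳ four (0≤+ 1)) }) }
            ; (inj₂ e) → case both? B x₂ z₂ of λ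
              { (inj₁ (x₂∈ , z₂∈)) → subst₂ (λ s t → + 4 * ⟦ B ⟧ r + + 4 * s + + 4 * t ≤ ρ m β ⟦ B ⟧ + 1ℤ) (sym e) (sym (both-∈ x₂∈ z₂∈))
                  (case r ∈? B of λ
                    { (inj₁ p) → subst (λ t → + 4 * t + + 4 * 0ℤ + + 4 * 1ℤ ≤ ρ m β ⟦ B ⟧ + 1ℤ) (sym (⟦⟧-∈ p)) (+-monoˡ-≤ 1ℤ (loose₂ B B⊆Z two x₂∈ z₂∈ p))
                    ; (inj₂ p) → subst (λ t → + 4 * t + + 4 * 0ℤ + + 4 * 1ℤ ≤ ρ m β ⟦ B ⟧ + 1ℤ) (sym (⟦⟧-∉ p)) (padʳ four (0≤+ 1)) })
              ; (inj₂ e′) → subst₂ (λ s t → + 4 * ⟦ B ⟧ r + + 4 * s + + 4 * t ≤ ρ m β ⟦ B ⟧ + 1ℤ) (sym e) (sym e′)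
                  (none (ρ m β ⟦ B ⟧) (⟦ B ⟧ r) four (χ≤1 (B r))) } }
            where
            two-π : ∀ b e → + 7 + + 4 * e ≤ b → + 4 * e + + 4 * 1ℤ + + 4 * 1ℤ ≤ b + 1ℤ
            two-π b e p = lin p (solve (b ∷ e ∷ []))
            none : ∀ b e → + 4 ≤ b → e ≤ 1ℤ → + 4 * e + + 4 * 0ℤ + + 4 * 0ℤ ≤ b + 1ℤ
            none b e p q = lin (p ⊕ q ⊕ q ⊕ q ⊕ q ⊕ 0≤+ 1) (solve (b ∷ e ∷ []))
          arith : ∀ b b′ e s t → b ≤ b′ + + 2 * (+ 2 * e) → + 4 * e + + 4 * s + + 4 * t ≤ b + 1ℤ → - 1ℤ ≤ b′ - + 4 * t - + 4 * s
          arith b b′ e s t p q = lin (p ⊕ q) (solve (b ∷ b′ ∷ e ∷ s ∷ t ∷ []))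

        v₁∈S₃ : v₁ ∈ S₃
        v₁∈S₃ = ∈-−⁺ (∈-−⁺ (∈-−⁺ A₁.v∈S (v₁≢v₃ ∘ sym)) (A₁.v≢y ∘ sym)) (v₁≢v₂ ∘ sym)

        size≤ : size S₄ + 1ℤ ≤ size S
        size≤ = ≤-trans (≤-reflexive (sym (size-remove v₁∈S₃))) (size-mono λ u p → ∈-−ˡ (∈-−ˡ (∈-−ˡ p)))

        arm-row : ∀ {v x z} (a : Arm v x z) {B} → B ⊆ S₂ → row μ v ⟦ B ⟧ ≡ ⟦ B ⟧ x + ⟦ B ⟧ z
        arm-row {x = x} {z} a {B} B⊆ = trans (Arm.row₃ a B (λ u p → ∈-−ˡ (∈-−ˡ (B⊆ u p)))) (trans (cong (λ t → t + ⟦ B ⟧ x + ⟦ B ⟧ z) (⟦⟧-∉ (∉-⊆ B⊆ ∉-−))) (cong (_+ ⟦ B ⟧ z) (+-identityˡ (⟦ B ⟧ x))))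

        -- v₁ and v₂ go to F and subdivide the new edges, y goes to M, and y has room for v₃.
        quartic : Colorable m β S
        quartic =
          let c , C = below m₁₂ (raise β f) S₄ (raise-load load f≥0) size≤ sparse₄
              C₁ = subdivide m₂ A₁.x≢z 1ℤ {S = S₃} {v = v₁} C λ B B⊆ → ≤-reflexive (trans (row-addEdge m A₂.x≢z v₁ ⟦ B ⟧)
                     (trans (cong₂ _+_ (arm-row a₁ (λ u p → ∈-−ˡ (∈-−ˡ (B⊆ u p)))) (cong₂ (λ s t → s * ⟦ B ⟧ z₂ + t * ⟦ B ⟧ x₂) (δ-≢ (∈∉-≢ A₁.v∈T A₂.x∉T ∘ sym)) (δ-≢ (∈∉-≢ A₁.v∈T A₂.z∉T ∘ sym))))
                       (vanish (⟦ B ⟧ x₁ + ⟦ B ⟧ z₁) (⟦ B ⟧ z₂) (⟦ B ⟧ x₂))))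
              C₂ = subdivide m A₂.x≢z 1ℤ {S = S₂} {v = v₂} C₁ λ B B⊆ → ≤-reflexive (arm-row a₂ (λ u p → ∈-−ˡ (B⊆ u p)))
          in finish c C₂
          where
          vanish : ∀ a b c → a + (0ℤ * b + 0ℤ * c) ≡ a
          vanish = solve-∀
          finish : ∀ c → Colored m (raise β f) S₂ ((c [ v₁ ↦ false ]) [ v₂ ↦ false ]) → Colorable m β S
          finish c C₂ = extend-three m C₃ load g≥0 (≤-reflexive (trans (sym (row-self m A₃.v∈S)) (proj₁ (proj₂ (T₀⁻ A₃.v∈T))))) (≤-reflexive (cong (_+ 1ℤ) A₃.βv)) slack
            where
            c₁ = c [ v₁ ↦ false ]
            c₂ = c₁ [ v₂ ↦ false ]
            c₃ = c₂ [ y ↦ true ]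
            P = (S₁ − y) ∩ c₂
            P⊆S : P ⊆ S
            P⊆S u p = ∈-−ˡ (∈-−ˡ (∈-∩ˡ p))
            ∉P : ∀ {u} → u ∉ c₂ → u ∉ P
            ∉P = ∉-⊆ (λ u → ∈-∩ʳ)
            v₁∉c₂ : v₁ ∉ c₂
            v₁∉c₂ = nmem (trans (upd-≢ c₁ false (v₁≢v₂ ∘ sym)) (upd-≡ c v₁ false))
            v₃∉P : v₃ ∉ P
            v₃∉P = ∉-⊆ {B = S − v₃} (λ u p → ∈-−ˡ (∈-∩ˡ p)) ∉-−
            r∉P : r ∉ P
            r∉P = case r ∈? P of λ
              { (inj₂ h) → h
              ; (inj₁ p) → ⊥-elim (1≰0 (arith (β r) (raise β f r) (δ y r) (proj₁ (load r)) (χ≥0 (y == r))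
                  (subst (λ t → β r + (+ 2 * t + δ y r) ≤ raise β f r) (δ-refl r) (raise-M β f r (load≤D C₂ (∈-∩ˡ p) (∈-∩ʳ p)))) (load≤D C₂ (∈-∩ˡ p) (∈-∩ʳ p)))) }
              where
              arith : ∀ b b′ d → 0ℤ ≤ b → 0ℤ ≤ d → b + (+ 2 * 1ℤ + d) ≤ b′ → b′ ≤ 1ℤ → 1ℤ ≤ 0ℤ
              arith b b′ d p q s t = lin (p ⊕ q ⊕ s ⊕ t) (solve (b ∷ b′ ∷ d ∷ []))
            row-P : row μ y ⟦ P ⟧ ≡ 0ℤ
            row-P = trans (row-y P P⊆S) (cong₂ _+_ (cong₂ _+_ (cong₂ _+_ (⟦⟧-∉ (∉P v₁∉c₂)) (⟦⟧-∉ (∉P upd-false))) (⟦⟧-∉ v₃∉P)) (⟦⟧-∉ r∉P))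
            C₃ : Colored m (raise β g) S₁ c₃
            C₃ = addM {β = raise β g} {S = S₁} {v = y} C₂
              (λ u u∈ u∈c → subst (raise β g u + μ y u ≤_) (+-identityʳ (raise β f u))
                (raise-mono {g} {f} u (padˡ (*-nonneg (0≤+ 2) (χ≥0 (r == u))) ≤-refl) ⊕ subst (μ y u ≤_) row-P (row-∈ μ≥0 y (∈-∩⁺ u∈ u∈c))))
              (≤-trans (≤-reflexive row-P) (0≤+ 1))
              (subst (λ t → t + raise β g y ≤ 1ℤ) (sym row-P) (subst (_≤ 1ℤ) (sym (+-identityˡ (raise β g y))) (≤-trans (raise-≤ β g y) (≤-reflexive (cong₂ _+_ βy (δ-refl y))))))
            -- `y` is in M, so if `v₃` has at most one edge to M, that edge goes to `y`; no other
            -- neighbour needs room.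
            slack : ∀ u → u ∈ S − v₃ → u ∈ c₃ → row μ v₃ ⟦ (S − v₃) ∩ c₃ ⟧ ≤ 1ℤ → μ v₃ u ≤ g u
            slack u u∈ u∈c rM = case y ≟ u of λ
              { (yes refl) → ≤-trans (tri-simple A₃.tri y∈) (≤-reflexive (sym (δ-refl y)))
              ; (no y≢u) → ≤-trans (arith (μ v₃ u) (μ v₃ y) (row μ v₃ ⟦ (S − v₃) ∩ c₃ ⟧) (row-∈₂ m (∈-∩⁺ (∈-−⁺ y∈ A₃.v≢y) upd-true) (∈-∩⁺ u∈ u∈c) y≢u) rM μy) (g≥0 u) }
              where
              μy : 1ℤ ≤ μ v₃ y
              μy = subst (1ℤ ≤_) (sym (μ-row A₃.row₃ y∈)) (padʳ (padʳ (≤-reflexive (sym (δ-refl y))) (χ≥0 (y == x₃))) (χ≥0 (y == z₃)))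
              arith : ∀ a b s → a + b ≤ s → s ≤ 1ℤ → 1ℤ ≤ b → a ≤ 0ℤ
              arith a b s p q t = lin (p ⊕ q ⊕ t) (solve (a ∷ b ∷ s ∷ []))

    module _ (x z : Fin N) where

      -- The obstructions to replacing this arm by an edge: the edge and the load of `r` together
      -- cost 8, and potential 6 would drop below -1.
      Tight : VSet N → Set
      Tight B = (∀ u → ⟦ B ⟧ u ≤ ⟦ Z ⟧ u) × + 2 ≤ size B × 1ℤ ≤ ⟦ B ⟧ x × 1ℤ ≤ ⟦ B ⟧ z × 1ℤ ≤ ⟦ B ⟧ r × ρ m β ⟦ B ⟧ ≤ + 6

      tight? : (∃[ B ] B ⊆ Z × + 2 ≤ size B × x ∈ B × z ∈ B × r ∈ B × ρ m β ⟦ B ⟧ ≤ + 6) ⊎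
        (∀ B → B ⊆ Z → + 2 ≤ size B → x ∈ B → z ∈ B → r ∈ B → + 7 ≤ ρ m β ⟦ B ⟧)
      tight? = case search {P = Tight} respects dec of λ
        { (inj₁ (B , s , two , x∈ , z∈ , r∈ , le)) → inj₁ (B , (λ u p → mem (χ-true (subst (_≤ ⟦ Z ⟧ u) (⟦⟧-∈ p) (s u)))) , two , mem (χ-true x∈) , mem (χ-true z∈) , mem (χ-true r∈) , le)
        ; (inj₂ none) → inj₂ λ B s two x∈ z∈ r∈ → case ρ m β ⟦ B ⟧ ≤⊎> + 6 of λ
          { (inj₁ p) → ⊥-elim (none B (⟦⟧-mono s , two , one x∈ , one z∈ , one r∈ , p))
          ; (inj₂ p) → p } }
        where
        one : ∀ {B : VSet N} {u} → u ∈ B → 1ℤ ≤ ⟦ B ⟧ u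
        one p = ≤-reflexive (sym (⟦⟧-∈ p))
        respects : ∀ {B B′} → (∀ u → B u ≡ B′ u) → Tight B → Tight B′
        respects eq (s , two , x∈ , z∈ , r∈ , le) = (λ u → subst (_≤ ⟦ Z ⟧ u) (cong χ (eq u)) (s u)) , subst (+ 2 ≤_) (∑-cong (cong χ ∘ eq)) two ,
          subst (λ t → 1ℤ ≤ χ t) (eq x) x∈ , subst (λ t → 1ℤ ≤ χ t) (eq z) z∈ , subst (λ t → 1ℤ ≤ χ t) (eq r) r∈ , subst (_≤ + 6) (ρ-cong m β (cong χ ∘ eq)) le
        dec : ∀ B → Dec (Tight B)
        dec B = all? (λ u → ⟦ B ⟧ u ≤? ⟦ Z ⟧ u) ×-dec ((+ 2 ≤? size B) ×-dec ((1ℤ ≤? ⟦ B ⟧ x) ×-dec ((1ℤ ≤? ⟦ B ⟧ z) ×-dec ((1ℤ ≤? ⟦ B ⟧ r) ×-dec (ρ m β ⟦ B ⟧ ≤? + 6)))))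

    -- By `no-two-tight` at most one arm is obstructed. Two unobstructed arms become edges, and the
    -- remaining one plays the part of `v₃`.
    three-arms : ∀ {v₁ x₁ z₁ v₂ x₂ z₂ v₃ x₃ z₃} → Arm v₁ x₁ z₁ → Arm v₂ x₂ z₂ → Arm v₃ x₃ z₃ →
      v₁ ≢ v₂ → v₁ ≢ v₃ → v₂ ≢ v₃ → Row₄ v₁ v₂ v₃ → (∀ {u} → u ∈ S → y ≢ u → v₁ ≢ u → v₂ ≢ u → v₃ ≢ u → u ∈ Z) →
      Colorable m β S
    three-arms {v₁} {x₁} {z₁} {v₂} {x₂} {z₂} {v₃} {x₃} {z₃} a₁ a₂ a₃ n₁₂ n₁₃ n₂₃ row-y Z⊇ = go (tight? x₁ z₁) (tight? x₂ z₂) (tight? x₃ z₃)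
      where
      swap : ∀ a b c d → a + b + c + d ≡ a + c + b + d
      swap = solve-∀
      cycle : ∀ a b c d → a + b + c + d ≡ b + c + a + d
      cycle = solve-∀
      module T₁₂ = Two a₁ a₂ a₃ n₁₂ n₁₃ n₂₃ row-y
      module T₁₃ = Two a₁ a₃ a₂ n₁₃ n₁₂ (n₂₃ ∘ sym) (λ B B⊆ → trans (row-y B B⊆) (swap (⟦ B ⟧ v₁) (⟦ B ⟧ v₂) (⟦ B ⟧ v₃) (⟦ B ⟧ r)))
      module T₂₃ = Two a₂ a₃ a₁ n₂₃ (n₁₂ ∘ sym) (n₁₃ ∘ sym) (λ B B⊆ → trans (row-y B B⊆) (cycle (⟦ B ⟧ v₁) (⟦ B ⟧ v₂) (⟦ B ⟧ v₃) (⟦ B ⟧ r)))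
      go : _ → _ → _ → Colorable m β S
      go (inj₂ l₁) (inj₂ l₂) _ = T₁₂.quartic l₁ l₂ Z⊇
      go (inj₂ l₁) (inj₁ _) (inj₂ l₃) = T₁₃.quartic l₁ l₃ (λ p q a b c → Z⊇ p q a c b)
      go (inj₁ _) (inj₂ l₂) (inj₂ l₃) = T₂₃.quartic l₂ l₃ (λ p q a b c → Z⊇ p q c a b)
      go (inj₁ (B , s , two , x , z , p , le)) (inj₁ (C , s′ , _ , x′ , z′ , p′ , le′)) _ = ⊥-elim (T₁₂.no-two-tight s s′ two x z p le x′ z′ p′ le′)
      go (inj₁ (B , s , two , x , z , p , le)) (inj₂ _) (inj₁ (C , s′ , _ , x′ , z′ , p′ , le′)) = ⊥-elim (T₁₃.no-two-tight s s′ two x z p le x′ z′ p′ le′)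
      go (inj₂ _) (inj₁ (B , s , two , x , z , p , le)) (inj₁ (C , s′ , _ , x′ , z′ , p′ , le′)) = ⊥-elim (T₂₃.no-two-tight s s′ two x z p le x′ z′ p′ le′)

-- Light neighbours of vertices of negative charge

overfull : ∀ a b c d → 1ℤ ≤ a → 1ℤ ≤ b → 0ℤ ≤ c → 0ℤ ≤ d → a + b + c + d ≤ 1ℤ → 1ℤ ≤ 0ℤ
overfull a b c d p q r s t = lin (p ⊕ q ⊕ r ⊕ s ⊕ t) (solve (a ∷ b ∷ c ∷ d ∷ []))

swap : ∀ a b c d → a + b + c + d ≡ a + c + b + d
swap = solve-∀

cycle : ∀ a b c d → a + b + c + d ≡ b + c + a + d
cycle = solve-∀

module LightDegrees {N : ℕ} (m : Mult N) {β : Fin N → ℤ} (load : DegreeOne.IsLoad {N} β) {S : VSet N} (sparse : DegreeOne.Sparse m β S) (below : DegreeOne.Below S)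
  (gap : DegreeOne.Gap m β S (+ 4)) where
  open DegreeOne {N}
  open Mult m
  open QuarticReduction m load sparse below gap public

  T₀⊆S : T₀ ⊆ S
  T₀⊆S u p = proj₁ (T₀⁻ p)

  light-degree : Fin N → ℤ
  light-degree y = row μ y ⟦ T₀ ⟧

  self : (v : Fin N) → 1ℤ ≤ δ v v
  self v = ≤-reflexive (sym (δ-refl v))

  meets : {u v : Fin N} → u ≡ v → 1ℤ ≤ δ u v
  meets {u} e = ≤-reflexive (sym (trans (cong (δ u) (sym e)) (δ-refl u)))

  module WithTris (tris : ∀ v → v ∈ T₀ → ∃[ x ] ∃[ y ] ∃[ z ] Tri v x y z) where

    module LightNeighbours {y} (y∈ : y ∈ S) (t≥3 : + 3 ≤ light-degree y) where

      Found : Set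
      Found = ∃[ v₁ ] ∃[ v₂ ] ∃[ v₃ ] v₁ ∈ T₀ × v₂ ∈ T₀ × v₃ ∈ T₀ × ∃[ f ] (∀ u → 0ℤ ≤ f u) ×
        (∀ B → B ⊆ S → row μ y ⟦ B ⟧ ≡ ⟦ B ⟧ v₁ + ⟦ B ⟧ v₂ + ⟦ B ⟧ v₃ + dot ⟦ B ⟧ f)

      found : Found
      found = unpack (peels 3 T₀ (nbrs≥0 y) (subst (+ 3 ≤_) (sym (dot-nbrs y T₀ T₀⊆S)) t≥3))
        where
        assoc : ∀ a b c d → a + (b + (c + 0ℤ)) + d ≡ a + b + c + d
        assoc = solve-∀
        unpack : (∃[ us ] All (_∈ T₀) us × ∃[ f ] (∀ u → 0ℤ ≤ f u) × (∀ a → dot a (nbrs y) ≡ sumAt {k = 3} a us + dot a f)) → Found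
        unpack (v₁ Vec.∷ v₂ Vec.∷ v₃ Vec.∷ Vec.[] , p All.∷ q All.∷ r All.∷ All.[] , f , f≥0 , eq) = v₁ , v₂ , v₃ , p , q , r , f , f≥0 ,
          λ B B⊆ → trans (sym (dot-nbrs y B B⊆)) (trans (eq ⟦ B ⟧) (assoc (⟦ B ⟧ v₁) (⟦ B ⟧ v₂) (⟦ B ⟧ v₃) (dot ⟦ B ⟧ f)))

      module _ {v₁ v₂ v₃} (v₁∈ : v₁ ∈ T₀) (v₂∈ : v₂ ∈ T₀) (v₃∈ : v₃ ∈ T₀) {f : Fin N → ℤ} (f≥0 : ∀ u → 0ℤ ≤ f u)
        (split : ∀ B → B ⊆ S → row μ y ⟦ B ⟧ ≡ ⟦ B ⟧ v₁ + ⟦ B ⟧ v₂ + ⟦ B ⟧ v₃ + dot ⟦ B ⟧ f) where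

        μ-split : ∀ {u} → u ∈ S → μ y u ≡ δ u v₁ + δ u v₂ + δ u v₃ + f u
        μ-split {u} u∈ = trans (sym (row-δ μ y u)) (trans (row-cong μ y (λ w → sym (⟦⁅⁆⟧ u w)))
          (trans (split (∅ ⁺ u) (λ w p → subst (_∈ S) (∈-⁅⁆ p) u∈)) (cong₂ _+_ (cong₂ _+_ (cong₂ _+_ (⟦⁅⁆⟧ u v₁) (⟦⁅⁆⟧ u v₂)) (⟦⁅⁆⟧ u v₃))
            (trans (dot-cong {f = f} (⟦⁅⁆⟧ u) (λ _ → refl)) (dot-δ u f)))))

        simple : ∀ {u} → u ∈ T₀ → μ y u ≤ 1ℤ
        simple {u} u∈ = let _ , _ , _ , t = tris u u∈ in subst (_≤ 1ℤ) (μ-sym u y) (tri-simple t y∈)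

        bits : ∀ {u} → u ∈ T₀ → δ u v₁ + δ u v₂ + δ u v₃ + f u ≤ 1ℤ
        bits {u} u∈ = subst (_≤ 1ℤ) (μ-split (T₀⊆S u u∈)) (simple u∈)

        -- Light vertices have no parallel edges, so the same vertex cannot have been drawn twice.
        v₁≢v₂ : v₁ ≢ v₂
        v₁≢v₂ e = 1≰0 (overfull (δ v₁ v₁) (δ v₁ v₂) (δ v₁ v₃) (f v₁) (self v₁) (meets e) (χ≥0 (v₁ == v₃)) (f≥0 v₁) (bits v₁∈))

        v₁≢v₃ : v₁ ≢ v₃
        v₁≢v₃ e = 1≰0 (overfull (δ v₁ v₁) (δ v₁ v₃) (δ v₁ v₂) (f v₁) (self v₁) (meets e) (χ≥0 (v₁ == v₂)) (f≥0 v₁)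
          (subst (_≤ 1ℤ) (swap (δ v₁ v₁) (δ v₁ v₂) (δ v₁ v₃) (f v₁)) (bits v₁∈)))

        v₂≢v₃ : v₂ ≢ v₃
        v₂≢v₃ e = 1≰0 (overfull (δ v₂ v₂) (δ v₂ v₃) (δ v₂ v₁) (f v₂) (self v₂) (meets e) (χ≥0 (v₂ == v₁)) (f≥0 v₂)
          (subst (_≤ 1ℤ) (cycle (δ v₂ v₁) (δ v₂ v₂) (δ v₂ v₃) (f v₂)) (bits v₂∈)))

        tri-y : ∀ {v} → v ∈ T₀ → 1ℤ ≤ δ v v₁ + δ v v₂ + δ v v₃ + f v → ∃[ x ] ∃[ z ] Tri v y x z
        tri-y {v} v∈ le = let _ , _ , _ , t = tris v v∈ in tri-at t y∈ (subst (1ℤ ≤_) (trans (sym (μ-split (T₀⊆S v v∈))) (μ-sym y v)) le)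

        private
          pad : ∀ v {a b c} → 1ℤ ≤ a ⊎ 1ℤ ≤ b ⊎ 1ℤ ≤ c → 0ℤ ≤ a → 0ℤ ≤ b → 0ℤ ≤ c → 1ℤ ≤ a + b + c + f v
          pad v (inj₁ p) a b c = padʳ (padʳ (padʳ p b) c) (f≥0 v)
          pad v (inj₂ (inj₁ p)) a b c = padʳ (padʳ (padˡ a p) c) (f≥0 v)
          pad v (inj₂ (inj₂ p)) a b c = padʳ (padˡ (a ⊕ b) p) (f≥0 v)

        tri₁ : ∃[ x ] ∃[ z ] Tri v₁ y x z
        tri₁ = tri-y v₁∈ (pad v₁ (inj₁ (self v₁)) (χ≥0 (v₁ == v₁)) (χ≥0 (v₁ == v₂)) (χ≥0 (v₁ == v₃)))
        tri₂ : ∃[ x ] ∃[ z ] Tri v₂ y x z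
        tri₂ = tri-y v₂∈ (pad v₂ (inj₂ (inj₁ (self v₂))) (χ≥0 (v₂ == v₁)) (χ≥0 (v₂ == v₂)) (χ≥0 (v₂ == v₃)))
        tri₃ : ∃[ x ] ∃[ z ] Tri v₃ y x z
        tri₃ = tri-y v₃∈ (pad v₃ (inj₂ (inj₂ (self v₃))) (χ≥0 (v₃ == v₁)) (χ≥0 (v₃ == v₂)) (χ≥0 (v₃ == v₃)))

        rest : ∀ k → row μ y ⟦ S ⟧ ≡ + 3 + k → dot ⟦ S ⟧ f ≡ k
        rest k deg = cancel (dot ⟦ S ⟧ f) k (trans (sym (trans (split S λ _ p → p) (cong (_+ dot ⟦ S ⟧ f) (cong₂ _+_ (cong₂ _+_ (⟦⟧-∈ (T₀⊆S v₁ v₁∈)) (⟦⟧-∈ (T₀⊆S v₂ v₂∈))) (⟦⟧-∈ (T₀⊆S v₃ v₃∈)))))) deg)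
          where
          cancel : ∀ a k → + 3 + a ≡ + 3 + k → a ≡ k
          cancel a k p = trans (shift a) (trans (cong (_- + 3) p) (sym (shift k)))
            where
            shift : ∀ a → a ≡ + 3 + a - + 3
            shift = solve-∀

        color-cubic : β y ≡ 1ℤ → row μ y ⟦ S ⟧ ≡ + 3 → Colorable m β S
        color-cubic βy deg = let _ , _ , t = tri₁ in
          Cubic.cubic y∈ βy (λ B B⊆ → trans (split B B⊆) (trans (cong (_+_ (⟦ B ⟧ v₁ + ⟦ B ⟧ v₂ + ⟦ B ⟧ v₃)) (vanishing f≥0 (≤-reflexive (rest 0ℤ deg)) B B⊆)) (+-identityʳ (⟦ B ⟧ v₁ + ⟦ B ⟧ v₂ + ⟦ B ⟧ v₃))))
            v₁∈ (T₀⊆S v₂ v₂∈) (T₀⊆S v₃ v₃∈) v₂≢v₃ t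

        color-quartic : β y ≡ 0ℤ → row μ y ⟦ S ⟧ ≡ + 4 → Colorable m β S
        color-quartic βy deg = go (neighbours 1 f≥0 (rest 1ℤ deg))
          where
          go : (∃[ us ] All (_∈ S) us × (∀ B → B ⊆ S → dot ⟦ B ⟧ f ≡ sumAt {k = 1} ⟦ B ⟧ us)) → Colorable m β S
          go (r Vec.∷ Vec.[] , r∈ All.∷ All.[] , eq) =
            let _ , _ , t₁ = tri₁
                _ , _ , t₂ = tri₂
                _ , _ , t₃ = tri₃
            in Quartic.three-arms y∈ βy r∈ Z (λ u p → ∈-−ˡ (∈-−ˡ (∈-−ˡ (∈-−ˡ p)))) (∉-⊆ {B = S − y} (λ u p → ∈-−ˡ (∈-−ˡ (∈-−ˡ p))) ∉-−)
              (record { tri = t₁ ; v∈T = v₁∈ ; v∉Z = ∉-⊆ {B = S − y − v₁} (λ u p → ∈-−ˡ (∈-−ˡ p)) ∉-− })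
              (record { tri = t₂ ; v∈T = v₂∈ ; v∉Z = ∉-⊆ {B = S − y − v₁ − v₂} (λ u p → ∈-−ˡ p) ∉-− })
              (record { tri = t₃ ; v∈T = v₃∈ ; v∉Z = ∉-− })
              v₁≢v₂ v₁≢v₃ v₂≢v₃ (λ B B⊆ → trans (split B B⊆) (cong (_+_ (⟦ B ⟧ v₁ + ⟦ B ⟧ v₂ + ⟦ B ⟧ v₃)) (trans (eq B B⊆) (+-identityʳ (⟦ B ⟧ r)))))
              (λ p q a b c → ∈-−⁺ (∈-−⁺ (∈-−⁺ (∈-−⁺ p q) a) b) c)
            where
            Z = S − y − v₁ − v₂ − v₃

      color-light-neighbours : β y ≡ 0ℤ × row μ y ⟦ S ⟧ ≡ + 4 ⊎ β y ≡ 1ℤ × row μ y ⟦ S ⟧ ≡ + 3 → Colorable m β S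
      color-light-neighbours h = let _ , _ , _ , p , q , r , _ , f≥0 , split = found in case h of λ
        { (inj₁ (βy , deg)) → color-quartic p q r f≥0 split βy deg
        ; (inj₂ (βy , deg)) → color-cubic p q r f≥0 split βy deg }

    -- A violation means 2 (7 - 2β - 2d) + t ≥ 1, where t ≤ d counts the edges to light vertices.
    -- With charge at most -1 this leaves d = 4 for load 0 and d = 3 for load 1, both with t ≥ 3,
    -- and nothing for load 2. The two survivors are the quartic and the cubic reduction.
    heavy : ∀ y → y ∈ S → ch y ≤ - 1ℤ → Colorable m β S ⊎ + 2 * ch y + light-degree y ≤ 0ℤ
    heavy y y∈ neg with + 2 * ch y + light-degree y ≤⊎> 0ℤ
    ... | inj₁ p = inj₂ p
    ... | inj₂ p = inj₁ (go (β y ≤⊎> 0ℤ) (β y ≤⊎> 1ℤ))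
      where
      d = row μ y ⟦ S ⟧
      t = light-degree y
      t≤d : t ≤ d
      t≤d = row-mono μ≥0 y (⟦⟧-mono T₀⊆S)
      exactly : ∀ {k} d → ¬ (k + 1ℤ ≤ d) → ¬ (d + 1ℤ ≤ k) → d ≡ k
      exactly {k} d ¬p ¬q = ≤-antisym (case d ≤⊎> k of λ { (inj₁ h) → h ; (inj₂ h) → ⊥-elim (¬p h) }) (case k ≤⊎> d of λ { (inj₁ h) → h ; (inj₂ h) → ⊥-elim (¬q h) })
      go : β y ≤ 0ℤ ⊎ 0ℤ + 1ℤ ≤ β y → β y ≤ 1ℤ ⊎ 1ℤ + 1ℤ ≤ β y → Colorable m β S
      go (inj₁ b≤0) _ = LightNeighbours.color-light-neighbours y∈ (t₃ (β y) d t (proj₁ (load y)) four p) (inj₁ (≤-antisym b≤0 (proj₁ (load y)) , four))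
        where
        hi : ∀ b d t → 0ℤ ≤ b → t ≤ d → 0ℤ + 1ℤ ≤ + 2 * (+ 7 - + 2 * b - + 2 * d) + t → ¬ (+ 5 ≤ d)
        hi b d t q s u v = 1≰0 (lin (q ⊕ q ⊕ q ⊕ q ⊕ s ⊕ u ⊕ v ⊕ v ⊕ v ⊕ 0≤+ 1) (solve (b ∷ d ∷ t ∷ [])))
        lo : ∀ b d → b ≤ 0ℤ → + 7 - + 2 * b - + 2 * d ≤ - 1ℤ → ¬ (d + 1ℤ ≤ + 4)
        lo b d q s u = 1≰0 (lin (q ⊕ q ⊕ s ⊕ u ⊕ u ⊕ 0≤+ 1) (solve (b ∷ d ∷ [])))
        four : d ≡ + 4
        four = exactly d (hi (β y) d t (proj₁ (load y)) t≤d p) (lo (β y) d b≤0 neg)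
        t₃ : ∀ b d t → 0ℤ ≤ b → d ≡ + 4 → 0ℤ + 1ℤ ≤ + 2 * (+ 7 - + 2 * b - + 2 * d) + t → + 3 ≤ t
        t₃ b _ t q refl s = lin (q ⊕ q ⊕ q ⊕ q ⊕ s) (solve (b ∷ t ∷ []))
      go (inj₂ b≥1) (inj₁ b≤1) = LightNeighbours.color-light-neighbours y∈ (t₃ (β y) d t b≥1 three′ p) (inj₂ (≤-antisym b≤1 b≥1 , three′))
        where
        hi : ∀ b d t → 0ℤ + 1ℤ ≤ b → t ≤ d → 0ℤ + 1ℤ ≤ + 2 * (+ 7 - + 2 * b - + 2 * d) + t → ¬ (+ 4 ≤ d)
        hi b d t q s u v = 1≰0 (lin (q ⊕ q ⊕ q ⊕ q ⊕ s ⊕ u ⊕ v ⊕ v ⊕ v ⊕ 0≤+ 2) (solve (b ∷ d ∷ t ∷ [])))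
        lo : ∀ b d → b ≤ 1ℤ → + 7 - + 2 * b - + 2 * d ≤ - 1ℤ → ¬ (d + 1ℤ ≤ + 3)
        lo b d q s u = 1≰0 (lin (q ⊕ q ⊕ s ⊕ u ⊕ u ⊕ 0≤+ 1) (solve (b ∷ d ∷ [])))
        three′ : d ≡ + 3
        three′ = exactly d (hi (β y) d t b≥1 t≤d p) (lo (β y) d b≤1 neg)
        t₃ : ∀ b d t → 0ℤ + 1ℤ ≤ b → d ≡ + 3 → 0ℤ + 1ℤ ≤ + 2 * (+ 7 - + 2 * b - + 2 * d) + t → + 3 ≤ t
        t₃ b _ t q refl s = lin (q ⊕ q ⊕ q ⊕ q ⊕ s) (solve (b ∷ t ∷ []))
      go (inj₂ _) (inj₂ b≥2) = ⊥-elim (1≰0 (arith (β y) d t b≥2 (proj₂ (load y)) t≤d neg p))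
        where
        arith : ∀ b d t → 1ℤ + 1ℤ ≤ b → b ≤ + 2 → t ≤ d → + 7 - + 2 * b - + 2 * d ≤ - 1ℤ → 0ℤ + 1ℤ ≤ + 2 * (+ 7 - + 2 * b - + 2 * d) + t → 1ℤ ≤ 0ℤ
        arith b d t p q s u v = lemma (two d (lin (q ⊕ q ⊕ u) (solve (b ∷ d ∷ []))))
          where
          two : ∀ d → + 4 ≤ + 2 * d → + 2 ≤ d
          two d h = case + 2 ≤⊎> d of λ { (inj₁ k) → k ; (inj₂ k) → ⊥-elim (1≰0 (lin (h ⊕ k ⊕ k ⊕ 0≤+ 1) (solve (d ∷ [])))) }
          lemma : + 2 ≤ d → 1ℤ ≤ 0ℤ
          lemma h = lin (p ⊕ p ⊕ p ⊕ p ⊕ s ⊕ v ⊕ h ⊕ h ⊕ h) (solve (b ∷ d ∷ t ∷ []))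

-- The final count

module Numbers where

  -- Here `τ` counts the light vertices, `c` is the total charge of the others, and `l` the number
  -- of edges between both kinds. From 2c ≤ -3τ and τ + c ≥ -1 it follows that -2 ≤ 2τ + 2c ≤ -τ.
  τ≤2 : ∀ r τ c l → r ≡ τ + c → l ≡ + 3 * τ → + 2 * c + l ≤ 0ℤ → - 1ℤ ≤ r → τ ≤ + 2
  τ≤2 r τ c l p q i j = lin (≤-reflexive p ⊕ ≤-reflexive p ⊕ ≤-reflexive (sym q) ⊕ i ⊕ j ⊕ j) (solve (r ∷ τ ∷ c ∷ l ∷ []))

  c≥-3 : ∀ r τ c → r ≡ τ + c → τ ≤ + 2 → - 1ℤ ≤ r → - + 3 ≤ c
  c≥-3 r τ c p q j = lin (≤-reflexive p ⊕ q ⊕ j) (solve (r ∷ τ ∷ c ∷ []))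

  σ≤3 : ∀ c σ → c ≤ - 1ℤ * σ → - + 3 ≤ c → σ ≤ + 3
  σ≤3 c σ p q = lin (p ⊕ q) (solve (c ∷ σ ∷ []))

  τ≥2 : ∀ r τ c σ → r ≡ τ + c → - 1ℤ ≤ r → c ≤ - 1ℤ * σ → + 3 ≤ σ → + 2 ≤ τ
  τ≥2 r τ c σ p j k l = lin (≤-reflexive p ⊕ j ⊕ k ⊕ l) (solve (r ∷ τ ∷ c ∷ σ ∷ []))

  two-left : ∀ b e t → + 7 - + 2 * b - + 2 * (t + e) ≡ - 1ℤ → t ≡ + 2 → b + e ≡ + 2
  two-left b e _ p refl = ≤-antisym (halve (b + e) (+ 2) (lin (≤-reflexive (sym p)) (solve (b ∷ e ∷ []))))
                                    (halve (+ 2) (b + e) (lin (≤-reflexive p) (solve (b ∷ e ∷ []))))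
    where
    halve : ∀ a k → + 2 * a ≤ + 2 * k → a ≤ k
    halve a k h = *-cancelˡ-≤-pos a k (+ 2) h

  all-one : ∀ b e f → b + (e + f) ≡ + 2 → 1ℤ ≤ e → 1ℤ ≤ f → e + b ≤ 1ℤ
  all-one b e f p q r = lin (≤-reflexive p ⊕ r) (solve (b ∷ e ∷ f ∷ []))

  zero-edge : ∀ a b → a ≤ 0ℤ → b ≤ 1ℤ → a + b ≤ 1ℤ
  zero-edge a b p q = lin (p ⊕ q) (solve (a ∷ b ∷ []))

module FinalCount {N : ℕ} (m : Mult N) {β : Fin N → ℤ} (load : DegreeOne.IsLoad {N} β) {S : VSet N} (sparse : DegreeOne.Sparse m β S) (below : DegreeOne.Below S)
  (gap : DegreeOne.Gap m β S (+ 4)) where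
  open DegreeOne {N}
  open Mult m
  open LightDegrees m load sparse below gap public

  module Counting (tris : ∀ v → v ∈ T₀ → ∃[ x ] ∃[ y ] ∃[ z ] Tri v x y z)
    (neg : ∀ y → y ∈ S ∖ T₀ → ch y ≤ - 1ℤ) (heavy : ∀ y → y ∈ S ∖ T₀ → + 2 * ch y + light-degree y ≤ 0ℤ) where

    Y : VSet N
    Y = S ∖ T₀

    light-row : ∀ {v B} → v ∈ T₀ → B ⊆ T₀ → row μ v ⟦ B ⟧ ≡ 0ℤ
    light-row {v} {B} v∈ B⊆ = let _ , _ , _ , t = tris v v∈ in
      trans (Tri.row₃ t B (λ u p → T₀⊆S u (B⊆ u p))) (cong₂ _+_ (cong₂ _+_ (⟦⟧-∉ (∉-⊆ B⊆ (Tri.x∉ t))) (⟦⟧-∉ (∉-⊆ B⊆ (Tri.y∉ t)))) (⟦⟧-∉ (∉-⊆ B⊆ (Tri.z∉ t))))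

    light-quad : ∀ {B} → B ⊆ T₀ → quad μ ⟦ B ⟧ ⟦ B ⟧ ≡ 0ℤ
    light-quad {B} B⊆ = trans (quad-dot μ ⟦ B ⟧ ⟦ B ⟧) (trans (dot-cong-∈ {B = B} λ u u∈ → light-row (B⊆ u u∈) B⊆) (dot-size B 0ℤ))

    -- Light vertices are pairwise non-adjacent and have no parallel edges, so only simple edges at
    -- `k` remain.
    star : ∀ {k} → k ∈ S → Acyclic μ (T₀ ⁺ k)
    star {k} k∈ B B⊆ u u∈ = case k ∈? B of λ
      { (inj₁ k∈B) → subst₂ (λ s t → s + + 2 ≤ + 2 * t) (sym (trans (quad-remove m k∈B) (cong (_+ + 2 * row μ k ⟦ B − k ⟧) (light-quad B−k⊆)))) (sym (size-remove k∈B))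
          (arith₁ (row μ k ⟦ B − k ⟧) (size (B − k)) (subst₂ _≤_ (sym (row-dot μ k ⟦ B − k ⟧)) (trans (dot-size (B − k) 1ℤ) (*-identityˡ (size (B − k))))
            (dot-mono-∈ {B = B − k} λ w w∈ → let _ , _ , _ , t = tris w (B−k⊆ w w∈) in subst (_≤ 1ℤ) (μ-sym w k) (tri-simple t k∈))))
      ; (inj₂ k∉B) → subst (λ s → s + + 2 ≤ + 2 * size B) (sym (light-quad λ w w∈ → case ∈-⁺⁻ (B⊆ w w∈) of λ { (inj₁ refl) → ∈-contra w∈ k∉B ; (inj₂ p) → p })) (arith₂ (size B) (size-nonempty u∈)) }
      where
      B−k⊆ : B − k ⊆ T₀
      B−k⊆ w p = case ∈-⁺⁻ (B⊆ w (∈-−ˡ p)) of λ { (inj₁ e) → ⊥-elim (∈-−ʳ p e) ; (inj₂ q) → q }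
      arith₁ : ∀ a s → a ≤ s → 0ℤ + + 2 * a + + 2 ≤ + 2 * (s + 1ℤ)
      arith₁ a s p = lin (p ⊕ p) (solve (a ∷ s ∷ []))
      arith₂ : ∀ s → 1ℤ ≤ s → 0ℤ + + 2 ≤ + 2 * s
      arith₂ s p = lin (p ⊕ p) (solve (s ∷ []))

    -- `i` and `j` form M, joined by at most one edge. Everything else is `k` and light vertices, a
    -- forest by `star`.
    color-pair : ∀ {i j k} → i ∈ S → j ∈ S → k ∈ S → (∀ u → u ∈ Y → i ≡ u ⊎ j ≡ u ⊎ k ≡ u) →
      μ i j + β i ≤ 1ℤ → μ i j + β j ≤ 1ℤ → Colorable m β S
    color-pair {i} {j} {k} i∈ j∈ k∈ cover le-i le-j = c , record { forestM = acM ; forestF = acyclic-mono F⊆ (star k∈) ; degree = deg }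
      where
      c = ∅ ⁺ i ⁺ j
      μ≤1 : μ j i ≤ 1ℤ
      μ≤1 = subst (_≤ 1ℤ) (μ-sym i j) (≤-trans (padʳ ≤-refl (proj₁ (load i))) le-i)
      ac-i : Acyclic μ (∅ ⁺ i)
      ac-i = acyclic-leaf m {P = ∅} i (λ B B⊆ u u∈ → case B⊆ u u∈ of λ { (mem ()) }) (λ u p i≢u → ⊥-elim (i≢u (∈-⁅⁆ p))) (≤-trans (≤-reflexive (row-empty μ i {∅} λ _ → nmem refl)) (0≤+ 1))
      acM : Acyclic μ (S ∩ c)
      acM = acyclic-leaf m j ac-i (λ u p j≢u → case ∈-⁺⁻ (∈-∩ʳ p) of λ { (inj₁ e) → ⊥-elim (j≢u e) ; (inj₂ q) → q })
        (subst (_≤ 1ℤ) (sym (trans (row-cong μ j (⟦⁅⁆⟧ i)) (row-δ μ j i))) μ≤1)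
      F⊆ : S ∖ c ⊆ T₀ ⁺ k
      F⊆ u p = case u ∈? T₀ of λ
        { (inj₁ q) → ∈-⁺ˡ q
        ; (inj₂ q) → case cover u (∈-∖⁺ (∈-∖ˡ p) q) of λ
          { (inj₁ refl) → ∈-contra (∈-⁺ˡ ∈-⁺≡) (∈-∖ʳ p)
          ; (inj₂ (inj₁ refl)) → ∈-contra ∈-⁺≡ (∈-∖ʳ p)
          ; (inj₂ (inj₂ refl)) → ∈-⁺≡ } }
      c≤ : ∀ u → ⟦ S ∩ c ⟧ u ≤ (δ i ⊞ δ j) u
      c≤ u = ≤-trans (⟦⟧-mono {A = S ∩ c} {c} (λ w p → ∈-∩ʳ p) u) (case i ≟ u of λ
        { (yes refl) → ≤-trans (χ≤1 (c u)) (padʳ (self u) (χ≥0 (j == u)))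
        ; (no i≢u) → case j ≟ u of λ
          { (yes refl) → ≤-trans (χ≤1 (c u)) (padˡ (χ≥0 (i == u)) (self u))
          ; (no j≢u) → subst (_≤ δ i u + δ j u) (sym (⟦⟧-∉ (∉-⁺ j≢u (∉-⁺ i≢u (nmem {A = ∅} refl))))) (χ≥0 (i == u) ⊕ χ≥0 (j == u)) } })
      row≤ : ∀ u → row μ u ⟦ S ∩ c ⟧ ≤ μ u i + μ u j
      row≤ u = subst (row μ u ⟦ S ∩ c ⟧ ≤_) (trans (row-+ μ u (δ i) (δ j)) (cong₂ _+_ (row-δ μ u i) (row-δ μ u j))) (row-mono μ≥0 u c≤)
      deg : ∀ u → u ∈ S → u ∈ c → row μ u ⟦ S ∩ c ⟧ + β u ≤ 1ℤ
      deg u _ u∈c = case ∈-⁺⁻ u∈c of λ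
        { (inj₁ refl) → ≤-trans (+-monoˡ-≤ (β u) (row≤ u)) (subst (λ t → t + β u ≤ 1ℤ) (sym (trans (cong₂ _+_ (μ-sym u i) (μ-irr u)) (+-identityʳ (μ i u)))) le-j)
        ; (inj₂ q) → case ∈-⁅⁆ q of λ { refl → ≤-trans (+-monoˡ-≤ (β u) (row≤ u)) (subst (λ t → t + β u ≤ 1ℤ) (sym (trans (cong (_+ μ u j) (μ-irr u)) (+-identityˡ (μ u j)))) le-i) } }

    τ σ C L : ℤ
    τ = size T₀
    σ = size Y
    C = dot ⟦ Y ⟧ ch
    L = dot ⟦ Y ⟧ light-degree

    S-split : ∀ u → ⟦ S ⟧ u ≡ (⟦ T₀ ⟧ ⊞ ⟦ Y ⟧) u
    S-split = ⟦⟧-split T₀⊆S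

    ρ≡ : ρ m β ⟦ S ⟧ ≡ τ + C
    ρ≡ = trans (ρ-charge m β S) (trans (dot-cong {f = ch} S-split (λ _ → refl)) (trans (dot-+ˡ ⟦ T₀ ⟧ ⟦ Y ⟧ ch)
      (cong (_+ C) (trans (dot-cong-∈ {B = T₀} λ v v∈ → cong₂ (λ b d → + 7 - + 2 * b - + 2 * d) (proj₂ (proj₂ (T₀⁻ v∈))) (proj₁ (proj₂ (T₀⁻ v∈)))) (trans (dot-size T₀ 1ℤ) (*-identityˡ τ))))))

    L≡ : L ≡ + 3 * τ
    L≡ = trans (sym (quad-dot μ ⟦ Y ⟧ ⟦ T₀ ⟧)) (trans (quad-sym μ μ-sym ⟦ Y ⟧ ⟦ T₀ ⟧) (trans (quad-dot μ ⟦ T₀ ⟧ ⟦ Y ⟧) (trans (dot-cong-∈ {B = T₀} to-Y) (dot-size T₀ (+ 3)))))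
      where
      to-Y : ∀ v → v ∈ T₀ → row μ v ⟦ Y ⟧ ≡ + 3
      to-Y v v∈ = let _ , _ , _ , t = tris v v∈ in
        trans (Tri.row₃ t Y (λ u → ∈-∖ˡ)) (cong₂ _+_ (cong₂ _+_ (⟦⟧-∈ (∈-∖⁺ (Tri.x∈ t) (Tri.x∉ t))) (⟦⟧-∈ (∈-∖⁺ (Tri.y∈ t) (Tri.y∉ t)))) (⟦⟧-∈ (∈-∖⁺ (Tri.z∈ t) (Tri.z∉ t))))

    2C+L : dot ⟦ Y ⟧ (λ y → + 2 * ch y + light-degree y) ≡ + 2 * C + L
    2C+L = trans (dot-+ʳ ⟦ Y ⟧ (λ y → + 2 * ch y) light-degree) (cong (_+ L) (dot-*ʳ ⟦ Y ⟧ ch (+ 2)))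

    2C+L≤0 : + 2 * C + L ≤ 0ℤ
    2C+L≤0 = subst₂ _≤_ 2C+L (dot-size Y 0ℤ) (dot-mono-∈ heavy)

    C≤ : C ≤ - 1ℤ * σ
    C≤ = subst (C ≤_) (dot-size Y (- 1ℤ)) (dot-mono-∈ neg)

    -- The count leaves only two light vertices with the same three neighbours.
    finish : ∀ {v x y z} → v ∈ T₀ → Tri v x y z → Colorable m β S
    finish {v} {x} {y} {z} v∈ t = go
      where
      open Tri t
      open Numbers
      x∈Y = ∈-∖⁺ x∈ x∉
      y∈Y = ∈-∖⁺ y∈ y∉
      z∈Y = ∈-∖⁺ z∈ z∉
      y∈′ : y ∈ Y − x
      y∈′ = ∈-−⁺ y∈Y x≢y
      z∈′ : z ∈ Y − x − y
      z∈′ = ∈-−⁺ (∈-−⁺ z∈Y (z≢x ∘ sym)) y≢z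
      Y₀ = Y − x − y − z
      σ≡ : σ ≡ size Y₀ + 1ℤ + 1ℤ + 1ℤ
      σ≡ = trans (size-remove x∈Y) (cong (_+ 1ℤ) (trans (size-remove y∈′) (cong (_+ 1ℤ) (size-remove z∈′))))
      ρ≥ : - 1ℤ ≤ ρ m β ⟦ S ⟧
      ρ≥ = -1≤ρ x∈
      τ≤ : τ ≤ + 2
      τ≤ = τ≤2 (ρ m β ⟦ S ⟧) τ C L ρ≡ L≡ 2C+L≤0 ρ≥
      C≥ : - + 3 ≤ C
      C≥ = c≥-3 (ρ m β ⟦ S ⟧) τ C ρ≡ τ≤ ρ≥
      Y₀-empty : ∀ u → u ∉ Y₀
      Y₀-empty u = case u ∈? Y₀ of λ
        { (inj₂ q) → q
        ; (inj₁ p) → ⊥-elim (1≰0 (arith (size Y₀) (size-nonempty p) (subst (_≤ + 3) σ≡ (σ≤3 C σ C≤ C≥)))) }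
        where
        arith : ∀ s → 1ℤ ≤ s → s + 1ℤ + 1ℤ + 1ℤ ≤ + 3 → 1ℤ ≤ 0ℤ
        arith s p q = lin (p ⊕ q) (solve (s ∷ []))
      σ₃ : σ ≡ + 3
      σ₃ = trans σ≡ (cong (λ s → s + 1ℤ + 1ℤ + 1ℤ) (size-empty {B = Y₀} Y₀-empty))
      τ₂ : τ ≡ + 2
      τ₂ = ≤-antisym τ≤ (τ≥2 (ρ m β ⟦ S ⟧) τ C σ ρ≡ ρ≥ C≤ (≤-reflexive (sym σ₃)))
      C₃ : C ≡ - + 3
      C₃ = ≤-antisym (subst (λ s → C ≤ - 1ℤ * s) σ₃ C≤) C≥
      cover : ∀ u → u ∈ Y → x ≡ u ⊎ y ≡ u ⊎ z ≡ u
      cover u u∈ = case x ≟ u of λ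
        { (yes e) → inj₁ e
        ; (no p) → case y ≟ u of λ
          { (yes e) → inj₂ (inj₁ e)
          ; (no q) → case z ≟ u of λ
            { (yes e) → inj₂ (inj₂ e)
            ; (no r) → ∈-contra (∈-−⁺ (∈-−⁺ (∈-−⁺ u∈ p) q) r) (Y₀-empty u) } } }
      -- The summed inequalities turn out to be equalities, so the bounds are attained at every
      -- single vertex.
      zero-sum : ∀ {f : Fin N → ℤ} → (∀ u → u ∈ Y → f u ≤ 0ℤ) → dot ⟦ Y ⟧ f ≡ 0ℤ → ∀ u → u ∈ Y → f u ≡ 0ℤ
      zero-sum {f} f≤0 eq u u∈ = ≤-antisym (f≤0 u u∈) (arith (f u) (dot ⟦ Y ⟧ f) (subst (- 1ℤ * f u ≤_) (dot-*ʳ ⟦ Y ⟧ f (- 1ℤ)) (dot-∈ (λ w w∈ → neg-arith (f w) (f≤0 w w∈)) u u∈)) eq)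
        where
        neg-arith : ∀ a → a ≤ 0ℤ → 0ℤ ≤ - 1ℤ * a
        neg-arith a p = lin p (solve (a ∷ []))
        arith : ∀ a s → - 1ℤ * a ≤ - 1ℤ * s → s ≡ 0ℤ → 0ℤ ≤ a
        arith a s p q = lin (p ⊕ ≤-reflexive (sym q)) (solve (a ∷ s ∷ []))
      charge-one : ∀ u → u ∈ Y → ch u ≡ - 1ℤ
      charge-one u u∈ = trans (shift (ch u)) (cong (_- 1ℤ) (zero-sum (λ w w∈ → subst (_≤ 0ℤ) refl (lin′ (ch w) (neg w w∈))) total u u∈))
        where
        shift : ∀ a → a ≡ a + 1ℤ - 1ℤ
        shift = solve-∀
        lin′ : ∀ a → a ≤ - 1ℤ → a + 1ℤ ≤ 0ℤ
        lin′ a p = lin p (solve (a ∷ []))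
        total : dot ⟦ Y ⟧ (λ w → ch w + 1ℤ) ≡ 0ℤ
        total = trans (dot-+ʳ ⟦ Y ⟧ ch (λ _ → 1ℤ)) (cong₂ _+_ C₃ (trans (dot-size Y 1ℤ) (trans (*-identityˡ σ) σ₃)))
      light-two : ∀ u → u ∈ Y → light-degree u ≡ + 2
      light-two u u∈ = trans (shift (light-degree u)) (cong (_+ + 2) (trans (cong (λ s → + 2 * s + light-degree u) (sym (charge-one u u∈))) (zero-sum heavy (trans 2C+L (cong₂ (λ s l → + 2 * s + l) C₃ (trans L≡ (cong (_*_ (+ 3)) τ₂)))) u u∈)))
        where
        shift : ∀ a → a ≡ + 2 * - 1ℤ + a + + 2
        shift = solve-∀
      row-Y : ∀ u → row μ u ⟦ Y ⟧ ≡ μ u z + μ u y + μ u x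
      row-Y u = trans (drop x∈Y) (cong (_+ μ u x) (trans (drop y∈′) (cong (_+ μ u y) (trans (drop z∈′) (trans (cong (_+ μ u z) (row-empty μ u {Y₀} Y₀-empty)) (+-identityˡ (μ u z)))))))
        where
        drop : ∀ {A w} → w ∈ A → row μ u ⟦ A ⟧ ≡ row μ u ⟦ A − w ⟧ + μ u w
        drop {A} {w} w∈ = trans (row-cong μ u (⟦⟧-remove w∈)) (trans (row-+ μ u ⟦ A − w ⟧ (δ w)) (cong (_+_ (row μ u ⟦ A − w ⟧)) (row-δ μ u w)))
      balance : ∀ u → u ∈ Y → β u + row μ u ⟦ Y ⟧ ≡ + 2
      balance u u∈ = two-left (β u) (row μ u ⟦ Y ⟧) (light-degree u)
        (trans (cong (λ d → + 7 - + 2 * β u - + 2 * d) (sym (trans (row-cong μ u S-split) (row-+ μ u ⟦ T₀ ⟧ ⟦ Y ⟧)))) (charge-one u u∈)) (light-two u u∈)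
      go : Colorable m β S
      -- Two non-adjacent vertices among `x`, `y`, `z` can form M, their loads being at most 1. If
      -- all three pairs are adjacent, `balance` leaves a triangle of simple edges with no load, and
      -- any one of its edges may lie in M.
      go = case n≤0⊎1≤n (μ x y) of λ
        { (inj₁ p) → color-pair x∈ y∈ z∈ cover (zero-edge (μ x y) (β x) p x≤1) (zero-edge (μ x y) (β y) p y≤1)
        ; (inj₂ xy) → case n≤0⊎1≤n (μ x z) of λ
          { (inj₁ p) → color-pair x∈ z∈ y∈ (λ u u∈ → swap₂₃ (cover u u∈)) (zero-edge (μ x z) (β x) p x≤1) (zero-edge (μ x z) (β z) p z≤1)
          ; (inj₂ xz) → case n≤0⊎1≤n (μ y z) of λ
            { (inj₁ p) → color-pair y∈ z∈ x∈ (λ u u∈ → rot (cover u u∈)) (zero-edge (μ y z) (β y) p y≤1) (zero-edge (μ y z) (β z) p z≤1)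
            ; (inj₂ yz) → color-pair x∈ y∈ z∈ cover
                (all-one (β x) (μ x y) (μ x z) (trans (cong (_+_ (β x)) (trans (at-x (μ x z) (μ x y)) (trans (cong (_+_ (μ x z + μ x y)) (sym (μ-irr x))) (sym (row-Y x))))) (balance x x∈Y)) xy xz)
                (subst (λ s → s + β y ≤ 1ℤ) (μ-sym y x) (all-one (β y) (μ y x) (μ y z) (trans (cong (_+_ (β y)) (trans (at-y (μ y z) (μ y x)) (trans (cong (λ s → μ y z + s + μ y x) (sym (μ-irr y))) (sym (row-Y y))))) (balance y y∈Y)) (subst (1ℤ ≤_) (μ-sym x y) xy) yz)) } } }
        where
        at-x : ∀ a b → b + a ≡ a + b + 0ℤ
        at-x = solve-∀
        at-y : ∀ a b → b + a ≡ a + 0ℤ + b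
        at-y = solve-∀
        swap₂₃ : ∀ {A B C : Set} → A ⊎ B ⊎ C → A ⊎ C ⊎ B
        swap₂₃ (inj₁ a) = inj₁ a
        swap₂₃ (inj₂ (inj₁ b)) = inj₂ (inj₂ b)
        swap₂₃ (inj₂ (inj₂ c)) = inj₂ (inj₁ c)
        rot : ∀ {A B C : Set} → A ⊎ B ⊎ C → B ⊎ C ⊎ A
        rot (inj₁ a) = inj₂ (inj₂ a)
        rot (inj₂ (inj₁ b)) = inj₁ b
        rot (inj₂ (inj₂ c)) = inj₂ (inj₁ c)

    count : Colorable m β S
    count = case nonempty? T₀ of λ
      { (inj₁ (v , v∈)) → let _ , _ , _ , t = tris v v∈ in finish v∈ t
      ; (inj₂ e) → no-light λ v v∈ → neg v (∈-∖⁺ v∈ (e v)) }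

  light→T₀ : ∀ {v} → v ∈ S → Light v → v ∈ T₀
  light→T₀ {v} v∈ (deg , b) = T₀⁺ v∈ deg (≤-antisym (lin b (cancel (β v))) (proj₁ (load v)))
    where
    cancel : ∀ b → 0ℤ - b ≡ 1ℤ - (b + 1ℤ)
    cancel = solve-∀

  tight-colorable : Colorable m β S
  tight-colorable = case choose (λ v → case v ∈? T₀ of λ
      { (inj₂ v∉) → inj₂ λ v∈ → ∈-contra v∈ v∉
      ; (inj₁ v∈) → case light-tri v∈ of λ { (inj₁ col) → inj₁ col ; (inj₂ t) → inj₂ λ _ → t } }) of λ
    { (inj₁ col) → col
    ; (inj₂ tris) → case choose (λ v → case v ∈? (S ∖ T₀) of λ
        { (inj₂ v∉) → inj₂ λ v∈ → ∈-contra v∈ v∉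
        ; (inj₁ v∈) → case classify v (∈-∖ˡ v∈) of λ
          { (inj₁ col) → inj₁ col
          ; (inj₂ (inj₁ light)) → ∈-contra (light→T₀ (∈-∖ˡ v∈) light) (∈-∖ʳ v∈)
          ; (inj₂ (inj₂ neg)) → case WithTris.heavy tris v (∈-∖ˡ v∈) neg of λ
            { (inj₁ col) → inj₁ col
            ; (inj₂ h) → inj₂ λ _ → neg , h } } }) of λ
      { (inj₁ col) → col
      ; (inj₂ good) → Counting.count tris (λ y y∈ → proj₁ (good y y∈)) (λ y y∈ → proj₂ (good y y∈)) } }

-- The induction on the number of vertices

module _ {N : ℕ} where

  step-one : (m : Mult N) {β : Fin N → ℤ} (load : DegreeOne.IsLoad {N} β) {S : VSet N} → DegreeOne.Sparse m β S → DegreeOne.Below S → DegreeOne.Colorable m β S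
  step-one m {β} load {S} sparse below = case gap₄ of λ
    { (inj₁ col) → col
    ; (inj₂ gap) → FinalCount.tight-colorable m load sparse below gap }
    where
    open DegreeOne {N}
    next : ∀ {g} t → 0ℤ ≤ t → g ≤ + 3 → - 1ℤ ≤ g - + 2 * t → g ≤ 0ℤ ⊎ 1ℤ ≤ t × (g ≤ + 2 ⊎ + 2 ≤ t) →
      Colorable m β S ⊎ Gap m β S g → Colorable m β S ⊎ Gap m β S (g + 1ℤ)
    next t a b c d (inj₁ col) = inj₁ col
    next t a b c d (inj₂ gap) = gap-step m load sparse below t a b c d gap
    ≤ℕ : ∀ {a b} → a ℕ.≤ b → + a ≤ + b
    ≤ℕ = +≤+
    1≤2 : 1 ℕ.≤ 2
    1≤2 = ℕ.s≤s ℕ.z≤n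
    gap₄ : Colorable m β S ⊎ Gap m β S (+ 4)
    gap₄ = next {+ 3} (+ 2) (0≤+ 2) ≤-refl ≤-refl (inj₂ (≤ℕ 1≤2 , inj₂ ≤-refl))
      (next {+ 2} 1ℤ (0≤+ 1) (≤ℕ (ℕ.s≤s (ℕ.s≤s ℕ.z≤n))) -≤+ (inj₂ (≤-refl , inj₁ ≤-refl))
      (next {+ 1} 1ℤ (0≤+ 1) (≤ℕ (ℕ.s≤s ℕ.z≤n)) ≤-refl (inj₂ (≤-refl , inj₁ (≤ℕ 1≤2)))
      (next {0ℤ} 0ℤ ≤-refl (0≤+ 3) -≤+ (inj₁ ≤-refl)
      (next { - 1ℤ } 0ℤ ≤-refl -≤+ ≤-refl (inj₁ -≤+) (inj₂ λ B B⊆ _ _ _ → sparse B B⊆)))))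

  module _ (D : ℤ) (1≤D : 1ℤ ≤ D) where
    open Reduction {N} D 1≤D

    color-step : (m : Mult N) {β : Fin N → ℤ} (load : IsLoad β) {S : VSet N} → Sparse m β S → Below S → Colorable m β S
    color-step m load sparse below = case D ≤⊎> 1ℤ of λ
      { (inj₂ 2≤D) → Critical.step-large m load sparse below 2≤D
      ; (inj₁ D≤1) → small (≤-antisym 1≤D D≤1) 1≤D load sparse below }
      where
      small : ∀ {D} → 1ℤ ≡ D → (1≤D : 1ℤ ≤ D) → ∀ {β S} → Reduction.IsLoad {N} D 1≤D β → Reduction.Sparse D 1≤D m β S → Reduction.Below D 1≤D S → Reduction.Colorable D 1≤D m β S
      -- The opaque `ρ` also depends on the module parameter `1≤D`. Matching that proof down to its
      -- constructors identifies it with the `≤-refl` fixed in `DegreeOne`.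
      small refl (+≤+ (ℕ.s≤s ℕ.z≤n)) load sparse below = step-one m load sparse below

    sparse-colorable : ∀ k (m : Mult N) (β : Fin N → ℤ) (S : VSet N) → IsLoad β → size S ≤ + k → Sparse m β S → Colorable m β S
    sparse-colorable k m β S load bound sparse = color-step m load sparse (below k bound)
      where
      below : ∀ k → size S ≤ + k → Below S
      below ℕ.zero bound m′ β′ S′ load′ smaller _ = ⊥-elim (1≰0 (arith (size S′) (size S) (∑-nonneg (⟦⟧≥0 S′)) smaller bound))
        where
        arith : ∀ s t → 0ℤ ≤ s → s + 1ℤ ≤ t → t ≤ 0ℤ → 1ℤ ≤ 0ℤ
        arith s t p q r = lin (p ⊕ q ⊕ r) (solve (s ∷ t ∷ []))
      below (ℕ.suc k) bound m′ β′ S′ load′ smaller sparse′ = sparse-colorable k m′ β′ S′ load′ (arith (size S′) (size S) (+ k) smaller bound) sparse′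
        where
        arith : ∀ s t k → s + 1ℤ ≤ t → t ≤ 1ℤ + k → s ≤ k
        arith s t k p q = lin (p ⊕ q) (solve (s ∷ t ∷ k ∷ []))

-- Multigraphs

length-filter : ∀ {A : Set} {k} (f : A → Bool) (g : Fin k → A) → + length (filterᵇ f (List.tabulate g)) ≡ sum (λ i → χ (f (g i)))
length-filter {k = ℕ.zero}  f g = sym (∑-zero λ ())
length-filter {k = ℕ.suc k} f g = trans head-tail (sym (∑-suc _))
  where
  head-tail : + length (filterᵇ f (List.tabulate g)) ≡ χ (f (g zero)) + sum (λ i → χ (f (g (suc i))))
  head-tail with f (g zero)
  ... | true  = cong (_+_ 1ℤ) (length-filter f (g ∘ suc))
  ... | false = trans (length-filter f (g ∘ suc)) (sym (+-identityˡ _))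

card-tabulate : ∀ {k} (B : VSet k) → + Sub.∣ tabulate B ∣ ≡ size B
card-tabulate {ℕ.zero}  B = sym (∑-zero λ ())
card-tabulate {ℕ.suc k} B = trans head-tail (sym (∑-suc _))
  where
  head-tail : + Sub.∣ tabulate B ∣ ≡ χ (B zero) + size (B ∘ suc)
  head-tail with B zero
  ... | true  = cong (_+_ 1ℤ) (card-tabulate (B ∘ suc))
  ... | false = trans (card-tabulate (B ∘ suc)) (sym (+-identityˡ _))

open import Defs

module FromMultigraph (G : Multigraph) where

  V = Fin (n G)
  p q : Fin (m G) → V
  p e = proj₁ (ends G e)
  q e = proj₂ (ends G e)

  μG : Mat (n G)
  μG u v = sum λ e → link (p e) (q e) u v

  mult : Mult (n G)
  mult = record
    { μ     = μG
    ; μ-sym = λ u v → ∑-cong λ e → link-sym (p e) (q e) u v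
    ; μ≥0   = λ u v → ∑-nonneg λ e → link≥0 (p e) (q e) u v
    ; μ-irr = λ v → ∑-zero λ e → link-irr (loopless G e) v
    }

  row-edges : ∀ v a → row μG v a ≡ sum (λ e → δ (p e) v * a (q e) + δ (q e) v * a (p e))
  row-edges v a = trans (row-dot μG v a) (trans (dot-sum a (λ e → link (p e) (q e) v)) (∑-cong λ e → dot-link a (p e) (q e) v))

  quad-edges : ∀ a → quad μG a a ≡ sum (λ e → + 2 * (a (p e) * a (q e)))
  quad-edges a = trans (quad-dot μG a a) (trans (dot-cong {a = a} (λ _ → refl) (λ v → row-edges v a))
    (trans (dot-sum a (λ e v → δ (p e) v * a (q e) + δ (q e) v * a (p e))) (∑-cong λ e → trans (dot-ends a a (p e) (q e)) (double (a (p e)) (a (q e))))))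
    where
    double : ∀ s t → s * t + t * s ≡ + 2 * (s * t)
    double = solve-∀

  edgesIn-quad : ∀ B → quad μG ⟦ B ⟧ ⟦ B ⟧ ≡ + 2 * + edgesIn G (tabulate B)
  edgesIn-quad B = trans (quad-edges ⟦ B ⟧) (trans (sym (∑-*ˡ (+ 2) (λ e → ⟦ B ⟧ (p e) * ⟦ B ⟧ (q e)))) (cong (_*_ (+ 2)) (sym (trans (length-filter _ (λ e → e)) (∑-cong λ e →
    trans (cong₂ (λ s t → χ (s ∧ t)) (lookup∘tabulate B (p e)) (lookup∘tabulate B (q e))) (χ-∧ (B (p e)) (B (q e))))))))
    where
    χ-∧ : ∀ a b → χ (a ∧ b) ≡ χ a * χ b
    χ-∧ true  b = sym (*-identityˡ (χ b))
    χ-∧ false b = sym (*-zeroˡ (χ b))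

  -- The disjunction over the two ends of an edge is bounded by the sum over them, and the row is
  -- that sum over all edges.
  degreeIn-row : ∀ c v → + degreeIn G (tabulate c) v ≤ row μG v ⟦ c ⟧
  degreeIn-row c v = subst₂ _≤_ (sym (length-filter _ (λ e → e))) (sym (row-edges v ⟦ c ⟧)) (∑-mono λ e →
    ≤-trans (χ-∨ ((toℕ (p e) ℕ.≡ᵇ toℕ v) ∧ lookup (tabulate c) (q e)) _) (end (p e) (q e) ⊕ end (q e) (p e)))
    where
    χ-∨ : ∀ a b → χ (a ∨ b) ≤ χ a + χ b
    χ-∨ true  b = padʳ ≤-refl (χ≥0 b)
    χ-∨ false b = ≤-reflexive (sym (+-identityˡ (χ b)))
    end : ∀ s t → χ ((toℕ s ℕ.≡ᵇ toℕ v) ∧ lookup (tabulate c) t) ≤ δ s v * χ (c t)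
    end s t = subst (λ b → χ ((toℕ s ℕ.≡ᵇ toℕ v) ∧ b) ≤ δ s v * χ (c t)) (sym (lookup∘tabulate c t)) (case s ≟ v of λ
      { (yes refl) → ≤-trans (χ-mono λ r → proj₂ (∧-true {toℕ s ℕ.≡ᵇ toℕ s} r)) (≤-reflexive (sym (trans (cong (_* χ (c t)) (δ-refl s)) (*-identityˡ (χ (c t))))))
      ; (no s≢v) → ≤-trans (χ-mono {b = false} λ r → ⊥-elim (s≢v (toℕ-injective (ℕ.≡ᵇ⇒≡ (toℕ s) (toℕ v) (to-T (proj₁ (∧-true r))))))) (*-nonneg (χ≥0 (s == v)) (χ≥0 (c t))) })
      where
      to-T : ∀ {b} → b ≡ true → Bool.T b
      to-T refl = _

  -- The k + 2 vertices of a cycle span at least k + 2 edges.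
  no-cycle : ∀ {P A} → Acyclic μG P → (∀ v → v Sub.∈ A → v ∈ P) → CycleIn G A → ⊥
  no-cycle {P} {A} acyclic A⊆P cyc = 1≰0 (arith (+ k) (quad μG ⟦ B ⟧ ⟦ B ⟧) (size B) (acyclic B B⊆P (vs zero) (vs∈ zero)) size≤ quad≥)
    where
    open CycleIn cyc
    B : VSet (n G)
    B u = does (any? λ i → vs i ≟ u)
    vs∈ : ∀ i → vs i ∈ B
    vs∈ i = mem (dec-true (any? λ j → vs j ≟ vs i) (i , refl))
    B⁻ : ∀ {u} → u ∈ B → ∃[ i ] vs i ≡ u
    B⁻ {u} (mem h) = from-does (any? λ i → vs i ≟ u) h
    B⊆P : B ⊆ P
    B⊆P u u∈ = let i , e = B⁻ u∈ in subst (_∈ P) e (A⊆P (vs i) (vs-in i))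
    ones : ∀ j → sum {j} (λ _ → 1ℤ) ≡ + j
    ones ℕ.zero    = ∑-zero λ ()
    ones (ℕ.suc j) = trans (∑-suc _) (cong (_+_ 1ℤ) (ones j))
    size≤ : size B ≤ + (ℕ.suc (ℕ.suc k))
    size≤ = subst (size B ≤_) (trans (∑-comm (λ u i → δ (vs i) u)) (trans (∑-cong λ i → trans (∑-cong λ u → sym (*-identityʳ (δ (vs i) u))) (∑-δ (vs i) λ _ → 1ℤ)) (ones (ℕ.suc (ℕ.suc k)))))
      (∑-mono λ u → case u ∈? B of λ
        { (inj₂ u∉) → subst (_≤ sum (λ i → δ (vs i) u)) (sym (⟦⟧-∉ u∉)) (∑-nonneg λ i → χ≥0 (vs i == u))
        ; (inj₁ u∈) → let i , e = B⁻ u∈ in ≤-trans (χ≤1 (B u)) (≤-trans (≤-reflexive (sym (trans (cong (δ (vs i)) (sym e)) (δ-refl (vs i))))) (∑-term (λ i → χ≥0 (vs i == u)) i)) })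
    joined : ∀ {e u v} → Joins G e u v → u ∈ B → v ∈ B → p e ∈ B × q e ∈ B
    joined (inj₁ h) u∈ v∈ = subst (_∈ B) (sym (cong proj₁ h)) u∈ , subst (_∈ B) (sym (cong proj₂ h)) v∈
    joined (inj₂ h) u∈ v∈ = subst (_∈ B) (sym (cong proj₁ h)) v∈ , subst (_∈ B) (sym (cong proj₂ h)) u∈
    es∈ : ∀ i → p (es i) ∈ B × q (es i) ∈ B
    es∈ i with view i
    ... | ‵fromℕ         = joined close (vs∈ (fromℕ (ℕ.suc k))) (vs∈ zero)
    ... | ‵inj₁ {i = j} _ = joined (step j) (vs∈ (inject₁ j)) (vs∈ (suc j))
    -- By `es-inj` an edge occurs at most once on the cycle, so the left side is at most 1, and it
    -- is 1 only for edges with both ends in `B`.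
    used : ∀ e → sum (λ i → δ (es i) e) ≤ ⟦ B ⟧ (p e) * ⟦ B ⟧ (q e)
    used e = case any? (λ i → es i ≟ e) of λ
      { (no ¬h) → ≤-trans (≤-reflexive (∑-zero λ i → δ-≢ λ h → ¬h (i , h))) (*-nonneg (⟦⟧≥0 B (p e)) (⟦⟧≥0 B (q e)))
      ; (yes (i₀ , refl)) → ≤-reflexive (trans (∑-cong λ i → trans (same i₀ i) (sym (*-identityʳ (δ i₀ i)))) (trans (∑-δ i₀ λ _ → 1ℤ)
          (sym (cong₂ _*_ (⟦⟧-∈ (proj₁ (es∈ i₀))) (⟦⟧-∈ (proj₂ (es∈ i₀))))))) }
      where
      same : ∀ i₀ i → δ (es i) (es i₀) ≡ δ i₀ i
      same i₀ i = case i₀ ≟ i of λ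
        { (yes refl) → trans (δ-refl (es i₀)) (sym (δ-refl i₀))
        ; (no ne) → trans (δ-≢ λ h → ne (sym (es-inj h))) (sym (δ-≢ ne)) }
    quad≥ : + 2 * + (ℕ.suc (ℕ.suc k)) ≤ quad μG ⟦ B ⟧ ⟦ B ⟧
    quad≥ = subst₂ _≤_ (cong (_*_ (+ 2)) (trans (∑-comm (λ e i → δ (es i) e)) (trans (∑-cong λ i → trans (∑-cong λ e → sym (*-identityʳ (δ (es i) e))) (∑-δ (es i) λ _ → 1ℤ)) (ones (ℕ.suc (ℕ.suc k))))))
      (trans (∑-*ˡ (+ 2) (λ e → ⟦ B ⟧ (p e) * ⟦ B ⟧ (q e))) (sym (quad-edges ⟦ B ⟧))) (*-monoˡ (+ 2) (0≤+ 2) (∑-mono used))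
    arith : ∀ k q s → q + + 2 ≤ + 2 * s → s ≤ + 2 + k → + 2 * (+ 2 + k) ≤ q → 1ℤ ≤ 0ℤ
    arith k q s a b c = lin (a ⊕ b ⊕ b ⊕ c ⊕ 0≤+ 1) (solve (k ∷ q ∷ s ∷ []))

  module _ (D : ℕ) (1≤D : 1 ℕ.≤ D) (sparse : SparseD D G) where
    open Reduction {n G} (+ D) (+≤+ 1≤D)

    all : VSet (n G)
    all _ = true

    no-load : V → ℤ
    no-load _ = 0ℤ

    sparseG : Sparse mult no-load all
    sparseG B _ two = subst (- 1ℤ ≤_) (sym (trans (ρ-def mult no-load ⟦ B ⟧) (cong₂ (λ s t → s - (+ D + 1ℤ) * t) (dot-size B (+ 4 * + D + + 3 - + 2 * 0ℤ)) (edgesIn-quad B))))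
      (arith (+ D) (size B) (+ edgesIn G (tabulate B)) (subst (λ s → + 2 * (1ℤ + + D) * + edgesIn G (tabulate B) ≤ (+ 4 * + D + + 3) * s + 1ℤ) (card-tabulate B) cast))
      where
      card≥2 : 2 ℕ.≤ Sub.∣ tabulate B ∣
      card≥2 = drop‿+≤+ (subst (+ 2 ≤_) (sym (card-tabulate B)) two)
      cast : + 2 * (1ℤ + + D) * + edgesIn G (tabulate B) ≤ (+ 4 * + D + + 3) * + Sub.∣ tabulate B ∣ + 1ℤ
      cast = subst₂ _≤_ (trans (pos-* (2 ℕ.* ℕ.suc D) _) (cong (_* + edgesIn G (tabulate B)) (pos-* 2 (ℕ.suc D))))
        (cong (_+ 1ℤ) (trans (pos-* (4 ℕ.* D ℕ.+ 3) _) (cong (_* + Sub.∣ tabulate B ∣) (cong (_+ + 3) (pos-* 4 D)))))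
        (+≤+ (sparse (tabulate B) card≥2))
      arith : ∀ d s e → + 2 * (1ℤ + d) * e ≤ (+ 4 * d + + 3) * s + 1ℤ → - 1ℤ ≤ (+ 4 * d + + 3 - + 2 * 0ℤ) * s - (d + 1ℤ) * (+ 2 * e)
      arith d s e h = lin h (solve (d ∷ s ∷ e ∷ []))

    coloring : DFColoring D G
    coloring =
      let c , C = sparse-colorable (+ D) (+≤+ 1≤D) (n G) mult no-load all (λ v → ≤-refl , 0≤+ _) (≤-reflexive (trans (sym (card-tabulate all)) (cong +_ refl-card))) sparseG in
      tabulate c ,
      no-cycle (forestM C) (λ v v∈ → ∈-∩⁺ (mem refl) (mem (in-c c v v∈))) ,
      (λ v v∈ → drop‿+≤+ (≤-trans (degreeIn-row c v) (≤-trans (row-mono (Mult.μ≥0 mult) v (⟦⟧-mono {A = c} {all ∩ c} λ u u∈ → ∈-∩⁺ (mem refl) u∈))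
        (subst (_≤ + D) (+-identityʳ (row μG v ⟦ all ∩ c ⟧)) (degree C v (mem refl) (mem (in-c c v v∈))))))) ,
      no-cycle (forestF C) (λ v v∈ → ∈-∖⁺ (mem refl) (nmem (not-true (trans (sym (cong not (lookup∘tabulate c v))) (trans (sym (lookup-map v not (tabulate c))) ([]=⇒lookup v∈))))))
      where
      in-c : ∀ c v → v Sub.∈ tabulate c → c v ≡ true
      in-c c v v∈ = trans (sym (lookup∘tabulate c v)) ([]=⇒lookup v∈)
      refl-card : Sub.∣ tabulate all ∣ ≡ n G
      refl-card = go (n G)
        where
        go : ∀ k → Sub.∣ tabulate {n = k} (λ _ → true) ∣ ≡ k
        go ℕ.zero = refl
        go (ℕ.suc k) = cong ℕ.suc (go k)

theorem1p1 : (D : ℕ) → 1 ℕ.≤ D → (G : Multigraph) → SparseD D G → DFColoring D G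
theorem1p1 D 1≤D G sparse = FromMultigraph.coloring G D 1≤D sparse
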